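{- Let $G$ be a threshold graph on $\{0,1,\dots,n\}$, labeled by reverse degree sequence, with edges directed from $i$ to $j$ when $i>j$, and let $\mathbf a=(a_1,\dots,a_n)\in\mathbb Z_{>0}^n$. (a) Let $\widetilde G$ be the multigraph obtained from $G$ by replacing each edge $(i,j)$ by $a_{\max\{i,j\}}$ parallel edges. If $G$ is connected, then $\operatorname{Ehr}_{q,1}(\mathcal F_G(\mathbf a))=t_{\widetilde G}(1,q)$. (b) For any spanning tree $T$ of $G$, let \[w(T)=\prod_{(i,j)\in E(T)}[a_{\max\{i,j\}}]_q\cdot\prod_{(i,j)\in\operatorname{Inv}(T)} q^{a_{\max\{p_T(i),j\}}}.\] Then $\operatorname{Ehr}_{q,1}(\mathcal F_G(\mathbf a))=\sum_T w(T)$, where $T$ ranges over all spanning trees of $G$.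
   Context: A threshold graph is built from one vertex by repeatedly adding a dominating vertex or an isolated vertex; labeled by reverse degree sequence means vertices $0,\dots,n$ with $d_i\ge d_j$ for $i<j$. $\mathcal F_G(\mathbf a)$ is the set of $x\in\mathbb R_{\ge0}^E$ such that for each vertex $k\ge1$ the flow out of $k$ (on edges to smaller vertices) minus the flow into $k$ equals $a_k$, and the net flow at $0$ is $-\sum a_i$. $wt_{q,t}(b)=\frac{q^b-t^b}{q-t}$ for $b>0$, $wt_{q,t}(0)=1$; for an integer flow $A=(a_{ij})$, $wt_{q,t}(A)=(-(1-t)(1-q))^{\#\{a_{ij}>0\}-n}\prod wt_{q,t}(a_{ij})$; $\operatorname{Ehr}_{q,t}(\mathcal F_G(\mathbf a))=\sum_{A\in\mathcal F_G(\mathbf a)\cap\mathbb Z^E}wt_{q,t}(A)$. The Tutte polynomial of a multigraph $H=(V,E)$ is $t_H(x,y)=\sum_{A\subseteq E}(x-1)^{k(A)-k(E)}(y-1)^{k(A)+|A|-|V|}$. Spanning trees are rooted at $0$; $E(T)$ is the edge set, $p_T(i)$ the parent of $i$ (its neighbor on the tree path from $0$ to $i$); $v$ is a descendant of $u$ if $u$ lies on the tree path from $0$ to $v$. $\operatorname{Inv}(T)$ is the set of inversions: pairs $(i,j)$ with $i\neq0$, $i>j$, $j$ a descendant of $i$. $[k]_q=1+q+\dots+q^{k-1}$. -}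

module Defs where

open import Level using (Level)
open import Data.Nat as ℕ using (ℕ; zero; suc; _∸_; _<ᵇ_)
open import Data.Fin as Fin using (Fin; zero; suc; toℕ)
open import Data.Fin.Permutation using (Permutation′; _⟨$⟩ʳ_)
open import Data.Bool using (Bool; true; false; if_then_else_; _∧_; _∨_; not)
open import Data.List as List using (List; []; _∷_; allFin; filterᵇ; concatMap; replicate; length; foldr)
open import Data.Vec as Vec using (Vec)
open import Data.Product using (_×_; _,_; proj₁; proj₂; Σ; ∃)
open import Relation.Binary.PropositionalEquality using (_≡_; _≢_)
open import Relation.Nullary.Decidable using (⌊_⌋)
open import Function using (_∘_)
open import Data.Nat.ListAction using () renaming (sum to sumL)
open import Algebra.Bundles using (CommutativeRing; Semiring)
import Algebra.Definitions.RawSemiring as RS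

_==_ : ∀ {m} → Fin m → Fin m → Bool
u == v = ⌊ u Fin.≟ v ⌋

maxV : ∀ {m} → Fin m → Fin m → Fin m
maxV u v = if toℕ u <ᵇ toℕ v then v else u

countᵇ : ∀ {A : Set} → (A → Bool) → List A → ℕ
countᵇ p xs = length (filterᵇ p xs)

anyᵇ : ∀ {A : Set} → (A → Bool) → List A → Bool
anyᵇ p = foldr (λ x b → p x ∨ b) false

allᵇ : ∀ {A : Set} → (A → Bool) → List A → Bool
allᵇ p = foldr (λ x b → p x ∧ b) true

allVecs : ∀ {A : Set} → List A → (m : ℕ) → List (Vec A m)
allVecs xs zero    = Vec.[] ∷ []
allVecs xs (suc m) = concatMap (λ x → List.map (x Vec.∷_) (allVecs xs m)) xs

iterate : ∀ {A : Set} → (A → A) → ℕ → A → A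
iterate f zero    x = x
iterate f (suc k) x = f (iterate f k x)

Graph : ℕ → Set
Graph n = Fin (suc n) → Fin (suc n) → Bool

-- Threshold graph: there is an order of creation (a bijection from the
-- vertices to the creation steps 0..n) and, for each step, a choice of
-- "dominating" (true) or "isolated" (false), such that two distinct
-- vertices are adjacent iff the later-created one was added as a
-- dominating vertex.  Loops are absent.
record IsThreshold {n : ℕ} (G : Graph n) : Set where
  field
    order     : Permutation′ (suc n)
    dominating : Fin (suc n) → Bool
    irrefl    : ∀ v → G v v ≡ false
    adjacency : ∀ u v → u ≢ v →
                G u v ≡ dominating (maxV (order ⟨$⟩ʳ u) (order ⟨$⟩ʳ v))

degree : ∀ {n} → Graph n → Fin (suc n) → ℕ
degree G v = countᵇ (G v) (allFin _)

ReverseDegreeLabeled : ∀ {n} → Graph n → Set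
ReverseDegreeLabeled {n} G = ∀ (i j : Fin (suc n)) → i Fin.< j → degree G j ℕ.≤ degree G i

data Walk {n : ℕ} (G : Graph n) : Fin (suc n) → Fin (suc n) → Set where
  here : ∀ {u} → Walk G u u
  step : ∀ {u v w} → G u v ≡ true → Walk G v w → Walk G u w

Connected : ∀ {n} → Graph n → Set
Connected {n} G = ∀ (u v : Fin (suc n)) → Walk G u v

-- Edge list of G: directed pairs (i , j) with i > j, i.e. directed from i to j
Edge : ℕ → Set
Edge n = Fin (suc n) × Fin (suc n)

edges : ∀ {n} → Graph n → List (Edge n)
edges {n} G = concatMap (λ i → List.map (i ,_)
                (filterᵇ (λ j → (toℕ j <ᵇ toℕ i) ∧ G i j) (allFin (suc n))))
              (allFin (suc n))

nE : ∀ {n} → Graph n → ℕ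
nE G = length (edges G)

-- a = (a_1,...,a_n) given as a : Fin n → ℕ, a_{k+1} = a k.
-- aAt a v = a_v for v ≥ 1 (and 0 at the vertex 0, never used).
aAt : ∀ {n} → (Fin n → ℕ) → Fin (suc n) → ℕ
aAt a zero    = 0
aAt a (suc k) = a k

sumℕ : ∀ {n} → (Fin n → ℕ) → ℕ
sumℕ a = sumL (List.map a (allFin _))

-- Integer flows: a flow is a vector of nonnegative integers indexed by
-- the edge list (edges G).

labelled : ∀ {n} (G : Graph n) → Vec ℕ (nE G) → List (Edge n × ℕ)
labelled G x = Vec.toList (Vec.zip (Vec.fromList (edges G)) x)

outflow : ∀ {n} (G : Graph n) → Vec ℕ (nE G) → Fin (suc n) → ℕ
outflow G x k = sumL (List.map proj₂ (filterᵇ (λ e → proj₁ (proj₁ e) == k) (labelled G x)))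

inflow : ∀ {n} (G : Graph n) → Vec ℕ (nE G) → Fin (suc n) → ℕ
inflow G x k = sumL (List.map proj₂ (filterᵇ (λ e → proj₂ (proj₁ e) == k) (labelled G x)))

-- x ∈ F_G(a) ∩ ℤ^E (nonnegativity is built into ℕ)
IsIntFlow : ∀ {n} (G : Graph n) (a : Fin n → ℕ) → Vec ℕ (nE G) → Set
IsIntFlow {n} G a x =
  (∀ (k : Fin n) → outflow G x (suc k) ≡ a k ℕ.+ inflow G x (suc k))
  × (inflow G x zero ≡ sumℕ a ℕ.+ outflow G x zero)

numPositive : ∀ {m} → Vec ℕ m → ℕ
numPositive x = countᵇ (λ b → 0 <ᵇ b) (Vec.toList x)

multiEdges : ∀ {n} → Graph n → (Fin n → ℕ) → List (Edge n)
multiEdges G a = concatMap (λ e → replicate (aAt a (maxV (proj₁ e) (proj₂ e))) e) (edges G)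

reachIn : ∀ {n} → List (Edge n) → ℕ → Fin (suc n) → Fin (suc n) → Bool
reachIn es zero    u v = u == v
reachIn es (suc s) u v = reachIn es s u v ∨
  anyᵇ (λ e → (reachIn es s u (proj₁ e) ∧ (proj₂ e == v)) ∨
              (reachIn es s u (proj₂ e) ∧ (proj₁ e == v))) es

reach : ∀ {n} → List (Edge n) → Fin (suc n) → Fin (suc n) → Bool
reach {n} es = reachIn es (suc n)

-- number of connected components of (Fin (suc n), es): number of vertices
-- that are the smallest vertex of their component
components : ∀ {n} → List (Edge n) → ℕ
components {n} es = countᵇ (λ v → not (anyᵇ (λ u → (toℕ u <ᵇ toℕ v) ∧ reach es u v) (allFin (suc n))))
                           (allFin (suc n))

select : ∀ {A : Set} → List A → List Bool → List A
select []       bs          = []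
select (x ∷ xs) []          = []
select (x ∷ xs) (b ∷ bs)    = if b then x ∷ select xs bs else select xs bs

module _ {c ℓ : Level} (R : CommutativeRing c ℓ) where
  open CommutativeRing R using (Carrier; _+_; _*_; -_; _-_; 0#; 1#; semiring)
  open RS (Semiring.rawSemiring semiring) using (_^_)

  Σᴿ : ∀ {A : Set} → List A → (A → Carrier) → Carrier
  Σᴿ xs f = foldr (λ x s → f x + s) 0# xs

  Πᴿ : ∀ {A : Set} → List A → (A → Carrier) → Carrier
  Πᴿ xs f = foldr (λ x s → f x * s) 1# xs

  qInt : Carrier → ℕ → Carrier
  qInt q k = Σᴿ (List.upTo k) (λ i → q ^ i)

  -- wt_{q,t}(b) = (q^b - t^b)/(q - t) = Σ_{i<b} q^i t^(b-1-i) for b > 0,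
  -- and wt_{q,t}(0) = 1
  wtQT : Carrier → Carrier → ℕ → Carrier
  wtQT q t zero    = 1#
  wtQT q t (suc b) = Σᴿ (List.upTo (suc b)) (λ i → (q ^ i) * (t ^ (b ∸ i)))

  flowWt : Carrier → Carrier → (n : ℕ) → ∀ {m} → Vec ℕ m → Carrier
  flowWt q t n x = ((- ((1# - t) * (1# - q))) ^ (numPositive x ∸ n))
                   * Πᴿ (Vec.toList x) (wtQT q t)

  -- Ehr_{q,t}(F_G(a)) computed over a list L of lattice points
  -- (the theorem requires L to enumerate F_G(a) ∩ ℤ^E exactly once each)
  EhrOver : Carrier → Carrier → ∀ {n} (G : Graph n) → List (Vec ℕ (nE G)) → Carrier
  EhrOver q t {n} G L = Σᴿ L (flowWt q t n)

  tutte : ∀ {n} → List (Edge n) → Carrier → Carrier → Carrier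
  tutte {n} es x y =
    Σᴿ (allVecs (true ∷ false ∷ []) (length es)) (λ S →
      let A = select es (Vec.toList S) in
      ((x - 1#) ^ (components A ∸ components es))
      * ((y - 1#) ^ ((components A ℕ.+ length A) ∸ suc n)))

  -- Spanning trees of G rooted at 0, encoded by their parent vectors:
  -- p (k) = p_T(k+1) is the parent of the vertex k+1.
  parentOf : ∀ {n} → Vec (Fin (suc n)) n → Fin (suc n) → Fin (suc n)
  parentOf p zero    = zero
  parentOf p (suc k) = Vec.lookup p k

  -- p encodes a spanning tree of G: every edge {v , p_T(v)} is an edge
  -- of G and following parents from any vertex reaches the root 0
  -- (i.e. the n edges {v , p_T(v)} form an acyclic, hence spanning, tree)
  isSpanningTreeᵇ : ∀ {n} → Graph n → Vec (Fin (suc n)) n → Bool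
  isSpanningTreeᵇ {n} G p =
    allᵇ (λ k → G (suc k) (parentOf p (suc k))) (allFin n)
    ∧ allᵇ (λ v → iterate (parentOf p) n v == zero) (allFin (suc n))

  spanningTrees : ∀ {n} → Graph n → List (Vec (Fin (suc n)) n)
  spanningTrees {n} G = filterᵇ (isSpanningTreeᵇ G) (allVecs (allFin (suc n)) n)

  descendantᵇ : ∀ {n} → Vec (Fin (suc n)) n → Fin (suc n) → Fin (suc n) → Bool
  descendantᵇ {n} p v u = anyᵇ (λ k → iterate (parentOf p) k v == u) (List.upTo (suc n))

  isInversionᵇ : ∀ {n} → Vec (Fin (suc n)) n → Fin (suc n) × Fin (suc n) → Bool
  isInversionᵇ p (i , j) = not (i == zero) ∧ (toℕ j <ᵇ toℕ i) ∧ descendantᵇ p j i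

  allPairs : (n : ℕ) → List (Fin (suc n) × Fin (suc n))
  allPairs n = concatMap (λ i → List.map (i ,_) (allFin (suc n))) (allFin (suc n))

  treeWeight : Carrier → ∀ {n} → (Fin n → ℕ) → Vec (Fin (suc n)) n → Carrier
  treeWeight q {n} a p =
    Πᴿ (allFin n) (λ k → qInt q (aAt a (maxV (suc k) (parentOf p (suc k)))))
    * Πᴿ (filterᵇ (isInversionᵇ p) (allPairs n))
         (λ ij → q ^ aAt a (maxV (parentOf p (proj₁ ij)) (proj₂ ij)))

{-# OPTIONS --safe #-}

-- Reverse degree labelling makes a threshold graph shifted: if j ~ k, i < j and i ≠ k, then i ~ k.
-- Let K be the generating function of the connected spanning subgraphs A of G̃ by (q - 1)^(|A| - n).
-- It is t_G̃(1,q), and it obeys deletion-contraction for a bundle of m parallel edges: K(G̃) is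
-- K(deleted) + [m]_q K(contracted), a bundle of m loops contributing a factor q^m.
--
-- Flows: at t = 1 only the flows in which each vertex has exactly one positive out-edge survive.
-- Resolving the bundles at the largest vertex v, from its largest neighbour downwards, either
-- deletes (v,j) or merges v into j; by shiftedness the edges of v that are left are then those
-- that arise when a_j is replaced by a_j + a_v, which is what sending all the flow at v to j does.
--
-- Trees (after Gessel and Sagan): resolve the bundles in the order of a depth-first search from 0
-- which tries the largest candidate first. When c is visited, the bundles joining it to the active
-- vertices s that it may still be attached to become loops. They correspond to the inversions
-- (i,c), where i is the active child of s = p(i), since c may still be attached to s iff c < i;
-- shiftedness guarantees that s ~ c.
module Submission where

open import Defs
open import Level using (Level; _⊔_)
open import Data.Nat as ℕ using (ℕ; zero; suc; _≤_; _<_; _∸_; _<ᵇ_; z≤n; s≤s)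
import Data.Nat.Properties as ℕₚ
open import Data.Fin as Fin using (Fin; zero; suc; toℕ)
import Data.Fin.Properties as Finₚ
open import Data.Bool using (Bool; true; false; if_then_else_; _∧_; _∨_; not)
import Data.Bool.Properties as Boolₚ
open Boolₚ using (T-≡)
open import Data.List as List using (List; []; _∷_; _++_; allFin; filterᵇ; concatMap; length; foldr)
import Data.List.Properties as Listₚ
open import Data.List.Membership.Propositional using (_∈_; _∉_; find; lose)
open import Data.List.Membership.Propositional.Properties using (∈-allFin; ∈-concatMap⁺; ∈-concatMap⁻; ∈-map⁺; ∈-map⁻; ∈-filter⁺; ∈-filter⁻; ∈-upTo⁺)
open import Data.List.Relation.Unary.Any using (here; there)
open import Data.List.Relation.Unary.All as All using (All; []; _∷_)
open import Data.List.Relation.Unary.AllPairs as AllPairs using ([]; _∷_)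
import Data.List.Relation.Unary.All.Properties as Allₚ
import Data.List.Relation.Unary.AllPairs.Properties as AllPairsₚ
open import Data.List.Relation.Unary.Unique.Propositional using (Unique)
import Data.List.Relation.Unary.Unique.Propositional.Properties as Uniqueₚ
open import Data.Vec as Vec using (Vec)
import Data.Vec.Properties as Vecₚ
import Data.Nat.ListAction
open import Data.Product using (_×_; _,_; proj₁; proj₂; ∃)
import Data.Product.Properties as Productₚ
open import Data.Sum using (_⊎_; inj₁; inj₂)
open import Data.Empty using (⊥; ⊥-elim)
open import Function using (_∘_; id; Equivalence; case_of_)
open import Function.Bundles using (_⇔_)
open import Relation.Binary.PropositionalEquality as ≡ using (_≡_; _≢_; refl; cong; cong₂; sym; trans; subst; subst₂)
open import Relation.Binary.Definitions using (tri<; tri≈; tri>)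
open import Relation.Nullary using (¬_; Dec; yes; no; does)
open import Relation.Nullary.Decidable using (_→-dec_; _×-dec_; _⊎-dec_; ¬?)
open import Algebra.Bundles using (CommutativeMonoid; CommutativeRing; Semiring)
import Algebra.Definitions.RawSemiring as RS

-- Contraction is never carried out on vertices. The vertex set and the list `edges G` stay fixed: a
-- bundle is deleted by setting its multiplicity to 0 and contracted by putting its edge on a list
-- of prescribed edges. Loops and parallel edges are then recognised by connectivity through that
-- list, no quotient graph is formed, and shiftedness is always applied to G itself. The bracket [m]
-- is what a bundle of m edges contributes: k of them with k ≥ 1 connect like a single edge and
-- leave k - 1 redundant ones, and the sum of binomial(m,k) (q - 1)^(k-1) is [m]_q. The identities
-- used are polynomial in q - 1, so the argument runs in any commutative ring without division. No
-- bijection between flows, trees and subgraphs is built. Each recursion starts from all objects and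
-- ends with exactly one, matched by a spanning tree of prescribed edges, or with none, matched by a
-- disconnected graph. An inversion is a global feature of a tree; in the order of the search its
-- larger end is already on the stack when the smaller one is visited, which makes its factor local.

module BigOp {c ℓ} (M : CommutativeMonoid c ℓ) where
  open CommutativeMonoid M renaming (refl to ≈-refl; sym to ≈-sym; trans to ≈-trans)
  open import Algebra.Properties.CommutativeSemigroup commutativeSemigroup using (interchange)

  -- Instantiated at the two monoids of the ring this unfolds to the folds of `Σᴿ` and `Πᴿ`, so the
  -- sums and products of the theorem need no translation.
  ⨁ : {A : Set} → List A → (A → Carrier) → Carrier
  ⨁ xs f = foldr (λ x s → f x ∙ s) ε xs

  module _ {A : Set} where
    ⨁-cong : ∀ (xs : List A) {f g : A → Carrier} → (∀ {x} → x ∈ xs → f x ≈ g x) → ⨁ xs f ≈ ⨁ xs g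
    ⨁-cong []       h = ≈-refl
    ⨁-cong (x ∷ xs) h = ∙-cong (h (here refl)) (⨁-cong xs (h ∘ there))

    ⨁-ε : ∀ (xs : List A) {f : A → Carrier} → (∀ {x} → x ∈ xs → f x ≈ ε) → ⨁ xs f ≈ ε
    ⨁-ε []       h = ≈-refl
    ⨁-ε (x ∷ xs) h = ≈-trans (∙-cong (h (here refl)) (⨁-ε xs (h ∘ there))) (identityˡ ε)

    ⨁-++ : ∀ (xs ys : List A) (f : A → Carrier) → ⨁ (xs ++ ys) f ≈ ⨁ xs f ∙ ⨁ ys f
    ⨁-++ []       ys f = ≈-sym (identityˡ _)
    ⨁-++ (x ∷ xs) ys f = ≈-trans (∙-congˡ (⨁-++ xs ys f)) (≈-sym (assoc _ _ _))

    ⨁-∙ : ∀ (xs : List A) (f g : A → Carrier) → ⨁ xs (λ x → f x ∙ g x) ≈ ⨁ xs f ∙ ⨁ xs g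
    ⨁-∙ []       f g = ≈-sym (identityˡ ε)
    ⨁-∙ (x ∷ xs) f g = ≈-trans (∙-congˡ (⨁-∙ xs f g)) (interchange _ _ _ _)

    ⨁-filterᵇ : ∀ (p : A → Bool) (xs : List A) (f : A → Carrier) →
                ⨁ (filterᵇ p xs) f ≈ ⨁ xs (λ x → if p x then f x else ε)
    ⨁-filterᵇ p []       f = ≈-refl
    ⨁-filterᵇ p (x ∷ xs) f with p x
    ... | true  = ∙-congˡ (⨁-filterᵇ p xs f)
    ... | false = ≈-trans (⨁-filterᵇ p xs f) (≈-sym (identityˡ _))

    ⨁-single : ∀ {xs : List A} {f : A → Carrier} {y} → Unique xs → y ∈ xs →
               (∀ {x} → x ∈ xs → x ≢ y → f x ≈ ε) → ⨁ xs f ≈ f y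
    ⨁-single {x ∷ xs} (x∉ ∷ u) (here refl) h =
      ≈-trans (∙-congˡ (⨁-ε xs (λ z∈ → h (there z∈) (λ { refl → All.lookup x∉ z∈ refl })))) (identityʳ _)
    ⨁-single {x ∷ xs} (x∉ ∷ u) (there y∈) h =
      ≈-trans (∙-cong (h (here refl) (All.lookup x∉ y∈)) (⨁-single u y∈ (h ∘ there))) (identityˡ _)

  ⨁-map : ∀ {A B : Set} (g : A → B) (xs : List A) (f : B → Carrier) → ⨁ (List.map g xs) f ≈ ⨁ xs (f ∘ g)
  ⨁-map g []       f = ≈-refl
  ⨁-map g (x ∷ xs) f = ∙-congˡ (⨁-map g xs f)

  ⨁-concatMap : ∀ {A B : Set} (g : A → List B) (xs : List A) (f : B → Carrier) →
                ⨁ (concatMap g xs) f ≈ ⨁ xs (λ x → ⨁ (g x) f)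
  ⨁-concatMap g []       f = ≈-refl
  ⨁-concatMap g (x ∷ xs) f = ≈-trans (⨁-++ (g x) _ f) (∙-congˡ (⨁-concatMap g xs f))

  ⨁-comm : ∀ {A B : Set} (xs : List A) (ys : List B) (f : A → B → Carrier) →
           ⨁ xs (λ x → ⨁ ys (f x)) ≈ ⨁ ys (λ y → ⨁ xs (λ x → f x y))
  ⨁-comm []       ys f = ≈-sym (⨁-ε ys (λ _ → ≈-refl))
  ⨁-comm (x ∷ xs) ys f = ≈-trans (∙-congˡ (⨁-comm xs ys f)) (≈-sym (⨁-∙ ys _ _))

  ⨁-allFin-suc : ∀ n (f : Fin (suc n) → Carrier) → ⨁ (allFin (suc n)) f ≈ f zero ∙ ⨁ (allFin n) (f ∘ suc)
  ⨁-allFin-suc n f = ∙-congˡ (≈-trans (reflexive (cong (λ l → ⨁ l f) (≡.sym (Listₚ.map-tabulate id suc)))) (⨁-map suc (allFin n) f))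

  ⨁-allFin-single : ∀ {n} (y : Fin n) {f : Fin n → Carrier} → (∀ x → x ≢ y → f x ≈ ε) → ⨁ (allFin n) f ≈ f y
  ⨁-allFin-single y h = ⨁-single (Uniqueₚ.allFin⁺ _) (∈-allFin y) (λ {x} _ → h x)

  -- A Kronecker delta and an exchange of the two sums take the place of comparing the orders of
  -- `xs` and `allFin n`. It serves to confine the inversions of a vertex to the stack of the
  -- search.
  ⨁-support : ∀ {n} {xs : List (Fin n)} {f : Fin n → Carrier} → Unique xs →
              (∀ i → i ∉ xs → f i ≈ ε) → ⨁ (allFin n) f ≈ ⨁ xs f
  ⨁-support {n} {xs} {f} u h = begin
      ⨁ (allFin n) f                              ≈⟨ ⨁-cong (allFin n) (λ {i} _ → spread i) ⟩
      ⨁ (allFin n) (λ i → ⨁ xs (λ x → δ x i))     ≈⟨ ⨁-comm (allFin n) xs (λ i x → δ x i) ⟩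
      ⨁ xs (λ x → ⨁ (allFin n) (δ x))             ≈⟨ ⨁-cong xs (λ {x} _ → ≈-trans (⨁-allFin-single x (δ-≢ x)) (δ-refl x)) ⟩
      ⨁ xs f                                      ∎
    where
    open import Relation.Binary.Reasoning.Setoid setoid
    open import Data.List.Membership.DecPropositional (Finₚ._≟_ {n}) using (_∈?_)
    δ : Fin n → Fin n → Carrier
    δ x i = if does (x Finₚ.≟ i) then f x else ε
    δ-≢ : ∀ x i → i ≢ x → δ x i ≈ ε
    δ-≢ x i ne with x Finₚ.≟ i
    ... | yes e = ⊥-elim (ne (sym e))
    ... | no _  = ≈-refl
    δ-refl : ∀ x → δ x x ≈ f x
    δ-refl x with x Finₚ.≟ x
    ... | yes e = ≈-refl
    ... | no ne = ⊥-elim (ne refl)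
    spread : ∀ i → f i ≈ ⨁ xs (λ x → δ x i)
    spread i with i ∈? xs
    ... | yes i∈ = ≈-sym (≈-trans (⨁-single u i∈ (λ {x} _ ne → δ-≢ x i (ne ∘ sym))) (δ-refl i))
    ... | no i∉  = ≈-trans (h i i∉) (≈-sym (⨁-ε xs (λ {x} x∈ → δ-≢ x i (λ { refl → i∉ x∈ }))))

  ⨁-allVecs-suc : ∀ {A : Set} (xs : List A) m (f : Vec A (suc m) → Carrier) →
                  ⨁ (allVecs xs (suc m)) f ≈ ⨁ xs (λ x → ⨁ (allVecs xs m) (λ v → f (x Vec.∷ v)))
  ⨁-allVecs-suc xs m f = ≈-trans (⨁-concatMap _ xs f) (⨁-cong xs (λ {x} _ → ⨁-map (x Vec.∷_) (allVecs xs m) f))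

  ⨁-allVecs-single : ∀ {k} m (y : Vec (Fin k) m) {f : Vec (Fin k) m → Carrier} →
                     (∀ x → x ≢ y → f x ≈ ε) → ⨁ (allVecs (allFin k) m) f ≈ f y
  ⨁-allVecs-single zero    Vec.[]      h = identityʳ _
  ⨁-allVecs-single {k} (suc m) (y Vec.∷ v) {f} h = ≈-trans (⨁-allVecs-suc (allFin k) m f)
    (≈-trans (⨁-allFin-single y (λ x ne → ⨁-ε (allVecs (allFin k) m) (λ {w} _ → h (x Vec.∷ w) (ne ∘ cong Vec.head))))
             (⨁-allVecs-single m v (λ w ne → h (y Vec.∷ w) (ne ∘ cong Vec.tail))))

-- Boolean tests and their meaning

==-sound : ∀ {m} {u v : Fin m} → (u == v) ≡ true → u ≡ v
==-sound {u = u} {v} h with u Finₚ.≟ v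
... | yes e = e
==-sound () | no _

==-refl : ∀ {m} (u : Fin m) → (u == u) ≡ true
==-refl u with u Finₚ.≟ u
... | yes _ = refl
... | no ne = ⊥-elim (ne refl)

==-≢ : ∀ {m} {u v : Fin m} → u ≢ v → (u == v) ≡ false
==-≢ {u = u} {v} ne with u Finₚ.≟ v
... | yes e = ⊥-elim (ne e)
... | no _  = refl

<ᵇ-true : ∀ {m n} → m < n → (m <ᵇ n) ≡ true
<ᵇ-true p = Equivalence.to T-≡ (ℕₚ.<⇒<ᵇ p)

<ᵇ-sound : ∀ {m n} → (m <ᵇ n) ≡ true → m < n
<ᵇ-sound {m} p = ℕₚ.<ᵇ⇒< m _ (Equivalence.from T-≡ p)

true≢false : ∀ {b} → b ≡ true → b ≡ false → ⊥
true≢false refl ()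

¬true⇒false : ∀ {b} → ¬ (b ≡ true) → b ≡ false
¬true⇒false {true}  h = ⊥-elim (h refl)
¬true⇒false {false} h = refl

<ᵇ-false : ∀ {m n} → n ≤ m → (m <ᵇ n) ≡ false
<ᵇ-false p = ¬true⇒false (λ h → ℕₚ.<⇒≱ (<ᵇ-sound h) p)

∧-true : ∀ {a b} → (a ∧ b) ≡ true → (a ≡ true) × (b ≡ true)
∧-true {true} {true} _ = refl , refl

∨-true : ∀ {a b} → (a ∨ b) ≡ true → (a ≡ true) ⊎ (b ≡ true)
∨-true {true}  h = inj₁ refl
∨-true {false} h = inj₂ h

∨-trueʳ : ∀ a {b} → b ≡ true → (a ∨ b) ≡ true
∨-trueʳ true  h = refl
∨-trueʳ false h = h

module _ {A : Set} {p : A → Bool} where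
  anyᵇ-intro : ∀ {xs x} → x ∈ xs → p x ≡ true → anyᵇ p xs ≡ true
  anyᵇ-intro {x ∷ xs} (here refl) h = cong (_∨ anyᵇ p xs) h
  anyᵇ-intro {x ∷ xs} (there x∈)  h = ∨-trueʳ (p x) (anyᵇ-intro x∈ h)

  anyᵇ-elim : ∀ xs → anyᵇ p xs ≡ true → ∃ λ x → (x ∈ xs) × (p x ≡ true)
  anyᵇ-elim (x ∷ xs) h with ∨-true {p x} h
  ... | inj₁ px = x , here refl , px
  ... | inj₂ h' = let (z , z∈ , pz) = anyᵇ-elim xs h' in z , there z∈ , pz

  allᵇ-intro : ∀ xs → (∀ {x} → x ∈ xs → p x ≡ true) → allᵇ p xs ≡ true
  allᵇ-intro []       h = refl
  allᵇ-intro (x ∷ xs) h = cong₂ _∧_ (h (here refl)) (allᵇ-intro xs (h ∘ there))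

  allᵇ-elim : ∀ {xs x} → allᵇ p xs ≡ true → x ∈ xs → p x ≡ true
  allᵇ-elim h (here refl) = proj₁ (∧-true h)
  allᵇ-elim h (there x∈)  = allᵇ-elim (proj₂ (∧-true h)) x∈

-- Sums of natural numbers and counting

module Sumℕ = BigOp ℕₚ.+-0-commutativeMonoid
open Sumℕ using () renaming (⨁ to Σℕ)

𝟙 : Bool → ℕ
𝟙 b = if b then 1 else 0

module _ {A : Set} where
  Σℕ-mono : ∀ (xs : List A) {f g : A → ℕ} → (∀ {x} → x ∈ xs → f x ≤ g x) → Σℕ xs f ≤ Σℕ xs g
  Σℕ-mono []       h = z≤n
  Σℕ-mono (x ∷ xs) h = ℕₚ.+-mono-≤ (h (here refl)) (Σℕ-mono xs (h ∘ there))

  Σℕ-mono-< : ∀ {xs : List A} {f g : A → ℕ} {y} → y ∈ xs → f y < g y →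
              (∀ {x} → x ∈ xs → f x ≤ g x) → Σℕ xs f < Σℕ xs g
  Σℕ-mono-< {x ∷ xs} (here refl) lt h = ℕₚ.+-mono-<-≤ lt (Σℕ-mono xs (h ∘ there))
  Σℕ-mono-< {x ∷ xs} (there y∈)  lt h = ℕₚ.+-mono-≤-< (h (here refl)) (Σℕ-mono-< y∈ lt (h ∘ there))

  Σℕ-const : ∀ (xs : List A) k → Σℕ xs (λ _ → k) ≡ length xs ℕ.* k
  Σℕ-const []       k = refl
  Σℕ-const (x ∷ xs) k = cong (k ℕ.+_) (Σℕ-const xs k)

  Σℕ-term : ∀ {xs : List A} {y} (f : A → ℕ) → y ∈ xs → f y ≤ Σℕ xs f
  Σℕ-term f (here refl)              = ℕₚ.m≤m+n _ _
  Σℕ-term {x ∷ xs} f (there y∈)      = ℕₚ.≤-trans (Σℕ-term f y∈) (ℕₚ.m≤n+m _ (f x))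

  Σℕ-zero : ∀ {xs : List A} {y} (f : A → ℕ) → Σℕ xs f ≡ 0 → y ∈ xs → f y ≡ 0
  Σℕ-zero f h y∈ = ℕₚ.n≤0⇒n≡0 (ℕₚ.≤-trans (Σℕ-term f y∈) (ℕₚ.≤-reflexive h))

  Σℕ-pos : ∀ (xs : List A) (f : A → ℕ) → 0 < Σℕ xs f → ∃ λ x → (x ∈ xs) × (0 < f x)
  Σℕ-pos (x ∷ xs) f h with f x in eq
  ... | suc k = x , here refl , subst (0 <_) (sym eq) (s≤s z≤n)
  ... | zero  = let (z , z∈ , lt) = Σℕ-pos xs f h in z , there z∈ , lt

  countᵇ-Σℕ : ∀ (p : A → Bool) xs → countᵇ p xs ≡ Σℕ xs (𝟙 ∘ p)
  countᵇ-Σℕ p []       = refl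
  countᵇ-Σℕ p (x ∷ xs) with p x
  ... | true  = cong suc (countᵇ-Σℕ p xs)
  ... | false = countᵇ-Σℕ p xs

length-allFin : ∀ n → length (allFin n) ≡ n
length-allFin n = Listₚ.length-tabulate id

𝟙≤1 : ∀ b → 𝟙 b ≤ 1
𝟙≤1 true  = s≤s z≤n
𝟙≤1 false = z≤n

𝟙-mono : ∀ {a b} → (a ≡ true → b ≡ true) → 𝟙 a ≤ 𝟙 b
𝟙-mono {false} h = z≤n
𝟙-mono {true}  h rewrite h refl = s≤s z≤n

-- Connectivity as an equivalence closure, and its agreement with bounded reachability

data Conn {n : ℕ} (A : List (Edge n)) : Fin (suc n) → Fin (suc n) → Set where
  crefl  : ∀ {u} → Conn A u u
  cedge  : ∀ {u v} → (u , v) ∈ A → Conn A u v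
  csym   : ∀ {u v} → Conn A u v → Conn A v u
  ctrans : ∀ {u v w} → Conn A u v → Conn A v w → Conn A u w

module _ {n : ℕ} {A : List (Edge n)} where
  Conn-invariant : ∀ {C : Set} (f : Fin (suc n) → C) → (∀ {u v} → (u , v) ∈ A → f u ≡ f v) →
                   ∀ {u v} → Conn A u v → f u ≡ f v
  Conn-invariant f h crefl        = refl
  Conn-invariant f h (cedge e)    = h e
  Conn-invariant f h (csym c)     = sym (Conn-invariant f h c)
  Conn-invariant f h (ctrans c d) = trans (Conn-invariant f h c) (Conn-invariant f h d)

  Conn-lift : ∀ {B : List (Edge n)} → (∀ {u v} → (u , v) ∈ A → Conn B u v) →
              ∀ {u v} → Conn A u v → Conn B u v
  Conn-lift h crefl        = crefl
  Conn-lift h (cedge e)    = h e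
  Conn-lift h (csym c)     = csym (Conn-lift h c)
  Conn-lift h (ctrans c d) = ctrans (Conn-lift h c) (Conn-lift h d)

  Conn-there : ∀ {e u v} → Conn A u v → Conn (e ∷ A) u v
  Conn-there = Conn-lift (cedge ∘ there)

module _ {n : ℕ} (A : List (Edge n)) (u : Fin (suc n)) where
  private
    R : ℕ → Fin (suc n) → Bool
    R s = reachIn A s u

    adjacentTo : ℕ → Fin (suc n) → Edge n → Bool
    adjacentTo s v e = (R s (proj₁ e) ∧ (proj₂ e == v)) ∨ (R s (proj₂ e) ∧ (proj₁ e == v))

  reachIn-sound : ∀ s {v} → R s v ≡ true → Conn A u v
  reachIn-sound zero    h = subst (Conn A u) (==-sound h) crefl
  reachIn-sound (suc s) {v} h with ∨-true {R s v} h
  ... | inj₁ h' = reachIn-sound s h'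
  ... | inj₂ h' with anyᵇ-elim A h'
  ...   | (x , y) , e∈ , k with ∨-true {R s x ∧ (y == v)} k
  ...     | inj₁ k' = ctrans (reachIn-sound s (proj₁ (∧-true k')))
                        (subst (Conn A x) (==-sound (proj₂ (∧-true {R s x} k'))) (cedge e∈))
  ...     | inj₂ k' = ctrans (reachIn-sound s (proj₁ (∧-true k')))
                        (subst (Conn A y) (==-sound (proj₂ (∧-true {R s y} k'))) (csym (cedge e∈)))

  reachIn-fwd : ∀ s {x y} → (x , y) ∈ A → R s x ≡ true → R (suc s) y ≡ true
  reachIn-fwd s {x} {y} e∈ h = ∨-trueʳ (R s y) (anyᵇ-intro {p = adjacentTo s y} e∈
    (cong₂ (λ a b → (a ∧ b) ∨ (R s y ∧ (x == y))) h (==-refl y)))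

  reachIn-bwd : ∀ s {x y} → (x , y) ∈ A → R s y ≡ true → R (suc s) x ≡ true
  reachIn-bwd s {x} {y} e∈ h = ∨-trueʳ (R s x) (anyᵇ-intro {p = adjacentTo s x} e∈
    (∨-trueʳ (R s x ∧ (y == x)) (cong₂ _∧_ h (==-refl x))))

  Stable : ℕ → Set
  Stable s = ∀ v → R (suc s) v ≡ true → R s v ≡ true

  stable-suc : ∀ {s} → Stable s → Stable (suc s)
  stable-suc {s} st v h with ∨-true {R (suc s) v} h
  ... | inj₁ h' = h'
  ... | inj₂ h' with anyᵇ-elim A h'
  ...   | (x , y) , e∈ , k with ∨-true {R (suc s) x ∧ (y == v)} k
  ...     | inj₁ k' with ==-sound {u = y} (proj₂ (∧-true {R (suc s) x} k'))
  ...       | refl = reachIn-fwd s e∈ (st x (proj₁ (∧-true k')))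
  stable-suc {s} st v h | inj₂ h' | (x , y) , e∈ , k | inj₂ k' with ==-sound {u = x} (proj₂ (∧-true {R (suc s) y} k'))
  ...       | refl = reachIn-bwd s e∈ (st y (proj₁ (∧-true k')))

  private
    imp? : ∀ s v → Dec (R (suc s) v ≡ true → R s v ≡ true)
    imp? s v = (R (suc s) v Boolₚ.≟ true) →-dec (R s v Boolₚ.≟ true)

  stable? : ∀ s → Stable s ⊎ (∃ λ v → (R (suc s) v ≡ true) × (R s v ≡ false))
  stable? s with Finₚ.all? (imp? s)
  ... | yes st = inj₁ st
  ... | no ¬st with Finₚ.¬∀⟶∃¬ _ (λ v → R (suc s) v ≡ true → R s v ≡ true) (imp? s) ¬st
  ...   | v , ¬imp = inj₂ (v , h₁ , h₂)
    where
    h₂ : R s v ≡ false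
    h₂ = ¬true⇒false (λ e → ¬imp (λ _ → e))
    h₁ : R (suc s) v ≡ true
    h₁ with R (suc s) v in eq
    ... | true  = refl
    ... | false = ⊥-elim (¬imp (λ ()))

  size : ℕ → ℕ
  size s = Σℕ (allFin (suc n)) (𝟙 ∘ R s)

  -- As long as the reachable set has not stabilised it gains a vertex at every step.
  stable-or-large : ∀ s → Stable s ⊎ (suc s ≤ size s)
  stable-or-large zero    = inj₂ (ℕₚ.≤-trans (ℕₚ.≤-reflexive (cong 𝟙 (sym (==-refl u))))
                                             (Σℕ-term (𝟙 ∘ R 0) (∈-allFin u)))
  stable-or-large (suc s) with stable-or-large s | stable? s
  ... | inj₁ st | _ = inj₁ (stable-suc {s} st)
  ... | _ | inj₁ st = inj₁ (stable-suc {s} st)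
  ... | inj₂ le | inj₂ (v , h₁ , h₂) = inj₂ (ℕₚ.≤-trans (s≤s le)
        (Σℕ-mono-< {y = v} (∈-allFin v) (subst (_< 𝟙 (R (suc s) v)) (cong 𝟙 (sym h₂)) (subst (λ b → 0 < 𝟙 b) (sym h₁) (s≤s z≤n)))
                   (λ {x} _ → 𝟙-mono {R s x} (cong (_∨ anyᵇ (adjacentTo s x) A)))))

  -- Growth up to stage `suc n` without stabilising would require n + 2 reached vertices among n +
  -- 1.
  stable-final : Stable (suc n)
  stable-final with stable-or-large (suc n)
  ... | inj₁ st = st
  ... | inj₂ le = ⊥-elim (ℕₚ.<⇒≱ le (ℕₚ.≤-trans (Σℕ-mono (allFin (suc n)) (λ {x} _ → 𝟙≤1 (R (suc n) x)))
                    (ℕₚ.≤-reflexive (trans (Σℕ-const (allFin (suc n)) 1)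
                      (trans (ℕₚ.*-identityʳ _) (length-allFin (suc n)))))))

  -- By `stable-final` the final reached set is closed under edges in both directions, so its
  -- indicator is constant on the class of `u`, where it starts out true.
  reach-complete : ∀ {v} → Conn A u v → reach A u v ≡ true
  reach-complete c = trans (sym (Conn-invariant (R (suc n)) closed c)) start
    where
    start : R (suc n) u ≡ true
    start = go (suc n)
      where
      go : ∀ s → R s u ≡ true
      go zero    = ==-refl u
      go (suc s) = cong (_∨ anyᵇ (adjacentTo s u) A) (go s)
    iff : ∀ {a b} → (a ≡ true → b ≡ true) → (b ≡ true → a ≡ true) → a ≡ b
    iff {true}  f g = sym (f refl)
    iff {false} {true} f g = g refl
    iff {false} {false} f g = refl
    closed : ∀ {x y} → (x , y) ∈ A → R (suc n) x ≡ R (suc n) y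
    closed e∈ = iff (λ h → stable-final _ (reachIn-fwd (suc n) e∈ h))
                    (λ h → stable-final _ (reachIn-bwd (suc n) e∈ h))

-- Number of components, and number of edges of a connected graph

connectedᵇ : ∀ {n} → List (Edge n) → Bool
connectedᵇ {n} A = allᵇ (reach A zero) (allFin (suc n))

module _ {n : ℕ} {A : List (Edge n)} where
  connected-intro : (∀ v → Conn A zero v) → connectedᵇ A ≡ true
  connected-intro h = allᵇ-intro (allFin (suc n)) (λ {v} _ → reach-complete A zero (h v))

  connected-elim : connectedᵇ A ≡ true → ∀ v → Conn A zero v
  connected-elim h v = reachIn-sound A zero (suc n) (allᵇ-elim h (∈-allFin v))

module _ {n : ℕ} (A : List (Edge n)) where
  private
    smaller : Fin (suc n) → Fin (suc n) → Bool
    smaller v u = (toℕ u <ᵇ toℕ v) ∧ reach A u v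

    minimal : Fin (suc n) → Bool
    minimal v = not (anyᵇ (smaller v) (allFin (suc n)))

    nonRootMinimal : ℕ
    nonRootMinimal = Σℕ (allFin n) (𝟙 ∘ minimal ∘ suc)

    minimal-zero : minimal zero ≡ true
    minimal-zero with anyᵇ (smaller zero) (allFin (suc n)) in eq
    ... | false = refl
    ... | true with anyᵇ-elim {p = smaller zero} (allFin (suc n)) eq
    ...   | u , _ , ()

    components-eq : components A ≡ suc nonRootMinimal
    components-eq = trans (countᵇ-Σℕ minimal (allFin (suc n)))
      (trans (Sumℕ.⨁-allFin-suc n (𝟙 ∘ minimal)) (cong (λ b → 𝟙 b ℕ.+ nonRootMinimal) minimal-zero))

  components-connected : connectedᵇ A ≡ true → components A ≡ 1
  components-connected h = trans components-eq (cong suc (Sumℕ.⨁-ε (allFin n) (λ {k} _ →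
    cong (𝟙 ∘ not) (anyᵇ-intro {p = smaller (suc k)} (∈-allFin zero) (reach-complete A zero (connected-elim h (suc k)))))))

  -- If 0 were the only vertex that is smallest in its class, repeated descent to a smaller member
  -- of the class would lead from every vertex to 0. The successor form exhibits a positive exponent
  -- of x - 1 in the Tutte polynomial.
  components-disconnected : connectedᵇ A ≡ false → ∃ λ k → components A ≡ suc (suc k)
  components-disconnected h with nonRootMinimal in eq
  ... | suc k = k , trans components-eq (cong suc eq)
  ... | zero  = ⊥-elim (true≢false (connected-intro (λ v → toRoot _ v ℕₚ.≤-refl)) h)
    where
    toRoot : ∀ b v → toℕ v ≤ b → Conn A zero v
    toRoot b       zero    le = crefl
    toRoot (suc b) (suc k) (s≤s le) with anyᵇ (smaller (suc k)) (allFin (suc n)) in eq₂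
    ... | false = ⊥-elim (ℕₚ.1+n≢0 (trans (cong (𝟙 ∘ not) (sym eq₂)) (Σℕ-zero (𝟙 ∘ minimal ∘ suc) eq (∈-allFin k))))
    ... | true with anyᵇ-elim {p = smaller (suc k)} (allFin (suc n)) eq₂
    ...   | u , _ , p = let (lt , r) = ∧-true {toℕ u <ᵇ suc (toℕ k)} p in
              ctrans (toRoot b u (ℕₚ.≤-trans (ℕₚ.≤-pred (<ᵇ-sound {toℕ u} lt)) le)) (reachIn-sound A u (suc n) r)

-- ρ labels the vertices by component representatives; each edge merges at most two classes.
componentLabels : ∀ {n} (A : List (Edge n)) → ∃ λ (ρ : Fin (suc n) → Fin (suc n)) →
  (∀ {u v} → (u , v) ∈ A → ρ u ≡ ρ v) × (suc n ≤ Σℕ (allFin (suc n)) (λ v → 𝟙 (ρ v == v)) ℕ.+ length A)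
componentLabels {n} [] = id , (λ ()) , ℕₚ.≤-reflexive (sym (trans (ℕₚ.+-identityʳ _)
  (trans (Sumℕ.⨁-cong (allFin (suc n)) {g = λ _ → 1} (λ {v} _ → cong 𝟙 (==-refl v)))
    (trans (Σℕ-const (allFin (suc n)) 1) (trans (ℕₚ.*-identityʳ _) (length-allFin (suc n)))))))
componentLabels {n} ((u , v) ∷ A) with componentLabels A
... | ρ , inv , le = ρ' , inv' , le'
  where
  V = Fin (suc n)
  ρ' : V → V
  ρ' w = if ρ w == ρ v then ρ u else ρ w
  ρ'-eq : ∀ {x y} → ρ x ≡ ρ y → ρ' x ≡ ρ' y
  ρ'-eq e = cong (λ z → if z == ρ v then ρ u else z) e
  ρ'v : ρ' v ≡ ρ u
  ρ'v rewrite ==-refl (ρ v) = refl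
  ρ'u : ρ' u ≡ ρ u
  ρ'u with ρ u == ρ v
  ... | true  = refl
  ... | false = refl
  inv' : ∀ {x y} → (x , y) ∈ (u , v) ∷ A → ρ' x ≡ ρ' y
  inv' (here refl) = trans ρ'u (sym ρ'v)
  inv' (there e)   = ρ'-eq (inv e)
  pt : ∀ w → 𝟙 (ρ w == w) ≤ 𝟙 (ρ' w == w) ℕ.+ 𝟙 (ρ v == w)
  pt w with ρ w == w in e₁
  ... | false = z≤n
  ... | true with ρ v == w in e₂
  ...   | true  = ℕₚ.m≤n+m 1 _
  ...   | false = ℕₚ.≤-trans (ℕₚ.≤-reflexive (cong 𝟙 (sym fixed))) (ℕₚ.m≤m+n _ _)
    where
    fixed : (ρ' w == w) ≡ true
    fixed with ρ w == ρ v in e₃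
    ... | false = e₁
    ... | true  = ⊥-elim (true≢false (subst (λ z → (ρ v == z) ≡ true)
                   (trans (sym (==-sound {u = ρ w} e₃)) (==-sound {u = ρ w} e₁)) (==-refl (ρ v))) e₂)
  le' : suc n ≤ Σℕ (allFin (suc n)) (λ w → 𝟙 (ρ' w == w)) ℕ.+ suc (length A)
  le' = ℕₚ.≤-trans le (ℕₚ.≤-trans (ℕₚ.+-monoˡ-≤ (length A) (ℕₚ.≤-trans (Σℕ-mono (allFin (suc n)) (λ {w} _ → pt w))
      (ℕₚ.≤-reflexive (trans (Sumℕ.⨁-∙ (allFin (suc n)) (λ w → 𝟙 (ρ' w == w)) (λ w → 𝟙 (ρ v == w))) (cong (Σℕ (allFin (suc n)) (λ w → 𝟙 (ρ' w == w)) ℕ.+_)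
         (trans (Sumℕ.⨁-allFin-single (ρ v) (λ w ne → cong 𝟙 (==-≢ (ne ∘ sym)))) (cong 𝟙 (==-refl (ρ v)))))))))
      (ℕₚ.≤-reflexive (ℕₚ.+-assoc _ 1 (length A))))

-- All labels of `componentLabels` coincide on a connected graph, so at most one fixed point is
-- counted. The bound makes the truncated exponent `length A ∸ n` of `base` a true difference.
connected-length : ∀ {n} {A : List (Edge n)} → (∀ v → Conn A zero v) → n ≤ length A
connected-length {n} {A} c with componentLabels A
... | ρ , inv , le = ℕₚ.≤-pred (ℕₚ.≤-trans le (ℕₚ.+-monoˡ-≤ (length A) one))
  where
  only : ∀ v → 𝟙 (ρ v == v) ≤ 𝟙 (ρ zero == v)
  only v = 𝟙-mono {ρ v == v} (λ h → subst (λ z → (z == v) ≡ true) (sym (Conn-invariant ρ inv (c v))) h)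
  one : Σℕ (allFin (suc n)) (λ v → 𝟙 (ρ v == v)) ≤ 1
  one = ℕₚ.≤-trans (Σℕ-mono (allFin (suc n)) (λ {v} _ → only v))
    (ℕₚ.≤-reflexive (trans (Sumℕ.⨁-allFin-single (ρ zero) (λ w ne → cong 𝟙 (==-≢ (ne ∘ sym)))) (cong 𝟙 (==-refl (ρ zero)))))

infix 4 _≋_
-- All that `base` sees of an edge list. Prescribed edges may thus be permuted, or exchanged for
-- edges parallel to them modulo the rest.
_≋_ : ∀ {n} → List (Edge n) → List (Edge n) → Set
A ≋ B = (length A ≡ length B) × (∀ {u v} → Conn A u v → Conn B u v) × (∀ {u v} → Conn B u v → Conn A u v)

module _ {n : ℕ} where
  ≋-∷ : ∀ {A B : List (Edge n)} e → A ≋ B → (e ∷ A) ≋ (e ∷ B)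
  ≋-∷ e (l , f , g) = cong suc l , Conn-lift (lift f) , Conn-lift (lift g)
    where
    lift : ∀ {A B : List (Edge n)} → (∀ {u v} → Conn A u v → Conn B u v) →
           ∀ {u v} → (u , v) ∈ e ∷ A → Conn (e ∷ B) u v
    lift f (here refl) = cedge (here refl)
    lift f (there m)   = Conn-there (f (cedge m))

  ≋-parallel : ∀ {A : List (Edge n)} {u v u' v'} → Conn ((u , v) ∷ A) u' v' → Conn ((u' , v') ∷ A) u v →
               ((u , v) ∷ A) ≋ ((u' , v') ∷ A)
  ≋-parallel {A} c d = refl , Conn-lift (lift d) , Conn-lift (lift c)
    where
    lift : ∀ {e e' : Edge n} → Conn (e ∷ A) (proj₁ e') (proj₂ e') → ∀ {u v} → (u , v) ∈ e' ∷ A → Conn (e ∷ A) u v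
    lift c (here refl) = c
    lift c (there m)   = cedge (there m)

  ≋-swap : ∀ {A : List (Edge n)} e e' → (e ∷ e' ∷ A) ≋ (e' ∷ e ∷ A)
  ≋-swap e e' = refl , Conn-lift (swap e e') , Conn-lift (swap e' e)
    where
    swap : ∀ {A : List (Edge n)} e e' {u v} → (u , v) ∈ e ∷ e' ∷ A → Conn (e' ∷ e ∷ A) u v
    swap e e' (here p)          = cedge (there (here p))
    swap e e' (there (here p))  = cedge (here p)
    swap e e' (there (there m)) = cedge (there (there m))

  connectedᵇ-resp : ∀ {A B : List (Edge n)} → A ≋ B → connectedᵇ A ≡ connectedᵇ B
  connectedᵇ-resp {A} {B} (_ , f , g) with connectedᵇ A in eq | connectedᵇ B in eq'
  ... | true  | true  = refl
  ... | false | false = refl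
  ... | true  | false = ⊥-elim (true≢false (connected-intro (λ v → f (connected-elim eq v))) eq')
  ... | false | true  = ⊥-elim (true≢false (connected-intro (λ v → g (connected-elim eq' v))) eq)

_≟ₑ_ : ∀ {n} (a b : Edge n) → Dec (a ≡ b)
_≟ₑ_ = Productₚ.≡-dec Finₚ._≟_ Finₚ._≟_

zeroAt : ∀ {n} → Edge n → (Edge n → ℕ) → Edge n → ℕ
zeroAt a μ b = if does (b ≟ₑ a) then 0 else μ b

zeroAt-≡ : ∀ {n} (a : Edge n) μ → zeroAt a μ a ≡ 0
zeroAt-≡ a μ with a ≟ₑ a
... | yes _ = refl
... | no ne = ⊥-elim (ne refl)

zeroAt-≢ : ∀ {n} {a b : Edge n} μ → b ≢ a → zeroAt a μ b ≡ μ b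
zeroAt-≢ {a = a} {b} μ ne with b ≟ₑ a
... | yes e = ⊥-elim (ne e)
... | no _  = refl

-- The generating function of connected spanning subgraphs, deletion and contraction

module WeightedSubgraphs {c ℓ : Level} (R : CommutativeRing c ℓ) (q : CommutativeRing.Carrier R) where
  open CommutativeRing R public
    using (Carrier; _≈_; _+_; _*_; _-_; -_; 0#; 1#; semiring; commutativeSemiring; setoid; reflexive
          ; +-cong; +-congˡ; +-congʳ; *-cong; *-congˡ; *-congʳ; +-identityˡ; +-identityʳ; *-identityˡ; *-identityʳ
          ; +-comm; +-assoc; -‿cong; -‿inverseˡ; -‿inverseʳ; ring; zeroˡ; zeroʳ; *-assoc; distribˡ; +-commutativeMonoid; *-commutativeMonoid)
    renaming (refl to ≈-refl; sym to ≈-sym; trans to ≈-trans)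
  open RS (Semiring.rawSemiring semiring) public using (_^_)
  open import Algebra.Solver.Ring.NaturalCoefficients.Default commutativeSemiring using (solve; _:=_; _:+_; _:*_; con)
  open import Relation.Binary.Reasoning.Setoid setoid

  module SumR  = BigOp +-commutativeMonoid
  module ProdR = BigOp *-commutativeMonoid

  y : Carrier
  y = q - 1#

  q≈1+y : q ≈ 1# + y
  q≈1+y = ≈-sym (begin
    1# + (q - 1#)     ≈⟨ +-comm 1# (q - 1#) ⟩
    (q - 1#) + 1#     ≈⟨ +-assoc q (- 1#) 1# ⟩
    q + (- 1# + 1#)   ≈⟨ +-congˡ (-‿inverseˡ 1#) ⟩
    q + 0#            ≈⟨ +-identityʳ q ⟩
    q                 ∎)

  [_] : ℕ → Carrier
  [ m ] = qInt R q m

  [suc] : ∀ m → [ suc m ] ≈ 1# + q * [ m ]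
  [suc] m = +-congˡ (begin
      SumR.⨁ (List.applyUpTo suc m) (q ^_)              ≈⟨ reflexive (cong (λ l → SumR.⨁ l (q ^_)) (≡.sym (Listₚ.map-applyUpTo id suc m))) ⟩
      SumR.⨁ (List.map suc (List.upTo m)) (q ^_)        ≈⟨ SumR.⨁-map suc (List.upTo m) (q ^_) ⟩
      SumR.⨁ (List.upTo m) (λ i → q * q ^ i)            ≈⟨ scale (List.upTo m) ⟩
      q * [ m ]                                         ∎)
    where
    scale : ∀ xs → SumR.⨁ xs (λ i → q * q ^ i) ≈ q * SumR.⨁ xs (q ^_)
    scale []       = ≈-sym (zeroʳ q)
    scale (x ∷ xs) = ≈-trans (+-congˡ (scale xs)) (≈-sym (distribˡ q _ _))

  [suc]-y : ∀ m → [ suc m ] ≈ 1# + (1# + y) * [ m ]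
  [suc]-y m = ≈-trans ([suc] m) (+-congˡ (*-congʳ q≈1+y))

  q^-geometric : ∀ m → q ^ m ≈ 1# + y * [ m ]
  q^-geometric zero    = ≈-sym (≈-trans (+-congˡ (zeroʳ y)) (+-identityʳ 1#))
  q^-geometric (suc m) = begin
    q * q ^ m                           ≈⟨ *-cong q≈1+y (q^-geometric m) ⟩
    (1# + y) * (1# + y * [ m ])         ≈⟨ solve 2 (λ y b → (con 1 :+ y) :* (con 1 :+ y :* b) := con 1 :+ y :* (con 1 :+ (con 1 :+ y) :* b)) ≈-refl y [ m ] ⟩
    1# + y * (1# + (1# + y) * [ m ])    ≈⟨ +-congˡ (*-congˡ (≈-sym ([suc]-y m))) ⟩
    1# + y * [ suc m ]                  ∎

  -- Merging two parallel bundles: a nonempty choice comes from the first only, from the second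
  -- only, or from both; in the last case one more edge is redundant, hence the `y`.
  []-+ : ∀ m k → [ m ℕ.+ k ] ≈ [ m ] + [ k ] + y * ([ m ] * [ k ])
  []-+ zero    k = solve 2 (λ y b → b := con 0 :+ b :+ y :* (con 0 :* b)) ≈-refl y [ k ]
  []-+ (suc m) k = begin
    [ suc (m ℕ.+ k) ]                                                     ≈⟨ [suc]-y (m ℕ.+ k) ⟩
    1# + (1# + y) * [ m ℕ.+ k ]                                           ≈⟨ +-congˡ (*-congˡ ([]-+ m k)) ⟩
    1# + (1# + y) * ([ m ] + [ k ] + y * ([ m ] * [ k ]))                 ≈⟨ solve 3 (λ y a b → con 1 :+ (con 1 :+ y) :* (a :+ b :+ y :* (a :* b))
                                                                               := (con 1 :+ (con 1 :+ y) :* a) :+ b :+ y :* ((con 1 :+ (con 1 :+ y) :* a) :* b)) ≈-refl y [ m ] [ k ] ⟩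
    (1# + (1# + y) * [ m ]) + [ k ] + y * ((1# + (1# + y) * [ m ]) * [ k ]) ≈⟨ +-cong (+-congʳ (≈-sym ([suc]-y m))) (*-congˡ (*-congʳ (≈-sym ([suc]-y m)))) ⟩
    [ suc m ] + [ k ] + y * ([ suc m ] * [ k ])                           ∎

  base : ∀ {n} → List (Edge n) → Carrier
  base {n} A = if connectedᵇ A then y ^ (length A ∸ n) else 0#

  -- The sum of base (A ++ acc) ∏_{e ∈ A} [μ e] over the sublists A of es; prescribing the edges
  -- of acc plays the role of contracting them.
  K : ∀ {n} → List (Edge n) → (Edge n → ℕ) → List (Edge n) → Carrier
  K []       μ acc = base acc
  K (e ∷ es) μ acc = K es μ acc + [ μ e ] * K es μ (e ∷ acc)

  module _ {n : ℕ} where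
    base-resp : ∀ {A B : List (Edge n)} → A ≋ B → base A ≈ base B
    base-resp {A} {B} A≋B rewrite connectedᵇ-resp A≋B | proj₁ A≋B = ≈-refl

    base-loop : ∀ {A : List (Edge n)} {u v} → Conn A u v → base ((u , v) ∷ A) ≈ y * base A
    base-loop {A} {u} {v} c with connectedᵇ A in eq
    ... | true rewrite connected-intro {A = (u , v) ∷ A} (λ w → Conn-there (connected-elim {A = A} eq w)) =
          -- The exponent grows by one only because a connected list already has at least n edges;
          -- below n the truncated difference would stay 0.
          reflexive (cong (y ^_) (ℕₚ.+-∸-assoc 1 (connected-length {A = A} (connected-elim {A = A} eq))))
    ... | false rewrite ¬true⇒false {connectedᵇ ((u , v) ∷ A)} (λ h → true≢false (connected-intro {A = A}
                      (λ w → Conn-lift (λ { (here refl) → c ; (there m) → cedge m }) (connected-elim {A = (u , v) ∷ A} h w))) eq) = ≈-sym (zeroʳ y)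

    base-colouring : ∀ {A : List (Edge n)} {C : Set} (f : Fin (suc n) → C) → (∀ {u v} → (u , v) ∈ A → f u ≡ f v) →
                     ∀ {w} → f zero ≢ f w → base A ≈ 0#
    base-colouring {A} f h {w} ne with connectedᵇ A in eq
    ... | true  = ⊥-elim (ne (Conn-invariant f h (connected-elim {A = A} eq w)))
    ... | false = ≈-refl

    base-tree : ∀ {A : List (Edge n)} → (∀ v → Conn A zero v) → length A ≡ n → base A ≈ 1#
    base-tree {A} c l rewrite connected-intro {A = A} c | l | ℕₚ.n∸n≡0 n = ≈-refl

    K-resp : ∀ es {μ} {A B : List (Edge n)} → A ≋ B → K es μ A ≈ K es μ B
    K-resp []       A≋B = base-resp A≋B
    K-resp (e ∷ es) A≋B = +-cong (K-resp es A≋B) (*-congˡ (K-resp es (≋-∷ e A≋B)))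

    K-cong : ∀ es {μ ν} (A : List (Edge n)) → (∀ {e} → e ∈ es → μ e ≡ ν e) → K es μ A ≈ K es ν A
    K-cong []       A h = ≈-refl
    K-cong (e ∷ es) A h = +-cong (K-cong es A (h ∘ there))
                                 (*-cong (reflexive (cong [_] (h (here refl)))) (K-cong es (e ∷ A) (h ∘ there)))

    K-loop : ∀ es {μ} {A : List (Edge n)} {u v} → Conn A u v → K es μ ((u , v) ∷ A) ≈ y * K es μ A
    K-loop []       c = base-loop c
    K-loop (e ∷ es) {μ} {A} {u} {v} c = begin
      K es μ ((u , v) ∷ A) + [ μ e ] * K es μ (e ∷ (u , v) ∷ A) ≈⟨ +-cong (K-loop es c) (*-congˡ (≈-trans (K-resp es (≋-swap e (u , v))) (K-loop es (Conn-there c)))) ⟩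
      y * K es μ A + [ μ e ] * (y * K es μ (e ∷ A))             ≈⟨ solve 4 (λ y a b c → y :* a :+ b :* (y :* c) := y :* (a :+ b :* c)) ≈-refl y (K es μ A) [ μ e ] (K es μ (e ∷ A)) ⟩
      y * (K es μ A + [ μ e ] * K es μ (e ∷ A))                 ∎

    -- Every subgraph of nonzero coefficient uses only edges between equal colours, so it cannot
    -- connect 0 to `w`. This disposes of the branches of both recursions in which no object is
    -- left.
    K-colouring : ∀ es {μ} (A : List (Edge n)) {C : Set} (f : Fin (suc n) → C) →
                  (∀ {u v} → (u , v) ∈ A → f u ≡ f v) →
                  (∀ {u v} → (u , v) ∈ es → μ (u , v) ≡ 0 ⊎ f u ≡ f v) →
                  ∀ {w} → f zero ≢ f w → K es μ A ≈ 0#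
    K-colouring []       A f h k ne = base-colouring f h ne
    K-colouring (e ∷ es) {μ} A f h k ne = ≈-trans (+-cong (K-colouring es A f h (k ∘ there) ne) second) (+-identityˡ 0#)
      where
      second : [ μ e ] * K es μ (e ∷ A) ≈ 0#
      second with k (here refl)
      ... | inj₁ z = ≈-trans (*-congʳ (reflexive (cong [_] z))) (zeroˡ _)
      ... | inj₂ s = ≈-trans (*-congˡ (K-colouring es (e ∷ A) f (λ { (here refl) → s ; (there m) → h m }) (k ∘ there) ne)) (zeroʳ _)

    K-empty : ∀ es {μ} {A : List (Edge n)} → (∀ {e} → e ∈ es → μ e ≡ 0) → K es μ A ≈ base A
    K-empty []       h = ≈-refl
    K-empty (e ∷ es) h = ≈-trans (+-cong (K-empty es (h ∘ there))
      (≈-trans (*-congʳ (reflexive (cong [_] (h (here refl))))) (zeroˡ _))) (+-identityʳ _)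

    -- The definition of `K` resolves the head of the list; `≋-swap` carries this to any position.
    -- The multiplicities after deletion are described pointwise, since each caller has a formula of
    -- its own for them.
    K-delete-contract : ∀ {es μ ν e} (A : List (Edge n)) → Unique es → e ∈ es → ν e ≡ 0 →
                        (∀ {e'} → e' ∈ es → e' ≢ e → ν e' ≡ μ e') →
                        K es μ A ≈ K es ν A + [ μ e ] * K es ν (e ∷ A)
    K-delete-contract {e ∷ es} {μ} {ν} A (e∉ ∷ u) (here refl) z same = ≈-sym (+-cong
        (≈-trans (+-congˡ kill) (≈-trans (+-identityʳ _) (agree A)))
        (*-congˡ (≈-trans (+-congˡ kill) (≈-trans (+-identityʳ _) (agree (e ∷ A))))))
      where
      kill : ∀ {x} → [ ν e ] * x ≈ 0#
      kill = ≈-trans (*-congʳ (reflexive (cong [_] z))) (zeroˡ _)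
      agree : ∀ B → K es ν B ≈ K es μ B
      agree B = K-cong es B (λ m → same (there m) (λ { refl → All.lookup e∉ m refl }))
    K-delete-contract {e' ∷ es} {μ} {ν} {e} A (e'∉ ∷ u) (there e∈) z same = begin
        K es μ A + [ μ e' ] * K es μ (e' ∷ A)
          ≈⟨ +-cong (ih A) (*-cong (reflexive (cong [_] (≡.sym (same (here refl) (All.lookup e'∉ e∈))))) (≈-trans (ih (e' ∷ A)) (+-congˡ (*-congˡ (K-resp es (≋-swap e e')))))) ⟩
        (K es ν A + [ μ e ] * K es ν (e ∷ A)) + [ ν e' ] * (K es ν (e' ∷ A) + [ μ e ] * K es ν (e' ∷ e ∷ A))
          ≈⟨ solve 6 (λ a b c d f g → (a :+ b :* c) :+ d :* (f :+ b :* g) := (a :+ d :* f) :+ b :* (c :+ d :* g)) ≈-refl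
               (K es ν A) [ μ e ] (K es ν (e ∷ A)) [ ν e' ] (K es ν (e' ∷ A)) (K es ν (e' ∷ e ∷ A)) ⟩
        (K es ν A + [ ν e' ] * K es ν (e' ∷ A)) + [ μ e ] * (K es ν (e ∷ A) + [ ν e' ] * K es ν (e' ∷ e ∷ A)) ∎
      where
      ih : ∀ B → K es μ B ≈ K es ν B + [ μ e ] * K es ν (e ∷ B)
      ih B = K-delete-contract B u e∈ z (same ∘ there)

    -- Prescribing an edge inside a component only costs a factor `y`, so deletion and contraction
    -- combine to the factor 1 + y [m], which is q^m by `q^-geometric`.
    K-remove-loop : ∀ {es μ ν u v} (A : List (Edge n)) → Unique es → (u , v) ∈ es → Conn A u v → ν (u , v) ≡ 0 →
                    (∀ {e'} → e' ∈ es → e' ≢ (u , v) → ν e' ≡ μ e') → K es μ A ≈ q ^ μ (u , v) * K es ν A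
    K-remove-loop {es} {μ} {ν} {u} {v} A un e∈ c z same = begin
      K es μ A                                              ≈⟨ K-delete-contract A un e∈ z same ⟩
      K es ν A + [ μ (u , v) ] * K es ν ((u , v) ∷ A)       ≈⟨ +-congˡ (*-congˡ (K-loop es c)) ⟩
      K es ν A + [ μ (u , v) ] * (y * K es ν A)             ≈⟨ solve 3 (λ k b y → k :+ b :* (y :* k) := (con 1 :+ y :* b) :* k) ≈-refl (K es ν A) [ μ (u , v) ] y ⟩
      (1# + y * [ μ (u , v) ]) * K es ν A                   ≈⟨ *-congʳ (≈-sym (q^-geometric (μ (u , v)))) ⟩
      q ^ μ (u , v) * K es ν A                              ∎

    -- The two connectivity hypotheses say that `e` and `e'` are parallel modulo `A`. Both bundles
    -- are resolved, the terms using either or both are collected by `[]-+`, and a single bundle at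
    -- `e'` is put back together.
    K-move-parallel : ∀ {es μ ν e e'} (A : List (Edge n)) → Unique es → e ∈ es → e' ∈ es → e ≢ e' →
                      Conn (e ∷ A) (proj₁ e') (proj₂ e') → Conn (e' ∷ A) (proj₁ e) (proj₂ e) →
                      ν e ≡ 0 → ν e' ≡ μ e ℕ.+ μ e' →
                      (∀ {f} → f ∈ es → f ≢ e → f ≢ e' → ν f ≡ μ f) → K es μ A ≈ K es ν A
    K-move-parallel {es} {μ} {ν} {e} {e'} A un e∈ e'∈ ne c c' νe νe' same = begin
        K es μ A
          ≈⟨ K-delete-contract A un e∈ μ₁e (λ _ → zeroAt-≢ μ) ⟩
        K es μ₁ A + [ μ e ] * K es μ₁ (e ∷ A)
          ≈⟨ +-cong (K-delete-contract A un e'∈ μ₂e' μ₂-same) (*-congˡ (K-delete-contract (e ∷ A) un e'∈ μ₂e' μ₂-same)) ⟩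
        (K es μ₂ A + [ μ₁ e' ] * K es μ₂ (e' ∷ A)) + [ μ e ] * (K es μ₂ (e ∷ A) + [ μ₁ e' ] * K es μ₂ (e' ∷ e ∷ A))
          ≈⟨ +-cong (+-congˡ (*-congʳ m1)) (*-congˡ (+-cong (K-resp es (≋-parallel c c')) (*-cong m1 (≈-trans (K-loop es c) (*-congˡ (K-resp es (≋-parallel c c'))))))) ⟩
        (K es μ₂ A + [ μ e' ] * k) + [ μ e ] * (k + [ μ e' ] * (y * k))
          ≈⟨ solve 5 (λ a x z k y → (a :+ z :* k) :+ x :* (k :+ z :* (y :* k)) := a :+ (x :+ z :+ y :* (x :* z)) :* k) ≈-refl
               (K es μ₂ A) [ μ e ] [ μ e' ] k y ⟩
        K es μ₂ A + ([ μ e ] + [ μ e' ] + y * ([ μ e ] * [ μ e' ])) * k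
          ≈⟨ +-congˡ (*-congʳ (≈-sym (≈-trans (reflexive (cong [_] νe')) ([]-+ (μ e) (μ e'))))) ⟩
        K es μ₂ A + [ ν e' ] * k
          ≈⟨ ≈-sym (K-delete-contract A un e'∈ μ₂e' ν-same) ⟩
        K es ν A ∎
      where
      μ₁ = zeroAt e μ
      μ₂ = zeroAt e' μ₁
      k = K es μ₂ (e' ∷ A)
      μ₁e : μ₁ e ≡ 0
      μ₁e = zeroAt-≡ e μ
      μ₂e' : μ₂ e' ≡ 0
      μ₂e' = zeroAt-≡ e' μ₁
      m1 : [ μ₁ e' ] ≈ [ μ e' ]
      m1 = reflexive (cong [_] (zeroAt-≢ μ (ne ∘ ≡.sym)))
      μ₂-same : ∀ {f} → f ∈ es → f ≢ e' → μ₂ f ≡ μ₁ f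
      μ₂-same _ = zeroAt-≢ μ₁
      ν-same : ∀ {f} → f ∈ es → f ≢ e' → μ₂ f ≡ ν f
      ν-same {f} f∈ ne' = trans (zeroAt-≢ μ₁ ne') (case f ≟ₑ e of λ where
        (yes refl) → trans (zeroAt-≡ e μ) (≡.sym νe)
        (no ne'')  → trans (zeroAt-≢ μ ne'') (≡.sym (same f∈ ne'' ne')))

    subsets : List (Edge n) → List (Edge n) → Carrier
    subsets []       acc = base acc
    subsets (e ∷ es) acc = subsets es acc + subsets es (e ∷ acc)

    subsets-resp : ∀ es {A B : List (Edge n)} → A ≋ B → subsets es A ≈ subsets es B
    subsets-resp []       A≋B = base-resp A≋B
    subsets-resp (e ∷ es) A≋B = +-cong (subsets-resp es A≋B) (subsets-resp es (≋-∷ e A≋B))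

    subsets-loop : ∀ es {A : List (Edge n)} {u v} → Conn A u v → subsets es ((u , v) ∷ A) ≈ y * subsets es A
    subsets-loop []       c = base-loop c
    subsets-loop (e ∷ es) {A} {u} {v} c = ≈-trans (+-cong (subsets-loop es c)
      (≈-trans (subsets-resp es (≋-swap e (u , v))) (subsets-loop es (Conn-there c)))) (≈-sym (distribˡ y _ _))

    -- A choice of k copies, k ≥ 1, connects like one copy and leaves k - 1 loops, each worth `y`;
    -- over all choices this adds up to `[ m ]`.
    subsets-replicate : ∀ m e es (A : List (Edge n)) →
      subsets (List.replicate m e ++ es) A ≈ subsets es A + [ m ] * subsets es (e ∷ A)
    subsets-replicate zero    e es A = ≈-sym (≈-trans (+-congˡ (zeroˡ _)) (+-identityʳ _))
    subsets-replicate (suc m) e es A = begin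
      subsets (List.replicate m e ++ es) A + subsets (List.replicate m e ++ es) (e ∷ A)
        ≈⟨ +-cong (subsets-replicate m e es A) (≈-trans (subsets-replicate m e es (e ∷ A)) (+-congˡ (*-congˡ (subsets-loop es (cedge (here refl)))))) ⟩
      (s + [ m ] * t) + (t + [ m ] * (y * t))
        ≈⟨ solve 4 (λ s b t y → (s :+ b :* t) :+ (t :+ b :* (y :* t)) := s :+ (con 1 :+ (con 1 :+ y) :* b) :* t) ≈-refl s [ m ] t y ⟩
      s + (1# + (1# + y) * [ m ]) * t
        ≈⟨ +-congˡ (*-congʳ (≈-sym ([suc]-y m))) ⟩
      s + [ suc m ] * t ∎
      where
      s = subsets es A
      t = subsets es (e ∷ A)

    subsets-multi : ∀ es (μ : Edge n → ℕ) A → subsets (concatMap (λ e → List.replicate (μ e) e) es) A ≈ K es μ A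
    subsets-multi []       μ A = ≈-refl
    subsets-multi (e ∷ es) μ A = ≈-trans (subsets-replicate (μ e) e (concatMap (λ e → List.replicate (μ e) e) es) A)
      (+-cong (subsets-multi es μ A) (*-congˡ (subsets-multi es μ (e ∷ A))))

    Σ-select : ∀ (es A : List (Edge n)) → SumR.⨁ (allVecs (true ∷ false ∷ []) (length es)) (λ S → base (select es (Vec.toList S) ++ A))
                        ≈ subsets es A
    Σ-select []       A = +-identityʳ _
    Σ-select (e ∷ es) A = begin
      SumR.⨁ (allVecs (true ∷ false ∷ []) (suc (length es))) (λ S → base (select (e ∷ es) (Vec.toList S) ++ A))
        ≈⟨ SumR.⨁-allVecs-suc (true ∷ false ∷ []) (length es) (λ S → base (select (e ∷ es) (Vec.toList S) ++ A)) ⟩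
      SumR.⨁ vs (λ S → base (e ∷ (sel S ++ A))) + (SumR.⨁ vs (λ S → base (sel S ++ A)) + 0#)
        ≈⟨ +-cong (≈-trans (SumR.⨁-cong vs (λ {S} _ → base-resp (shift e (sel S)))) (Σ-select es (e ∷ A)))
                  (≈-trans (+-identityʳ _) (Σ-select es A)) ⟩
      subsets es (e ∷ A) + subsets es A
        ≈⟨ +-comm _ _ ⟩
      subsets es A + subsets es (e ∷ A) ∎
      where
      vs = allVecs (true ∷ false ∷ []) (length es)
      sel : Vec Bool (length es) → List (Edge n)
      sel S = select es (Vec.toList S)
      shift : ∀ e xs → (e ∷ (xs ++ A)) ≋ (xs ++ e ∷ A)
      shift e []       = refl , id , id
      shift e (x ∷ xs) = let (l , f , g) = ≋-swap {A = xs ++ A} e x ; (l' , f' , g') = ≋-∷ x (shift e xs) in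
                         trans l l' , f' ∘ f , g ∘ g'

    -- At x = 1 the first factor is a power of 0: it is 1 for a connected sublist, where the
    -- exponent is 1 - 1, and 0 for the others. For a connected sublist the second exponent, (1 +
    -- |A|) - (n + 1), is the one of `base`.
    tutte-1q : ∀ (es : List (Edge n)) → components es ≡ 1 → tutte R es 1# q ≈ subsets es []
    tutte-1q es one = ≈-trans (SumR.⨁-cong (allVecs (true ∷ false ∷ []) (length es)) (λ {S} _ → term (select es (Vec.toList S)))) (Σ-select es [])
      where
      expr : ℕ → ℕ → ℕ → Carrier
      expr k k' l = (1# - 1#) ^ (k ∸ k') * y ^ ((k ℕ.+ l) ∸ suc n)
      kill : ∀ k l → expr (suc (suc k)) 1 l ≈ 0#
      kill k l = ≈-trans (*-congʳ (≈-trans (*-congʳ (-‿inverseʳ 1#)) (zeroˡ _))) (zeroˡ _)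
      value : ∀ A b → connectedᵇ A ≡ b → expr (components A) 1 (length A) ≈ (if b then y ^ (length A ∸ n) else 0#)
      value A true  h = ≈-trans (reflexive (cong (λ k → expr k 1 (length A)) (components-connected A h))) (*-identityˡ _)
      value A false h = let (k , e) = components-disconnected A h in
        ≈-trans (reflexive (cong (λ k → expr k 1 (length A)) e)) (kill k (length A))
      term : ∀ A → expr (components A) (components es) (length A) ≈ base (A ++ [])
      term A = ≈-trans (reflexive (cong (λ k → expr (components A) k (length A)) one))
        (≈-trans (value A (connectedᵇ A) refl) (reflexive (cong base (≡.sym (Listₚ.++-identityʳ A)))))

-- Threshold graphs labelled by reverse degree are shifted

record IsShifted {n : ℕ} (G : Graph n) : Set where
  field
    symmetric   : ∀ u v → G u v ≡ G v u
    irreflexive : ∀ v → G v v ≡ false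
    shifted     : ∀ {i j k} → toℕ i < toℕ j → k ≢ i → G j k ≡ true → G i k ≡ true

  adjacent⇒≢ : ∀ {u v} → G u v ≡ true → u ≢ v
  adjacent⇒≢ {u} h refl = true≢false h (irreflexive u)

maxV-≥ : ∀ {m} {u v : Fin m} → toℕ v ≤ toℕ u → maxV u v ≡ u
maxV-≥ {u = u} {v} le rewrite <ᵇ-false le = refl

maxV-< : ∀ {m} {u v : Fin m} → toℕ u < toℕ v → maxV u v ≡ v
maxV-< {u = u} {v} lt rewrite <ᵇ-true lt = refl

threshold⇒shifted : ∀ {n} {G : Graph n} → IsThreshold G → ReverseDegreeLabeled G → IsShifted G
threshold⇒shifted {n} {G} th rev = record { symmetric = G-sym ; irreflexive = irrefl ; shifted = G-shifted }
  where
  open IsThreshold th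
  open import Data.Fin.Permutation using (_⟨$⟩ʳ_; _⟨$⟩ˡ_; inverseˡ)
  V = Fin (suc n)
  t : V → ℕ
  t u = toℕ (order ⟨$⟩ʳ u)
  D : V → Bool
  D u = dominating (order ⟨$⟩ʳ u)

  t-injective : ∀ {u v} → t u ≡ t v → u ≡ v
  t-injective {u} {v} e = trans (sym (inverseˡ order)) (trans (cong (order ⟨$⟩ˡ_) (Finₚ.toℕ-injective e)) (inverseˡ order))

  later : ∀ {u v} → t u < t v → G u v ≡ D v
  later {u} {v} lt = trans (adjacency u v (λ { refl → ℕₚ.<-irrefl refl lt })) (cong dominating (maxV-< lt))

  earlier : ∀ {u v} → t u < t v → G v u ≡ D v
  earlier {u} {v} lt = trans (adjacency v u (λ { refl → ℕₚ.<-irrefl refl lt })) (cong dominating (maxV-≥ (ℕₚ.<⇒≤ lt)))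

  G-sym : ∀ u v → G u v ≡ G v u
  G-sym u v with ℕₚ.<-cmp (t u) (t v)
  ... | tri< lt _ _ = trans (later lt) (sym (earlier lt))
  ... | tri> _ _ gt = trans (earlier gt) (sym (later gt))
  ... | tri≈ _ e _ with t-injective e
  ...   | refl = refl

  -- Neighbourhoods in a threshold graph are nested: one vertex `k` that distinguishes `j` from `i`
  -- settles the comparison for all `l`. Adjacency depends only on the later of two creation times,
  -- so the cases follow the order of creation.
  nested : ∀ {i j k l} → G j k ≡ true → G i k ≡ false → k ≢ i → l ≢ i → l ≢ j → G i l ≡ true → G j l ≡ true
  nested {i} {j} {k} {l} jk ik k≢i l≢i l≢j il with ℕₚ.<-cmp (t i) (t k) | ℕₚ.<-cmp (t i) (t l) | ℕₚ.<-cmp (t j) (t l)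
  ... | tri≈ _ e _ | _ | _ = ⊥-elim (k≢i (t-injective (sym e)))
  ... | _ | tri≈ _ e _ | _ = ⊥-elim (l≢i (t-injective (sym e)))
  ... | _ | _ | tri≈ _ e _ = ⊥-elim (l≢j (t-injective (sym e)))
  ... | _ | tri< i<l _ _ | tri< j<l _ _ = trans (later j<l) (trans (sym (later i<l)) il)
  ... | tri> _ _ k<i | tri> _ _ l<i | _ = ⊥-elim (true≢false (trans (sym (earlier l<i)) il) (trans (sym (earlier k<i)) ik))
  ... | tri> _ _ k<i | tri< i<l _ _ | tri> _ _ l<j = trans (earlier l<j) (trans (sym (earlier (ℕₚ.<-trans k<i (ℕₚ.<-trans i<l l<j)))) jk)
  ... | tri< i<k _ _ | _ | tri> _ _ l<j with ℕₚ.<-cmp (t j) (t k)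
  ...   | tri< j<k _ _ = ⊥-elim (true≢false (trans (sym (later j<k)) jk) (trans (sym (later i<k)) ik))
  ...   | tri> _ _ k<j = trans (earlier l<j) (trans (sym (earlier k<j)) jk)
  ...   | tri≈ _ e _ = ⊥-elim (true≢false jk (trans (cong (G j) (t-injective (sym e))) (irrefl j)))
  nested {i} {j} {k} {l} jk ik k≢i l≢i l≢j il | tri< i<k _ _ | tri> _ _ l<i | tri< j<l _ _ =
    ⊥-elim (true≢false (trans (sym (later (ℕₚ.<-trans j<l (ℕₚ.<-trans l<i i<k)))) jk) (trans (sym (later i<k)) ik))

  degree-Σℕ : ∀ v → degree G v ≡ Σℕ (allFin (suc n)) (𝟙 ∘ G v)
  degree-Σℕ v = countᵇ-Σℕ (G v) (allFin (suc n))

  -- If j had a neighbour k missing from i, every other neighbour of i would be one of j, so deg i < deg j.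
  G-shifted : ∀ {i j k} → toℕ i < toℕ j → k ≢ i → G j k ≡ true → G i k ≡ true
  G-shifted {i} {j} {k} i<j k≢i jk with G i k in ik
  ... | true  = refl
  ... | false = ⊥-elim (ℕₚ.<⇒≱ (ℕₚ.+-cancelʳ-< g (degree G i) (degree G j) deg<) (rev i j i<j))
    where
    vs = allFin (suc n)
    g = 𝟙 (G i j)
    -- At l = i and l = j the inclusion of neighbourhoods says nothing, as one of the two entries
    -- lies on the diagonal. Adding the common entry `g` on the diagonal of both rows makes the
    -- comparison hold at every `l`, and it cancels from the totals.
    f₁ f₂ : V → ℕ
    f₁ l = 𝟙 (G i l) ℕ.+ (if l == i then g else 0)
    f₂ l = 𝟙 (G j l) ℕ.+ (if l == j then g else 0)
    Σδ : ∀ v → Σℕ vs (λ l → if l == v then g else 0) ≡ g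
    Σδ v = trans (Sumℕ.⨁-allFin-single v (λ l ne → cong (if_then g else 0) (==-≢ ne))) (cong (if_then g else 0) (==-refl v))
    Σf : ∀ v → Σℕ vs (λ l → 𝟙 (G v l) ℕ.+ (if l == v then g else 0)) ≡ degree G v ℕ.+ g
    Σf v = trans (Sumℕ.⨁-∙ vs (𝟙 ∘ G v) (λ l → if l == v then g else 0)) (cong₂ ℕ._+_ (sym (degree-Σℕ v)) (Σδ v))
    i≢j : i ≢ j
    i≢j refl = ℕₚ.<-irrefl refl i<j
    k≢j : k ≢ j
    k≢j refl = true≢false jk (irrefl k)
    pt : ∀ l → Dec (l ≡ i) → Dec (l ≡ j) → f₁ l ≤ f₂ l
    pt l (yes refl) _ rewrite irrefl i | ==-refl i | ==-≢ i≢j | G-sym i j = ℕₚ.m≤m+n _ 0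
    pt l (no l≢i) (yes refl) rewrite irrefl j | ==-refl j | ==-≢ l≢i = ℕₚ.≤-reflexive (ℕₚ.+-identityʳ _)
    pt l (no l≢i) (no l≢j) rewrite ==-≢ l≢i | ==-≢ l≢j = ℕₚ.+-monoˡ-≤ 0 (𝟙-mono {G i l} (nested jk ik k≢i l≢i l≢j))
    strict : f₁ k < f₂ k
    strict rewrite ik | jk | ==-≢ k≢i | ==-≢ k≢j = s≤s z≤n
    deg< : degree G i ℕ.+ g < degree G j ℕ.+ g
    deg< = ℕₚ.≤-trans (ℕₚ.≤-reflexive (cong suc (sym (Σf i))))
             (ℕₚ.≤-trans (Σℕ-mono-< {f = f₁} {f₂} (∈-allFin k) strict (λ {l} _ → pt l (l Finₚ.≟ i) (l Finₚ.≟ j))) (ℕₚ.≤-reflexive (Σf j)))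

-- The edge list of G

module _ {n : ℕ} (G : Graph n) where
  private
    below : Fin (suc n) → Fin (suc n) → Bool
    below i j = (toℕ j <ᵇ toℕ i) ∧ G i j

    row : Fin (suc n) → List (Fin (suc n))
    row i = filterᵇ (below i) (allFin (suc n))

    rowEdges : Fin (suc n) → List (Edge n)
    rowEdges i = List.map (i ,_) (row i)

  ∈-edges⁺ : ∀ {i j} → toℕ j < toℕ i → G i j ≡ true → (i , j) ∈ edges G
  ∈-edges⁺ {i} {j} lt g = ∈-concatMap⁺ rowEdges (lose (∈-allFin i) (∈-map⁺ (i ,_)
    (∈-filter⁺ (Boolₚ.T? ∘ below i) (∈-allFin j) (Equivalence.from T-≡ (cong₂ _∧_ (<ᵇ-true lt) g)))))

  ∈-edges⁻ : ∀ {i j} → (i , j) ∈ edges G → (toℕ j < toℕ i) × (G i j ≡ true)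
  ∈-edges⁻ {i} {j} e∈ with find (∈-concatMap⁻ rowEdges {xs = allFin (suc n)} e∈)
  ... | i' , _ , m with ∈-map⁻ (i' ,_) m
  ...   | j' , j∈ , refl = let (lt , g) = ∧-true {toℕ j <ᵇ toℕ i} (Equivalence.to T-≡ (proj₂ (∈-filter⁻ (Boolₚ.T? ∘ below i) {xs = allFin (suc n)} j∈)))
                           in <ᵇ-sound lt , g

  edges-unique : Unique (edges G)
  edges-unique = Uniqueₚ.concat⁺ (Allₚ.map⁺ {f = rowEdges} (All.universal rowUnique (allFin (suc n))))
      (AllPairsₚ.map⁺ {f = rowEdges} (AllPairs.map (λ ne {e} p → ne (same (proj₁ p) (proj₂ p))) (Uniqueₚ.allFin⁺ (suc n))))
    where
    rowUnique : ∀ i → Unique (rowEdges i)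
    rowUnique i = Uniqueₚ.map⁺ (cong proj₂) (Uniqueₚ.filter⁺ (Boolₚ.T? ∘ below i) (Uniqueₚ.allFin⁺ (suc n)))
    same : ∀ {i i' e} → e ∈ rowEdges i → e ∈ rowEdges i' → i ≡ i'
    same {i} {i'} m m' with ∈-map⁻ (i ,_) m | ∈-map⁻ (i' ,_) m'
    ... | _ , _ , refl | _ , _ , refl = refl

  module _ {c ℓ} (M : CommutativeMonoid c ℓ) where
    open CommutativeMonoid M using (Carrier; _≈_; ε) renaming (trans to ≈-trans; refl to ≈-refl; sym to ≈-sym)
    open BigOp M

    ⨁-edges : (f : Edge n → Carrier) → (∀ {e} → e ∉ edges G → f e ≈ ε) →
              ⨁ (edges G) f ≈ ⨁ (allFin (suc n)) (λ i → ⨁ (allFin (suc n)) (λ j → f (i , j)))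
    ⨁-edges f h = ≈-trans (⨁-concatMap rowEdges (allFin (suc n)) f) (⨁-cong (allFin (suc n)) (λ {i} _ →
        ≈-trans (⨁-map (i ,_) (row i) f) (≈-trans (⨁-filterᵇ (below i) (allFin (suc n)) (λ j → f (i , j))) (⨁-cong (allFin (suc n)) (λ {j} _ → off i j)))))
      where
      off : ∀ i j → (if (toℕ j <ᵇ toℕ i) ∧ G i j then f (i , j) else ε) ≈ f (i , j)
      off i j with (toℕ j <ᵇ toℕ i) ∧ G i j in eq
      ... | true  = ≈-refl
      ... | false = ≈-sym (h (λ e∈ → let (lt , g) = ∈-edges⁻ e∈ in true≢false (cong₂ _∧_ (<ᵇ-true lt) g) eq))

-- Flows as matrices

module _ {n : ℕ} where
  -- Lookup by edge instead of by position, total with value 0 off the list. It recovers every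
  -- coordinate when the list has no repetitions.
  valueAt : (es : List (Edge n)) → Vec ℕ (length es) → Edge n → ℕ
  valueAt []        x           e = 0
  valueAt (e' ∷ es) (v Vec.∷ x) e = if does (e ≟ₑ e') then v else valueAt es x e

  valueAt-here : ∀ {e es v x} → valueAt (e ∷ es) (v Vec.∷ x) e ≡ v
  valueAt-here {e} with e ≟ₑ e
  ... | yes _ = refl
  ... | no ne = ⊥-elim (ne refl)

  valueAt-there : ∀ {e e' es v x} → e ≢ e' → valueAt (e' ∷ es) (v Vec.∷ x) e ≡ valueAt es x e
  valueAt-there {e} {e'} ne with e ≟ₑ e'
  ... | yes p = ⊥-elim (ne p)
  ... | no _  = refl

  valueAt-∉ : ∀ {es x e} → e ∉ es → valueAt es x e ≡ 0
  valueAt-∉ {[]}               e∉ = refl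
  valueAt-∉ {e' ∷ es} {v Vec.∷ x} {e} e∉ = trans (valueAt-there {e} {e'} {es} {v} {x} (λ { refl → e∉ (here refl) })) (valueAt-∉ {es} {x} (e∉ ∘ there))

  map-valueAt-there : ∀ {B : Set} {e es v x} (g : Edge n → ℕ → B) → All (e ≢_) es →
                      List.map (λ e' → g e' (valueAt es x e')) es ≡ List.map (λ e' → g e' (valueAt (e ∷ es) (v Vec.∷ x) e')) es
  map-valueAt-there {e = e} {es} {v} {x} g e∉ = Listₚ.map-cong-local (All.map (λ {e'} ne → cong (g e') (sym (valueAt-there {e'} {e} {es} {v} {x} (ne ∘ sym)))) e∉)

  zip-valueAt : ∀ {es} (x : Vec ℕ (length es)) → Unique es →
                Vec.toList (Vec.zip (Vec.fromList es) x) ≡ List.map (λ e → e , valueAt es x e) es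
  zip-valueAt {[]}     Vec.[]      _        = refl
  zip-valueAt {e ∷ es} (v Vec.∷ x) (e∉ ∷ u) = cong₂ _∷_ (cong (e ,_) (sym (valueAt-here {e} {es} {v} {x})))
    (trans (zip-valueAt x u) (map-valueAt-there _,_ e∉))

  toList-valueAt : ∀ {es} (x : Vec ℕ (length es)) → Unique es → Vec.toList x ≡ List.map (valueAt es x) es
  toList-valueAt {[]}     Vec.[]      _        = refl
  toList-valueAt {e ∷ es} (v Vec.∷ x) (e∉ ∷ u) = cong₂ _∷_ (sym (valueAt-here {e} {es} {v} {x}))
    (trans (toList-valueAt x u) (map-valueAt-there (λ _ k → k) e∉))

  valueAt-map : ∀ {es} (f : Edge n → ℕ) {e} → e ∈ es → valueAt es (Vec.map f (Vec.fromList es)) e ≡ f e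
  valueAt-map {e' ∷ es} f {e} e∈ with e ≟ₑ e'
  ... | yes refl = refl
  valueAt-map {e' ∷ es} f {e} (here p)   | no ne = ⊥-elim (ne p)
  valueAt-map {e' ∷ es} f {e} (there e∈) | no ne = valueAt-map f e∈

sumL-map : ∀ {A : Set} (f : A → ℕ) xs → Data.Nat.ListAction.sum (List.map f xs) ≡ Σℕ xs f
sumL-map f []       = refl
sumL-map f (x ∷ xs) = cong (f x ℕ.+_) (sumL-map f xs)

module FlowMatrix {n : ℕ} (G : Graph n) where
  open import Data.List.Membership.DecPropositional (_≟ₑ_ {n}) using (_∈?_)

  private
    V  = Fin (suc n)
    vs = allFin (suc n)
    es = edges G

  -- In this form outflow and inflow are row and column sums over all vertices, so their totals can
  -- be compared by `⨁-comm`.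
  flow : Vec ℕ (nE G) → V → V → ℕ
  flow x i j = valueAt es x (i , j)

  flow-∉ : ∀ x {i j} → (i , j) ∉ es → flow x i j ≡ 0
  flow-∉ x = valueAt-∉ {es = es} {x}

  flow-injective : ∀ {x y} → (∀ i j → flow x i j ≡ flow y i j) → x ≡ y
  flow-injective {x} {y} h = trans (sym (Vecₚ.cast-is-id refl x)) (Vecₚ.toList-injective refl x y
    (trans (toList-valueAt x (edges-unique G)) (trans (Listₚ.map-cong (λ e → h (proj₁ e) (proj₂ e)) es) (sym (toList-valueAt y (edges-unique G))))))

  fromMatrix : (V → V → ℕ) → Vec ℕ (nE G)
  fromMatrix X = Vec.map (λ e → X (proj₁ e) (proj₂ e)) (Vec.fromList es)

  flow-fromMatrix : ∀ X → (∀ {i j} → (i , j) ∉ es → X i j ≡ 0) → ∀ i j → flow (fromMatrix X) i j ≡ X i j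
  flow-fromMatrix X h i j with (i , j) ∈? es
  ... | yes e∈ = valueAt-map (λ e → X (proj₁ e) (proj₂ e)) e∈
  ... | no e∉  = trans (flow-∉ (fromMatrix X) e∉) (sym (h e∉))

  private
    Σ-labelled : ∀ x (p : Edge n → Bool) →
      Data.Nat.ListAction.sum (List.map proj₂ (filterᵇ (p ∘ proj₁) (labelled G x)))
      ≡ Σℕ vs (λ i → Σℕ vs (λ j → if p (i , j) then flow x i j else 0))
    Σ-labelled x p = trans (sumL-map proj₂ (filterᵇ (p ∘ proj₁) (labelled G x)))
      (trans (Sumℕ.⨁-filterᵇ (p ∘ proj₁) (labelled G x) proj₂)
      (trans (cong (λ l → Σℕ l (λ e → if p (proj₁ e) then proj₂ e else 0)) (zip-valueAt x (edges-unique G)))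
      (trans (Sumℕ.⨁-map (λ e → e , valueAt es x e) es (λ e → if p (proj₁ e) then proj₂ e else 0))
      (⨁-edges G ℕₚ.+-0-commutativeMonoid (λ e → if p e then valueAt es x e else 0) (λ {e} e∉ → off e (valueAt-∉ {es = es} {x} e∉))))))
      where
      off : ∀ e → valueAt es x e ≡ 0 → (if p e then valueAt es x e else 0) ≡ 0
      off e z with p e
      ... | true  = z
      ... | false = refl

  outflow-Σ : ∀ x k → outflow G x k ≡ Σℕ vs (flow x k)
  outflow-Σ x k = trans (Σ-labelled x (λ e → proj₁ e == k))
    (trans (Sumℕ.⨁-allFin-single k (λ i ne → Sumℕ.⨁-ε vs (λ {j} _ → cong (if_then flow x i j else 0) (==-≢ ne))))
           (Sumℕ.⨁-cong vs (λ {j} _ → cong (if_then flow x k j else 0) (==-refl k))))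

  inflow-Σ : ∀ x k → inflow G x k ≡ Σℕ vs (λ i → flow x i k)
  inflow-Σ x k = trans (Σ-labelled x (λ e → proj₂ e == k)) (Sumℕ.⨁-cong vs (λ {i} _ →
    trans (Sumℕ.⨁-allFin-single k (λ j ne → cong (if_then flow x i j else 0) (==-≢ ne)))
          (cong (if_then flow x i k else 0) (==-refl k))))

  numPositive-Σ : ∀ x → numPositive x ≡ Σℕ vs (λ i → Σℕ vs (λ j → 𝟙 (0 <ᵇ flow x i j)))
  numPositive-Σ x = trans (countᵇ-Σℕ (0 <ᵇ_) (Vec.toList x))
    (trans (cong (λ l → Σℕ l (λ b → 𝟙 (0 <ᵇ b))) (toList-valueAt x (edges-unique G)))
    (trans (Sumℕ.⨁-map (valueAt es x) es (λ b → 𝟙 (0 <ᵇ b)))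
    (⨁-edges G ℕₚ.+-0-commutativeMonoid (λ e → 𝟙 (0 <ᵇ valueAt es x e)) (λ e∉ → cong (λ b → 𝟙 (0 <ᵇ b)) (valueAt-∉ {es = es} {x} e∉)))))

  module _ {c ℓ} (M : CommutativeMonoid c ℓ) where
    open CommutativeMonoid M using (Carrier; _≈_; ε; reflexive) renaming (trans to ≈-trans)
    open BigOp M

    ⨁-flow : (w : ℕ → Carrier) → w 0 ≈ ε → ∀ x → ⨁ (Vec.toList x) w ≈ ⨁ vs (λ i → ⨁ vs (λ j → w (flow x i j)))
    ⨁-flow w w0 x = ≈-trans (reflexive (cong (λ l → ⨁ l w) (toList-valueAt x (edges-unique G))))
        (≈-trans (⨁-map (valueAt es x) es w)
                 (⨁-edges G M (w ∘ valueAt es x) (λ e∉ → ≈-trans (reflexive (cong w (valueAt-∉ {es = es} {x} e∉))) w0)))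

  module _ (a : Fin n → ℕ) where
    -- The balance at 0 is automatic: total outflow equals total inflow, and the equations at the
    -- other vertices cancel from this.
    isIntFlow-intro : ∀ x → (∀ k → Σℕ vs (flow x (suc k)) ≡ a k ℕ.+ Σℕ vs (λ i → flow x i (suc k))) → IsIntFlow G a x
    isIntFlow-intro x h = (λ k → trans (outflow-Σ x (suc k)) (trans (h k) (cong (a k ℕ.+_) (sym (inflow-Σ x (suc k)))))) , root
      where
      ins outs : V → ℕ
      ins k  = Σℕ vs (λ i → flow x i k)
      outs k = Σℕ vs (flow x k)
      I = Σℕ (allFin n) (ins ∘ suc)
      total : ins zero ℕ.+ I ≡ (Σℕ (allFin n) a ℕ.+ outs zero) ℕ.+ I
      total = begin
        ins zero ℕ.+ I                                     ≡⟨ Sumℕ.⨁-allFin-suc n ins ⟨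
        Σℕ vs ins                                          ≡⟨ Sumℕ.⨁-comm vs vs (flow x) ⟨
        Σℕ vs outs                                         ≡⟨ Sumℕ.⨁-allFin-suc n outs ⟩
        outs zero ℕ.+ Σℕ (allFin n) (outs ∘ suc)           ≡⟨ cong (outs zero ℕ.+_) (trans (Sumℕ.⨁-cong (allFin n) (λ {k} _ → h k)) (Sumℕ.⨁-∙ (allFin n) a (ins ∘ suc))) ⟩
        outs zero ℕ.+ (Σℕ (allFin n) a ℕ.+ I)              ≡⟨ ℕₚ.+-assoc (outs zero) (Σℕ (allFin n) a) I ⟨
        (outs zero ℕ.+ Σℕ (allFin n) a) ℕ.+ I              ≡⟨ cong (ℕ._+ I) (ℕₚ.+-comm (outs zero) (Σℕ (allFin n) a)) ⟩
        (Σℕ (allFin n) a ℕ.+ outs zero) ℕ.+ I              ∎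
        where
        open ≡.≡-Reasoning
      root : inflow G x zero ≡ sumℕ a ℕ.+ outflow G x zero
      root = trans (inflow-Σ x zero) (trans (ℕₚ.+-cancelʳ-≡ I (ins zero) _ total)
        (sym (cong₂ ℕ._+_ (sumL-map a (allFin n)) (outflow-Σ x zero))))

    isIntFlow-conservation : ∀ {x} → IsIntFlow G a x → ∀ k → Σℕ vs (flow x (suc k)) ≡ a k ℕ.+ Σℕ vs (λ i → flow x i (suc k))
    isIntFlow-conservation {x} (h , _) k = trans (sym (outflow-Σ x (suc k))) (trans (h k) (cong (a k ℕ.+_) (inflow-Σ x (suc k))))

-- Conditionals and indicators

module _ {ℓ} {A : Set ℓ} {x y : A} where
  if-true : ∀ {b} → b ≡ true → (if b then x else y) ≡ x
  if-true refl = refl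

  if-false : ∀ {b} → b ≡ false → (if b then x else y) ≡ y
  if-false refl = refl

<ᵇ-suc-≢ : ∀ {l t} → l ≢ t → (l <ᵇ suc t) ≡ (l <ᵇ t)
<ᵇ-suc-≢ {l} {t} ne with l <ᵇ t in eq
... | true  = <ᵇ-true (ℕₚ.m<n⇒m<1+n (<ᵇ-sound {l} eq))
... | false = ¬true⇒false (λ h → true≢false (<ᵇ-true (ℕₚ.≤∧≢⇒< (ℕₚ.≤-pred (<ᵇ-sound {l} h)) ne)) eq)

module Indicator {c ℓ : Level} (R : CommutativeRing c ℓ) where
  open CommutativeRing R using (Carrier; _≈_; _+_; 0#; +-identityˡ; +-identityʳ) renaming (refl to ≈-refl; sym to ≈-sym)

  ind : {P : Set} → Dec P → Carrier → Carrier
  ind (yes _) w = w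
  ind (no _)  w = 0#

  module _ {P : Set} {w : Carrier} where
    ind-yes : (d : Dec P) → P → ind d w ≈ w
    ind-yes (yes _) p = ≈-refl
    ind-yes (no ¬p) p = ⊥-elim (¬p p)

    ind-no : (d : Dec P) → ¬ P → ind d w ≈ 0#
    ind-no (yes p) ¬p = ⊥-elim (¬p p)
    ind-no (no _)  ¬p = ≈-refl

  module _ {P Q : Set} {w : Carrier} where
    ind-⇔ : (d : Dec P) (e : Dec Q) → (P → Q) → (Q → P) → ind d w ≈ ind e w
    ind-⇔ (yes p) e f g = ≈-sym (ind-yes e (f p))
    ind-⇔ (no ¬p) e f g = ≈-sym (ind-no e (¬p ∘ g))

    -- The object side of a deletion-contraction step. The last hypothesis admits leftover objects
    -- of weight 0: for flows these are the ones that use two out-edges of a vertex, for trees there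
    -- are none.
    ind-split : ∀ {S : Set} (d : Dec P) (e : Dec Q) (f : Dec S) → (Q → P) → (S → P) → (Q → S → ⊥) →
                (P → ¬ Q → ¬ S → w ≈ 0#) → ind d w ≈ ind e w + ind f w
    ind-split (yes p) (yes q) (yes s) _ _ disj _ = ⊥-elim (disj q s)
    ind-split (yes p) (yes q) (no _)  _ _ _ _    = ≈-sym (+-identityʳ _)
    ind-split (yes p) (no _)  (yes s) _ _ _ _    = ≈-sym (+-identityˡ _)
    ind-split (yes p) (no ¬q) (no ¬s) _ _ _ z    = CommutativeRing.trans R (z p ¬q ¬s) (≈-sym (+-identityˡ _))
    ind-split (no ¬p) (yes q) _       f _ _ _    = ⊥-elim (¬p (f q))
    ind-split (no ¬p) _       (yes s) _ g _ _    = ⊥-elim (¬p (g s))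
    ind-split (no ¬p) (no _)  (no _)  _ _ _ _    = ≈-sym (+-identityˡ _)

-- Flows: the sum at t = 1 obeys the recursion of K

module Flows {c ℓ : Level} (R : CommutativeRing c ℓ) (q : CommutativeRing.Carrier R)
             {n : ℕ} (G : Graph n) (sh : IsShifted G) (a : Fin n → ℕ) (a≥1 : ∀ k → 1 ≤ a k) where
  open WeightedSubgraphs R q
  open import Algebra.Properties.Ring ring using (-0#≈0#)
  open Indicator R
  open FlowMatrix G
  open IsShifted sh
  open import Relation.Binary.Reasoning.Setoid setoid using (begin_; step-≈-⟩; _∎)

  private
    V  = Fin (suc n)
    vs = allFin (suc n)
    es = edges G

  wt : Vec ℕ (nE G) → Carrier
  wt = flowWt R q 1# n

  -- Positivity matters: at 0 the weight is 1 whereas `[ 0 ]` is 0.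
  wtQT-[] : ∀ {b} → 1 ≤ b → wtQT R q 1# b ≈ [ b ]
  wtQT-[] {suc b} _ = SumR.⨁-cong (List.upTo (suc b)) (λ {i} _ → ≈-trans (*-congˡ (one^ (b ∸ i))) (*-identityʳ _))
    where
    one^ : ∀ k → 1# ^ k ≈ 1#
    one^ zero    = ≈-refl
    one^ (suc k) = ≈-trans (*-identityˡ _) (one^ k)

  module _ {x : Vec ℕ (nE G)} (isFlow : IsIntFlow G a x) where
    out>0 : ∀ k → 0 < Σℕ vs (flow x (suc k))
    out>0 k = ℕₚ.≤-trans (a≥1 k) (ℕₚ.≤-trans (ℕₚ.m≤m+n (a k) _) (ℕₚ.≤-reflexive (sym (isIntFlow-conservation a {x} isFlow k))))

    positives : V → ℕ
    positives i = Σℕ vs (λ j → 𝟙 (0 <ᵇ flow x i j))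

    positives≥1 : ∀ k → 1 ≤ positives (suc k)
    positives≥1 k = let (j , _ , lt) = Σℕ-pos vs (flow x (suc k)) (out>0 k) in
      ℕₚ.≤-trans (ℕₚ.≤-reflexive (cong 𝟙 (sym (<ᵇ-true lt)))) (Σℕ-term (λ j → 𝟙 (0 <ᵇ flow x (suc k) j)) (∈-allFin j))

    positives≥2 : ∀ i {j j'} → j ≢ j' → 0 < flow x i j → 0 < flow x i j' → 2 ≤ positives i
    positives≥2 i {j} {j'} ne p p' = ℕₚ.≤-trans (ℕₚ.≤-reflexive (sym two)) (Σℕ-mono vs (λ {l} _ → pt l (l Finₚ.≟ j) (l Finₚ.≟ j')))
      where
      two : Σℕ vs (λ l → 𝟙 (l == j) ℕ.+ 𝟙 (l == j')) ≡ 2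
      two = trans (Sumℕ.⨁-∙ vs (λ l → 𝟙 (l == j)) (λ l → 𝟙 (l == j'))) (cong₂ ℕ._+_
        (trans (Sumℕ.⨁-allFin-single j (λ l ne → cong 𝟙 (==-≢ ne))) (cong 𝟙 (==-refl j)))
        (trans (Sumℕ.⨁-allFin-single j' (λ l ne → cong 𝟙 (==-≢ ne))) (cong 𝟙 (==-refl j'))))
      pt : ∀ l → Dec (l ≡ j) → Dec (l ≡ j') → 𝟙 (l == j) ℕ.+ 𝟙 (l == j') ≤ 𝟙 (0 <ᵇ flow x i l)
      pt l (yes refl) _ = ℕₚ.≤-reflexive (trans (cong₂ ℕ._+_ (cong 𝟙 (==-refl l)) (cong 𝟙 (==-≢ ne))) (cong 𝟙 (sym (<ᵇ-true p))))
      pt l (no l≢j) (yes refl) = ℕₚ.≤-reflexive (trans (cong₂ ℕ._+_ (cong 𝟙 (==-≢ l≢j)) (cong 𝟙 (==-refl l))) (cong 𝟙 (sym (<ᵇ-true p'))))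
      pt l (no l≢j) (no l≢j') = ℕₚ.≤-trans (ℕₚ.≤-reflexive (cong₂ ℕ._+_ (cong 𝟙 (==-≢ l≢j)) (cong 𝟙 (==-≢ l≢j')))) z≤n

    -- Positive supplies force a positive out-edge at each of the n vertices other than 0, so a
    -- second one at any of them takes the count past n.
    n<numPositive : ∀ k {j j'} → j ≢ j' → 0 < flow x (suc k) j → 0 < flow x (suc k) j' → n < numPositive x
    n<numPositive k ne p p' = ℕₚ.≤-trans (ℕₚ.≤-reflexive (cong suc (sym (trans (Σℕ-const (allFin n) 1) (trans (ℕₚ.*-identityʳ _) (length-allFin n))))))
      (ℕₚ.≤-trans (Σℕ-mono-< {f = λ _ → 1} {positives ∘ suc} (∈-allFin k) (positives≥2 (suc k) ne p p') (λ {l} _ → positives≥1 l))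
      (ℕₚ.≤-trans (ℕₚ.m≤n+m _ (positives zero)) (ℕₚ.≤-reflexive (sym (trans (numPositive-Σ x) (Sumℕ.⨁-allFin-suc n positives))))))

    wt-zero : n < numPositive x → wt x ≈ 0#
    wt-zero lt = ≈-trans (*-congʳ (vanish (numPositive x ∸ n) (ℕₚ.m<n⇒0<n∸m lt))) (zeroˡ _)
      where
      vanish : ∀ k → 0 < k → (- ((1# - 1#) * (1# - q))) ^ k ≈ 0#
      vanish (suc k) _ = ≈-trans (*-congʳ (≈-trans (-‿cong (≈-trans (*-congʳ (-‿inverseʳ 1#)) (zeroˡ _))) -0#≈0#)) (zeroˡ _)

  module _ (L : List (Vec ℕ (nE G))) (uL : Unique L) (mem : ∀ x → (x ∈ L) ⇔ IsIntFlow G a x) where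

    Supported : ℕ → (V → V) → Vec ℕ (nE G) → Set
    Supported m f x = ∀ i → m < toℕ i → ∀ j → j ≢ f i → flow x i j ≡ 0

    supported? : ∀ m f x → Dec (Supported m f x)
    supported? m f x = Finₚ.all? λ i → (m ℕₚ.<? toℕ i) →-dec Finₚ.all? λ j → (¬? (j Finₚ.≟ f i)) →-dec (flow x i j ℕₚ.≟ 0)

    μ : ℕ → (V → ℕ) → Edge n → ℕ
    μ m s e = if toℕ (proj₁ e) <ᵇ suc m then s (proj₁ e) else 0

    -- The vertices above m have been contracted: i has been merged with target i, and ρ i is the
    -- vertex it has ended up in.
    record State (m : ℕ) : Set where
      field
        target : V → V
        supply : V → ℕ
        acc    : List (Edge n)
        ρ      : V → V
        target-edge : ∀ i → m < toℕ i → (i , target i) ∈ es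
        supply-eq   : ∀ k → supply k ≡ aAt a k ℕ.+ Σℕ vs (λ i → if (m <ᵇ toℕ i) ∧ (target i == k) then supply i else 0)
        forced      : ∀ {x} → x ∈ L → Supported m target x → ∀ i → m < toℕ i → flow x i (target i) ≡ supply i
        length-acc  : m ℕ.+ length acc ≡ n
        ρ-acc       : ∀ {u v} → (u , v) ∈ acc → ρ u ≡ ρ v
        ρ-fix       : ∀ {v} → toℕ v ≤ m → ρ v ≡ v
        ρ-≤         : ∀ v → toℕ (ρ v) ≤ m
        ρ-conn      : ∀ v → Conn acc v (ρ v)

      -- The weight at t = 1 of the settled edges `(i , target i)`, which carry the flow `supply i`
      -- by `forced`.
      prefactor : Carrier
      prefactor = ProdR.⨁ vs (λ i → if m <ᵇ toℕ i then [ supply i ] else 1#)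

    module Step {m : ℕ} (st : State (suc m)) (v : V) (v≡ : toℕ v ≡ suc m) (j : V) (j<v : toℕ j < toℕ v) (vj : G v j ≡ true) where
      open State st

      j≤m : toℕ j ≤ m
      j≤m = ℕₚ.≤-pred (ℕₚ.≤-trans j<v (ℕₚ.≤-reflexive v≡))

      v≢j : v ≢ j
      v≢j refl = ℕₚ.<-irrefl refl j<v

      target' : V → V
      target' i = if i == v then j else target i

      supply' : V → ℕ
      supply' k = supply k ℕ.+ (if k == j then supply v else 0)

      ρ' : V → V
      ρ' w = if ρ w == v then j else ρ w

      target'-v : target' v ≡ j
      target'-v = if-true (==-refl v)

      target'-≢ : ∀ {i} → i ≢ v → target' i ≡ target i
      target'-≢ ne = if-false (==-≢ ne)

      supply'-≢ : ∀ {i} → i ≢ j → supply' i ≡ supply i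
      supply'-≢ ne = trans (cong (supply _ ℕ.+_) (if-false (==-≢ ne))) (ℕₚ.+-identityʳ _)

      above : ∀ {i} → m < toℕ i → i ≢ v → suc m < toℕ i
      above lt ne = ℕₚ.≤∧≢⇒< lt (λ e → ne (Finₚ.toℕ-injective (trans (sym e) (sym v≡))))

      above⇒≢v : ∀ {i} → suc m < toℕ i → i ≢ v
      above⇒≢v lt refl = ℕₚ.<-irrefl (sym v≡) lt

      m<v : m < toℕ v
      m<v = ℕₚ.≤-reflexive (sym v≡)

      above⇒≢j : ∀ {i} → m < toℕ i → i ≢ j
      above⇒≢j lt refl = ℕₚ.<⇒≱ lt j≤m

      supported-weaken : ∀ {x} → Supported m target' x → Supported (suc m) target x
      supported-weaken P i lt l ne = P i (ℕₚ.<-trans (ℕₚ.n<1+n m) lt) l (λ e → ne (trans e (target'-≢ (above⇒≢v lt))))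

      target-edge' : ∀ i → m < toℕ i → (i , target' i) ∈ es
      target-edge' i lt with i Finₚ.≟ v
      ... | yes refl = ∈-edges⁺ G j<v vj
      ... | no ne    = target-edge i (above lt ne)

      supply-eq' : ∀ k → supply' k ≡ aAt a k ℕ.+ Σℕ vs (λ i → if (m <ᵇ toℕ i) ∧ (target' i == k) then supply' i else 0)
      supply-eq' k = begin≡
          supply k ℕ.+ δ                                    ≡⟨ cong (ℕ._+ δ) (supply-eq k) ⟩
          aAt a k ℕ.+ Σℕ vs old ℕ.+ δ                       ≡⟨ ℕₚ.+-assoc (aAt a k) (Σℕ vs old) δ ⟩
          aAt a k ℕ.+ (Σℕ vs old ℕ.+ δ)                     ≡⟨ cong (λ z → aAt a k ℕ.+ (Σℕ vs old ℕ.+ z)) (trans (if-true (==-refl v)) δ-sym) ⟨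
          aAt a k ℕ.+ (Σℕ vs old ℕ.+ extra v)               ≡⟨ cong (λ z → aAt a k ℕ.+ (Σℕ vs old ℕ.+ z)) (Sumℕ.⨁-allFin-single v {extra} (λ i ne → if-false (==-≢ ne))) ⟨
          aAt a k ℕ.+ (Σℕ vs old ℕ.+ Σℕ vs extra)           ≡⟨ cong (aAt a k ℕ.+_) (Sumℕ.⨁-∙ vs old extra) ⟨
          aAt a k ℕ.+ Σℕ vs (λ i → old i ℕ.+ extra i)       ≡⟨ cong (aAt a k ℕ.+_) (Sumℕ.⨁-cong vs (λ {i} _ → pt i (i Finₚ.≟ v) (m ℕₚ.<? toℕ i))) ⟩
          aAt a k ℕ.+ Σℕ vs new                             ∎≡
        where
        open ≡.≡-Reasoning renaming (begin_ to begin≡_; _∎ to _∎≡)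
        δ = if k == j then supply v else 0
        old extra new : V → ℕ
        old i   = if (suc m <ᵇ toℕ i) ∧ (target i == k) then supply i else 0
        new i   = if (m <ᵇ toℕ i) ∧ (target' i == k) then supply' i else 0
        extra i = if i == v then (if j == k then supply v else 0) else 0
        δ-sym : (if j == k then supply v else 0) ≡ δ
        δ-sym = case (k Finₚ.≟ j) of λ where
          (yes refl) → refl
          (no ne)    → trans (if-false (==-≢ (ne ∘ sym))) (sym (if-false (==-≢ ne)))
        pt : ∀ i → Dec (i ≡ v) → Dec (m < toℕ i) → old i ℕ.+ extra i ≡ new i
        pt i (yes refl) _ = trans (cong₂ ℕ._+_ (if-false (cong (_∧ (target i == k)) (<ᵇ-false (ℕₚ.≤-reflexive v≡)))) (if-true (==-refl v)))
          (sym (trans (cong₂ (λ b t → if b ∧ (t == k) then supply' v else 0) (<ᵇ-true m<v) target'-v)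
                      (cong (if j == k then_else 0) (supply'-≢ v≢j))))
        pt i (no ne) (yes lt) = trans (cong₂ ℕ._+_ (cong (λ b → if b ∧ (target i == k) then supply i else 0) (<ᵇ-true (above lt ne))) (if-false (==-≢ ne)))
          (trans (ℕₚ.+-identityʳ _) (sym (trans (cong₂ (λ b t → if b ∧ (t == k) then supply' i else 0) (<ᵇ-true lt) (target'-≢ ne))
                      (cong (if target i == k then_else 0) (supply'-≢ (above⇒≢j lt))))))
        pt i (no ne) (no nlt) = trans (cong₂ ℕ._+_ (if-false (cong (_∧ (target i == k)) (<ᵇ-false (ℕₚ.m≤n⇒m≤1+n (ℕₚ.≮⇒≥ nlt))))) (if-false (==-≢ ne)))
          (sym (if-false (cong (_∧ (target' i == k)) (<ᵇ-false (ℕₚ.≮⇒≥ nlt)))))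

      -- Flow enters `v` only from larger vertices, where it is already known, so conservation fixes
      -- the outflow of `v` as `supply v`; the support condition puts all of it on `(v , j)`.
      forced' : ∀ {x} → x ∈ L → Supported m target' x → ∀ i → m < toℕ i → flow x i (target' i) ≡ supply' i
      forced' {x} x∈ P i lt = trans (go i lt (i Finₚ.≟ v)) (sym (supply'-≢ (above⇒≢j lt)))
        where
        P⁺ : Supported (suc m) target x
        P⁺ = supported-weaken P
        inflow-v : ∀ i → flow x i v ≡ (if (suc m <ᵇ toℕ i) ∧ (target i == v) then supply i else 0)
        inflow-v i with suc m ℕₚ.<? toℕ i
        ... | no nlt = trans (flow-∉ x (λ e∈ → nlt (subst (_< toℕ i) v≡ (proj₁ (∈-edges⁻ G e∈)))))
                             (sym (if-false (cong (_∧ (target i == v)) (<ᵇ-false (ℕₚ.≮⇒≥ nlt)))))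
        ... | yes lt with target i Finₚ.≟ v
        ...   | yes refl = trans (forced x∈ P⁺ i lt) (sym (if-true (cong₂ _∧_ (<ᵇ-true lt) refl)))
        ...   | no ne    = trans (P⁺ i lt v (ne ∘ sym)) (sym (if-false (cong₂ _∧_ (<ᵇ-true lt) refl)))
        out-v : ∀ w → w ≡ v → Σℕ vs (flow x w) ≡ aAt a w ℕ.+ Σℕ vs (λ i → flow x i w)
        out-v zero    refl = ⊥-elim (ℕₚ.0≢1+n v≡)
        out-v (suc k) e    = isIntFlow-conservation a {x} (Equivalence.to (mem x) x∈) k
        go : ∀ i → m < toℕ i → Dec (i ≡ v) → flow x i (target' i) ≡ supply i
        go i lt (no ne) = trans (cong (flow x i) (target'-≢ ne)) (forced x∈ P⁺ i (above lt ne))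
        go i lt (yes refl) = trans (sym (Sumℕ.⨁-allFin-single (target' v) (λ l ne → P v m<v l ne)))
          (trans (out-v v refl) (trans (cong (aAt a v ℕ.+_) (Sumℕ.⨁-cong vs (λ {i} _ → inflow-v i))) (sym (supply-eq v))))

      ρv : ρ v ≡ v
      ρv = ρ-fix (ℕₚ.≤-reflexive v≡)

      ρj : ρ j ≡ j
      ρj = ρ-fix (ℕₚ.m≤n⇒m≤1+n j≤m)

      ρ'-of : ∀ {w z} → ρ w ≡ z → z ≢ v → ρ' w ≡ z
      ρ'-of {w} refl ne = if-false (==-≢ ne)

      next : State m
      next = record
        { target = target' ; supply = supply' ; acc = (v , j) ∷ acc ; ρ = ρ'
        ; target-edge = target-edge' ; supply-eq = supply-eq' ; forced = forced'
        ; length-acc = trans (ℕₚ.+-suc m (length acc)) length-acc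
        ; ρ-acc = λ { (here refl) → trans (if-true (trans (cong (_== v) ρv) (==-refl v))) (sym (ρ'-of ρj (v≢j ∘ sym)))
                    ; (there e∈) → cong (λ z → if z == v then j else z) (ρ-acc e∈) }
        ; ρ-fix = λ {w} le → ρ'-of (ρ-fix (ℕₚ.m≤n⇒m≤1+n le)) (λ { refl → ℕₚ.<⇒≱ m<v le })
        ; ρ-≤ = ρ'-≤
        ; ρ-conn = ρ'-conn
        }
        where
        ρ'-≤ : ∀ w → toℕ (ρ' w) ≤ m
        ρ'-≤ w with ρ w Finₚ.≟ v
        ... | yes e = j≤m
        ... | no ne = ℕₚ.≤-pred (ℕₚ.≤∧≢⇒< (ρ-≤ w) (λ e → ne (Finₚ.toℕ-injective (trans e (sym v≡)))))
        ρ'-conn : ∀ w → Conn ((v , j) ∷ acc) w (ρ' w)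
        ρ'-conn w with ρ w Finₚ.≟ v
        ... | yes e = ctrans (Conn-there (subst (Conn acc w) e (ρ-conn w))) (cedge (here refl))
        ... | no ne = Conn-there (ρ-conn w)

      prefactor-next : State.prefactor next ≈ prefactor * [ supply v ]
      prefactor-next = begin
          State.prefactor next                                       ≈⟨ ProdR.⨁-cong vs (λ {i} _ → ≈-sym (pt i (i Finₚ.≟ v) (m ℕₚ.<? toℕ i))) ⟩
          ProdR.⨁ vs (λ i → old i * extra i)                          ≈⟨ ProdR.⨁-∙ vs old extra ⟩
          prefactor * ProdR.⨁ vs extra                                ≈⟨ *-congˡ (ProdR.⨁-allFin-single v (λ i ne → reflexive (if-false (==-≢ ne)))) ⟩
          prefactor * extra v                                        ≈⟨ *-congˡ (reflexive (if-true (==-refl v))) ⟩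
          prefactor * [ supply v ]                                   ∎
        where
        old extra : V → Carrier
        old i   = if suc m <ᵇ toℕ i then [ supply i ] else 1#
        extra i = if i == v then [ supply v ] else 1#
        pt : ∀ i → Dec (i ≡ v) → Dec (m < toℕ i) → old i * extra i ≈ (if m <ᵇ toℕ i then [ supply' i ] else 1#)
        pt i (yes refl) _ = ≈-trans (*-cong (reflexive (if-false (<ᵇ-false (ℕₚ.≤-reflexive v≡)))) (reflexive (if-true (==-refl v))))
          (≈-trans (*-identityˡ _) (reflexive (sym (trans (if-true (<ᵇ-true m<v)) (cong [_] (supply'-≢ v≢j))))))
        pt i (no ne) (yes lt) = ≈-trans (*-cong (reflexive (if-true (<ᵇ-true (above lt ne)))) (reflexive (if-false (==-≢ ne))))
          (≈-trans (*-identityʳ _) (reflexive (sym (trans (if-true (<ᵇ-true lt)) (cong [_] (supply'-≢ (above⇒≢j lt)))))))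
        pt i (no ne) (no nlt) = ≈-trans (*-cong (reflexive (if-false (<ᵇ-false (ℕₚ.m≤n⇒m≤1+n (ℕₚ.≮⇒≥ nlt))))) (reflexive (if-false (==-≢ ne))))
          (≈-trans (*-identityʳ _) (reflexive (sym (if-false (<ᵇ-false (ℕₚ.≮⇒≥ nlt))))))

    Claim : ∀ {m} → State m → Set ℓ
    Claim {m} st = SumR.⨁ L (λ x → ind (supported? m target x) (wt x)) ≈ prefactor * K es (μ m supply) acc
      where
      open State st

    module Inner {m : ℕ} (st : State (suc m)) (v : V) (v≡ : toℕ v ≡ suc m) where
      open State st

      -- The live multiplicities while `v` is being resolved: of its bundles only those to vertices
      -- below θ remain, and the smaller vertices are untouched.
      ν : ℕ → Edge n → ℕ
      ν θ e = if toℕ (proj₁ e) <ᵇ suc m then supply (proj₁ e)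
              else (if proj₁ e == v then (if toℕ (proj₂ e) <ᵇ θ then supply v else 0) else 0)

      data Position (i : V) : Set where
        low  : toℕ i < suc m → Position i
        mid  : i ≡ v → Position i
        high : suc m < toℕ i → Position i

      position : ∀ i → Position i
      position i with ℕₚ.<-cmp (toℕ i) (suc m)
      ... | tri< lt _ _ = low lt
      ... | tri≈ _ e _  = mid (Finₚ.toℕ-injective (trans e (sym v≡)))
      ... | tri> _ _ gt = high gt

      v≮ : (toℕ v <ᵇ suc m) ≡ false
      v≮ = <ᵇ-false (ℕₚ.≤-reflexive (sym v≡))

      low⇒≢ : ∀ {i} → toℕ i < suc m → i ≢ v
      low⇒≢ lt refl = ℕₚ.<⇒≢ lt v≡

      high⇒≢ : ∀ {i} → suc m < toℕ i → i ≢ v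
      high⇒≢ lt refl = ℕₚ.<⇒≢ lt (sym v≡)

      ν-low : ∀ θ l {i} → toℕ i < suc m → ν θ (i , l) ≡ supply i
      ν-low θ l lt = if-true (<ᵇ-true lt)

      ν-mid : ∀ θ l → ν θ (v , l) ≡ (if toℕ l <ᵇ θ then supply v else 0)
      ν-mid θ l = trans (if-false v≮) (if-true (==-refl v))

      ν-high : ∀ θ l {i} → suc m < toℕ i → ν θ (i , l) ≡ 0
      ν-high θ l lt = trans (if-false (<ᵇ-false (ℕₚ.<⇒≤ lt))) (if-false (==-≢ (high⇒≢ lt)))

      module Move (j : V) (j<v : toℕ j < toℕ v) (vj : G v j ≡ true) where
        open Step st v v≡ j j<v vj using (supply'; v≢j; j≤m)

        -- κ interpolates between ν and μ, moving the edges (v , k) with k ≥ t over to (j , k).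
        κ : ℕ → Edge n → ℕ
        κ t e = if proj₁ e == v then (if toℕ (proj₂ e) <ᵇ t then supply v else 0)
                else (if toℕ (proj₁ e) <ᵇ suc m
                      then supply (proj₁ e) ℕ.+ (if (proj₁ e == j) ∧ not (toℕ (proj₂ e) <ᵇ t) then supply v else 0)
                      else 0)

        κ-mid : ∀ t l → κ t (v , l) ≡ (if toℕ l <ᵇ t then supply v else 0)
        κ-mid t l = if-true (==-refl v)

        κ-low : ∀ t l {i} → toℕ i < suc m → κ t (i , l) ≡ supply i ℕ.+ (if (i == j) ∧ not (toℕ l <ᵇ t) then supply v else 0)
        κ-low t l lt = trans (if-false (==-≢ (low⇒≢ lt))) (if-true (<ᵇ-true lt))

        κ-high : ∀ t l {i} → suc m < toℕ i → κ t (i , l) ≡ 0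
        κ-high t l lt = trans (if-false (==-≢ (high⇒≢ lt))) (if-false (<ᵇ-false (ℕₚ.<⇒≤ lt)))

        A : List (Edge n)
        A = (v , j) ∷ acc

        κ-start : ∀ {e} → e ∈ es → ν (toℕ j) e ≡ κ (toℕ j) e
        κ-start {i , l} e∈ with position i
        ... | mid refl = trans (ν-mid (toℕ j) l) (sym (κ-mid (toℕ j) l))
        ... | high gt  = trans (ν-high (toℕ j) l gt) (sym (κ-high (toℕ j) l gt))
        ... | low lt   = trans (ν-low (toℕ j) l lt) (sym (trans (κ-low (toℕ j) l lt) (trans (cong (supply i ℕ.+_) (if-false none)) (ℕₚ.+-identityʳ _))))
          where
          none : ((i == j) ∧ not (toℕ l <ᵇ toℕ j)) ≡ false
          none with i Finₚ.≟ j
          ... | no _     = refl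
          ... | yes refl = cong not (<ᵇ-true (proj₁ (∈-edges⁻ G e∈)))

        κ-end : ∀ {e} → e ∈ es → κ 0 e ≡ μ m supply' e
        κ-end {i , l} e∈ with position i
        ... | mid refl = trans (κ-mid 0 l) (sym (if-false v≮))
        ... | high gt  = trans (κ-high 0 l gt) (sym (if-false (<ᵇ-false (ℕₚ.<⇒≤ gt))))
        ... | low lt   = trans (κ-low 0 l lt) (trans (cong (λ b → supply i ℕ.+ (if b then supply v else 0)) (Boolₚ.∧-identityʳ (i == j)))
                               (sym (if-true (<ᵇ-true lt))))

        -- With `(v , j)` prescribed, `(v , k)` and `(j , k)` are parallel for each k < j. Both are
        -- edges of G: v ~ j shifts down to v ~ k since k < j, and this shifts down to j ~ k since j
        -- < v.
        move : ∀ t → t ≤ toℕ j → K es (κ t) A ≈ K es (κ 0) A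
        move zero    _  = ≈-refl
        move (suc t) le = ≈-trans (K-move-parallel A (edges-unique G) vk∈ jk∈ (v≢j ∘ cong proj₁)
            (ctrans (csym (cedge (there (here refl)))) (cedge (here refl)))
            (ctrans (cedge (there (here refl))) (cedge (here refl)))
            (trans (κ-mid t k) (if-false k≮))
            (trans (κ-low t k (s≤s j≤m)) (trans (cong (supply j ℕ.+_) (if-true (cong₂ (λ b c → b ∧ not c) (==-refl j) k≮)))
              (trans (ℕₚ.+-comm (supply j) (supply v)) (sym (cong₂ ℕ._+_ (trans (κ-mid (suc t) k) (if-true k<)) (trans (κ-low (suc t) k (s≤s j≤m))
                (trans (cong (supply j ℕ.+_) (if-false (trans (cong ((j == j) ∧_) (cong not k<)) (Boolₚ.∧-zeroʳ (j == j))))) (ℕₚ.+-identityʳ _))))))))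
            (λ {f} → other f)) (move t (ℕₚ.<⇒≤ le))
          where
          k : V
          k = Fin.fromℕ< (ℕₚ.<-trans le (Finₚ.toℕ<n j))
          k≡ : toℕ k ≡ t
          k≡ = Finₚ.toℕ-fromℕ< _
          k<j : toℕ k < toℕ j
          k<j = subst (_< toℕ j) (sym k≡) le
          k≮ : (toℕ k <ᵇ t) ≡ false
          k≮ = <ᵇ-false (ℕₚ.≤-reflexive (sym k≡))
          k< : (toℕ k <ᵇ suc t) ≡ true
          k< = <ᵇ-true (s≤s (ℕₚ.≤-reflexive k≡))
          vk : G v k ≡ true
          vk = trans (symmetric v k) (shifted k<j (λ e → ℕₚ.<⇒≢ (ℕₚ.<-trans k<j j<v) (cong toℕ (sym e))) (trans (symmetric j v) vj))
          vk∈ : (v , k) ∈ es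
          vk∈ = ∈-edges⁺ G (ℕₚ.<-trans k<j j<v) vk
          jk∈ : (j , k) ∈ es
          jk∈ = ∈-edges⁺ G k<j (shifted j<v (λ e → ℕₚ.<⇒≢ k<j (cong toℕ e)) vk)
          ≢t : ∀ {l} → l ≢ k → toℕ l ≢ t
          ≢t ne e = ne (Finₚ.toℕ-injective (trans e (sym k≡)))
          other : ∀ f → f ∈ es → f ≢ (v , k) → f ≢ (j , k) → κ t f ≡ κ (suc t) f
          other (i , l) _ ne ne' with position i
          ... | mid refl = trans (κ-mid t l) (trans (cong (if_then supply v else 0) (sym (<ᵇ-suc-≢ (≢t (ne ∘ cong (v ,_)))))) (sym (κ-mid (suc t) l)))
          ... | high gt  = trans (κ-high t l gt) (sym (κ-high (suc t) l gt))
          ... | low lt   = trans (κ-low t l lt) (trans (cong (λ b → supply i ℕ.+ (if b then supply v else 0)) same) (sym (κ-low (suc t) l lt)))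
            where
            same : ((i == j) ∧ not (toℕ l <ᵇ t)) ≡ ((i == j) ∧ not (toℕ l <ᵇ suc t))
            same with i Finₚ.≟ j
            ... | no _     = refl
            ... | yes refl = cong not (sym (<ᵇ-suc-≢ (≢t (ne' ∘ cong (j ,_)))))

        contract : K es (ν (toℕ j)) A ≈ K es (μ m supply') A
        contract = ≈-trans (K-cong es A κ-start) (≈-trans (move (toℕ j) ℕₚ.≤-refl) (K-cong es A κ-end))

      Supp : ℕ → Vec ℕ (nE G) → Set
      Supp θ x = Supported (suc m) target x × (∀ j → θ ≤ toℕ j → flow x v j ≡ 0)

      supp? : ∀ θ x → Dec (Supp θ x)
      supp? θ x = supported? (suc m) target x ×-dec Finₚ.all? (λ j → (θ ℕₚ.≤? toℕ j) →-dec (flow x v j ℕₚ.≟ 0))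

      out≢0 : ∀ {x} → x ∈ L → ∀ w → w ≡ v → ¬ (∀ l → flow x w l ≡ 0)
      out≢0 x∈ zero    refl _ = ℕₚ.0≢1+n v≡
      out≢0 {x} x∈ (suc k) _ z = ℕₚ.<⇒≢ (out>0 (Equivalence.to (mem x) x∈) k) (sym (Sumℕ.⨁-ε vs (λ {l} _ → z l)))

      two-positive : ∀ {x} → x ∈ L → ∀ w → w ≡ v → ∀ {j j'} → j ≢ j' → 0 < flow x w j → 0 < flow x w j' → wt x ≈ 0#
      two-positive x∈ zero    refl _ _ _ = ⊥-elim (ℕₚ.0≢1+n v≡)
      two-positive {x} x∈ (suc k) _ ne p p' = let isF = Equivalence.to (mem x) x∈ in wt-zero isF (n<numPositive isF k ne p p')

      module _ (ih : ∀ (st' : State m) → Claim st') where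
        -- Raising θ by one readmits flow from `v` to the vertex `j` labelled θ. If the two are
        -- adjacent, this is one deletion-contraction of the bundle `(v , j)` on the graph side, and
        -- the contracted term is the claim for `next`, supplied by `ih`.
        inner : ∀ θ → θ ≤ suc m → SumR.⨁ L (λ x → ind (supp? θ x) (wt x)) ≈ prefactor * K es (ν θ) acc
        -- Both sides vanish: `v` has to send something, and the class of `v` has no live edge left,
        -- so the colouring `ρ w == v` separates it from 0.
        inner zero _ = ≈-trans (SumR.⨁-ε L (λ {x} x∈ → ind-no (supp? 0 x) (λ S → out≢0 x∈ v refl (λ l → proj₂ S l z≤n))))
            (≈-sym (≈-trans (*-congˡ (K-colouring es acc (λ w → ρ w == v) (λ e∈ → cong (_== v) (ρ-acc e∈)) colour {v}
              (λ e → true≢false (trans e (trans (cong (_== v) (ρ-fix (ℕₚ.≤-reflexive v≡))) (==-refl v))) (low-colour (s≤s z≤n))))) (zeroʳ _)))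
          where
          low-colour : ∀ {i} → toℕ i < suc m → (ρ i == v) ≡ false
          low-colour {i} lt = trans (cong (_== v) (ρ-fix (ℕₚ.<⇒≤ lt))) (==-≢ (low⇒≢ lt))
          colour : ∀ {i l} → (i , l) ∈ es → ν 0 (i , l) ≡ 0 ⊎ (ρ i == v) ≡ (ρ l == v)
          colour {i} {l} e∈ with position i
          ... | mid refl = inj₁ (ν-mid 0 l)
          ... | high gt  = inj₁ (ν-high 0 l gt)
          ... | low lt   = inj₂ (trans (low-colour lt) (sym (low-colour (ℕₚ.<-trans (proj₁ (∈-edges⁻ G e∈)) lt))))
        inner (suc θ) le = byAdjacency (G v j) refl
          where
          j : V
          j = Fin.fromℕ< (ℕₚ.<-trans (subst (θ <_) (sym v≡) le) (Finₚ.toℕ<n v))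
          j≡ : toℕ j ≡ θ
          j≡ = Finₚ.toℕ-fromℕ< _
          j<v : toℕ j < toℕ v
          j<v = subst₂ _<_ (sym j≡) (sym v≡) le
          ≢θ : ∀ {l} → l ≢ j → toℕ l ≢ θ
          ≢θ ne e = ne (Finₚ.toℕ-injective (trans e (sym j≡)))
          beyond : ∀ {x} → Supp (suc θ) x → flow x v j ≡ 0 → Supp θ x
          beyond (S , z) zj = S , λ l le → case (l Finₚ.≟ j) of λ where
            (yes refl) → zj
            (no ne)    → z l (ℕₚ.≤∧≢⇒< le (≢θ ne ∘ sym))
          weaken : ∀ {x} → Supp θ x → Supp (suc θ) x
          weaken (S , z) = S , λ l le → z l (ℕₚ.<⇒≤ le)
          ν-off : ∀ {e} → e ≢ (v , j) → ν θ e ≡ ν (suc θ) e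
          ν-off {i , l} ne with position i
          ... | low lt   = trans (ν-low θ l lt) (sym (ν-low (suc θ) l lt))
          ... | high gt  = trans (ν-high θ l gt) (sym (ν-high (suc θ) l gt))
          ... | mid refl = trans (ν-mid θ l) (trans (cong (if_then supply v else 0) (sym (<ᵇ-suc-≢ (≢θ (ne ∘ cong (v ,_)))))) (sym (ν-mid (suc θ) l)))
          byAdjacency : ∀ b → G v j ≡ b → SumR.⨁ L (λ x → ind (supp? (suc θ) x) (wt x)) ≈ prefactor * K es (ν (suc θ)) acc
          byAdjacency false vj = begin
            SumR.⨁ L (λ x → ind (supp? (suc θ) x) (wt x))
              ≈⟨ SumR.⨁-cong L (λ {x} _ → ind-⇔ (supp? (suc θ) x) (supp? θ x)
                   (λ S → beyond S (flow-∉ x (λ e∈ → true≢false (proj₂ (∈-edges⁻ G e∈)) vj))) weaken) ⟩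
            SumR.⨁ L (λ x → ind (supp? θ x) (wt x))
              ≈⟨ inner θ (ℕₚ.<⇒≤ le) ⟩
            prefactor * K es (ν θ) acc
              ≈⟨ *-congˡ (K-cong es acc (λ e∈ → ν-off (λ eq → true≢false (proj₂ (∈-edges⁻ G (subst (_∈ es) eq e∈))) vj))) ⟩
            prefactor * K es (ν (suc θ)) acc ∎
          byAdjacency true vj = begin
            SumR.⨁ L (λ x → ind (supp? (suc θ) x) (wt x))
              -- Either `v` sends nothing to `j`, or everything. A flow that divides its output
              -- between `j` and another target has two positive out-edges at `v` and weight 0.
              ≈⟨ SumR.⨁-cong L (λ {x} x∈ → ind-split (supp? (suc θ) x) (supp? θ x) (supported? m target' x)
                   weaken (λ P → supported-weaken P , λ l l≥ → P v m<v l (λ e → ℕₚ.<⇒≢ l≥ (sym (trans (cong toℕ (trans e target'-v)) j≡))))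
                   (disjoint x∈) (otherwise x∈)) ⟩
            SumR.⨁ L (λ x → ind (supp? θ x) (wt x) + ind (supported? m target' x) (wt x))
              ≈⟨ SumR.⨁-∙ L (λ x → ind (supp? θ x) (wt x)) (λ x → ind (supported? m target' x) (wt x)) ⟩
            SumR.⨁ L (λ x → ind (supp? θ x) (wt x)) + SumR.⨁ L (λ x → ind (supported? m target' x) (wt x))
              ≈⟨ +-cong (inner θ (ℕₚ.<⇒≤ le)) (ih next) ⟩
            prefactor * K es (ν θ) acc + State.prefactor next * K es (μ m supply') ((v , j) ∷ acc)
              ≈⟨ +-congˡ (≈-trans (*-cong prefactor-next (≈-sym (Move.contract j j<v vj))) (*-assoc prefactor [ supply v ] (K es (ν (toℕ j)) ((v , j) ∷ acc)))) ⟩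
            prefactor * K es (ν θ) acc + prefactor * ([ supply v ] * K es (ν (toℕ j)) ((v , j) ∷ acc))
              ≈⟨ ≈-sym (distribˡ prefactor (K es (ν θ) acc) ([ supply v ] * K es (ν (toℕ j)) ((v , j) ∷ acc))) ⟩
            prefactor * (K es (ν θ) acc + [ supply v ] * K es (ν (toℕ j)) ((v , j) ∷ acc))
              ≈⟨ *-congˡ (+-congˡ (*-cong (reflexive (cong [_] (sym (trans (ν-mid (suc θ) j) (if-true (<ᵇ-true (s≤s (ℕₚ.≤-reflexive j≡)))))))) (reflexive (cong (λ t → K es (ν t) ((v , j) ∷ acc)) j≡)))) ⟩
            prefactor * (K es (ν θ) acc + [ ν (suc θ) (v , j) ] * K es (ν θ) ((v , j) ∷ acc))
              ≈⟨ *-congˡ (≈-sym (K-delete-contract acc (edges-unique G) (∈-edges⁺ G j<v vj)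
                   (trans (ν-mid θ j) (if-false (<ᵇ-false (ℕₚ.≤-reflexive (sym j≡))))) (λ _ → ν-off))) ⟩
            prefactor * K es (ν (suc θ)) acc ∎
            where
            open Step st v v≡ j j<v vj
            disjoint : ∀ {x} → x ∈ L → Supp θ x → Supported m target' x → ⊥
            disjoint x∈ (_ , z) P = out≢0 x∈ v refl (λ l → case (l Finₚ.≟ j) of λ where
              (yes refl) → z l (ℕₚ.≤-reflexive (sym j≡))
              (no ne)    → P v m<v l (λ e → ne (trans e target'-v)))
            otherwise : ∀ {x} → x ∈ L → Supp (suc θ) x → ¬ Supp θ x → ¬ Supported m target' x → wt x ≈ 0#
            otherwise {x} x∈ S ¬S ¬P with Finₚ.all? (λ l → (¬? (l Finₚ.≟ j)) →-dec (flow x v l ℕₚ.≟ 0))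
            ... | yes z = ⊥-elim (¬P λ i lt l ne → case (i Finₚ.≟ v) of λ where
                    (yes refl) → z l (λ e → ne (trans e (sym target'-v)))
                    (no i≢v)   → proj₁ S i (above lt i≢v) l (λ e → ne (trans e (sym (target'-≢ i≢v)))))
            ... | no ¬z with Finₚ.¬∀⟶∃¬ (suc n) (λ l → l ≢ j → flow x v l ≡ 0) (λ l → (¬? (l Finₚ.≟ j)) →-dec (flow x v l ℕₚ.≟ 0)) ¬z
            ...   | l , ¬imp = two-positive x∈ v refl {j} {l} (λ e → ¬imp (λ ne → ⊥-elim (ne (sym e))))
                      (ℕₚ.n≢0⇒n>0 (λ z → ¬S (beyond S z))) (ℕₚ.n≢0⇒n>0 (λ z → ¬imp (λ _ → z)))

    module Final (st : State 0) where
      open State st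

      X : V → V → ℕ
      X i j = if (0 <ᵇ toℕ i) ∧ (j == target i) then supply i else 0

      x₀ : Vec ℕ (nE G)
      x₀ = fromMatrix X

      X-target : ∀ k → X (suc k) (target (suc k)) ≡ supply (suc k)
      X-target k = if-true (==-refl (target (suc k)))

      X-≢ : ∀ i {j} → j ≢ target i → X i j ≡ 0
      X-≢ i ne = if-false (trans (cong ((0 <ᵇ toℕ i) ∧_) (==-≢ ne)) (Boolₚ.∧-zeroʳ _))

      flow-x₀ : ∀ i j → flow x₀ i j ≡ X i j
      flow-x₀ = flow-fromMatrix X off
        where
        off : ∀ {i j} → (i , j) ∉ es → X i j ≡ 0
        off {zero}      e∉ = refl
        off {suc k} {j} e∉ = X-≢ (suc k) (λ { refl → e∉ (target-edge (suc k) (s≤s z≤n)) })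

      isFlow-x₀ : IsIntFlow G a x₀
      isFlow-x₀ = isIntFlow-intro a x₀ λ k →
        trans (Sumℕ.⨁-cong vs (λ {j} _ → flow-x₀ (suc k) j))
        (trans (Sumℕ.⨁-allFin-single (target (suc k)) (λ j → X-≢ (suc k)))
        (trans (X-target k) (trans (supply-eq (suc k)) (cong (a k ℕ.+_) (Sumℕ.⨁-cong vs (λ {i} _ →
          trans (cong (λ b → if (0 <ᵇ toℕ i) ∧ b then supply i else 0) (==-sym (target i) (suc k))) (sym (flow-x₀ i (suc k)))))))))
        where
        ==-sym : ∀ (u w : V) → (u == w) ≡ (w == u)
        ==-sym u w = case (u Finₚ.≟ w) of λ where
          (yes refl) → refl
          (no ne)    → trans (==-≢ ne) (sym (==-≢ (ne ∘ sym)))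

      unique-x₀ : ∀ {x} → x ∈ L → Supported 0 target x → x ≡ x₀
      unique-x₀ {x} x∈ P = flow-injective λ i j → trans (value i j) (sym (flow-x₀ i j))
        where
        value : ∀ i j → flow x i j ≡ X i j
        value zero    j = flow-∉ x (λ e∈ → case proj₁ (∈-edges⁻ G e∈) of λ ())
        value (suc k) j = case (j Finₚ.≟ target (suc k)) of λ where
          (yes refl) → trans (forced x∈ P (suc k) (s≤s z≤n)) (sym (X-target k))
          (no ne)    → trans (P (suc k) (s≤s z≤n) j ne) (sym (X-≢ (suc k) ne))

      supply≥1 : ∀ k → 1 ≤ supply (suc k)
      supply≥1 k = ℕₚ.≤-trans (a≥1 k) (ℕₚ.≤-trans (ℕₚ.m≤m+n (a k) _) (ℕₚ.≤-reflexive (sym (supply-eq (suc k)))))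

      numPositive-x₀ : numPositive x₀ ≡ n
      numPositive-x₀ = trans (numPositive-Σ x₀) (trans (Sumℕ.⨁-allFin-suc n (λ i → Σℕ vs (λ j → 𝟙 (0 <ᵇ flow x₀ i j))))
        (trans (cong₂ ℕ._+_ (Sumℕ.⨁-ε vs (λ {j} _ → cong (λ b → 𝟙 (0 <ᵇ b)) (flow-x₀ zero j)))
          (Sumℕ.⨁-cong (allFin n) (λ {k} _ → trans (Sumℕ.⨁-allFin-single (target (suc k)) (λ j ne → cong (λ b → 𝟙 (0 <ᵇ b)) (trans (flow-x₀ (suc k) j) (X-≢ (suc k) ne))))
              (trans (cong (λ b → 𝟙 (0 <ᵇ b)) (trans (flow-x₀ (suc k) (target (suc k))) (X-target k))) (cong 𝟙 (<ᵇ-true (supply≥1 k)))))))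
        (trans (Σℕ-const (allFin n) 1) (trans (ℕₚ.*-identityʳ _) (length-allFin n)))))

      wt-x₀ : wt x₀ ≈ prefactor
      wt-x₀ = begin
          z ^ (numPositive x₀ ∸ n) * ProdR.⨁ (Vec.toList x₀) (wtQT R q 1#)
            ≈⟨ *-cong (reflexive (cong (z ^_) (trans (cong (_∸ n) numPositive-x₀) (ℕₚ.n∸n≡0 n))))
                      (⨁-flow *-commutativeMonoid (wtQT R q 1#) ≈-refl x₀) ⟩
          1# * ProdR.⨁ vs (λ i → ProdR.⨁ vs (λ j → wtQT R q 1# (flow x₀ i j)))
            ≈⟨ *-identityˡ (ProdR.⨁ vs (λ i → ProdR.⨁ vs (λ j → wtQT R q 1# (flow x₀ i j)))) ⟩
          ProdR.⨁ vs (λ i → ProdR.⨁ vs (λ j → wtQT R q 1# (flow x₀ i j)))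
            ≈⟨ ProdR.⨁-cong vs (λ {i} _ → rowProd i) ⟩
          prefactor ∎
        where
        z : Carrier
        z = - ((1# - 1#) * (1# - q))
        rowProd : ∀ i → ProdR.⨁ vs (λ j → wtQT R q 1# (flow x₀ i j)) ≈ (if 0 <ᵇ toℕ i then [ supply i ] else 1#)
        rowProd zero    = ProdR.⨁-ε vs (λ {j} _ → reflexive (cong (wtQT R q 1#) (flow-x₀ zero j)))
        rowProd (suc k) = ≈-trans (ProdR.⨁-allFin-single (target (suc k)) (λ j ne → reflexive (cong (wtQT R q 1#) (trans (flow-x₀ (suc k) j) (X-≢ (suc k) ne)))))
          (≈-trans (reflexive (cong (wtQT R q 1#) (trans (flow-x₀ (suc k) (target (suc k))) (X-target k)))) (wtQT-[] (supply≥1 k)))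

      -- The only flow left sends the accumulated supply of each vertex to its target and has weight
      -- `prefactor`. No edge is live, and `acc` connects all vertices with n edges, so its `base`
      -- is 1.
      claim₀ : Claim st
      claim₀ = begin
          SumR.⨁ L (λ x → ind (supported? 0 target x) (wt x))
            ≈⟨ SumR.⨁-single {f = λ x → ind (supported? 0 target x) (wt x)} uL (Equivalence.from (mem x₀) isFlow-x₀) (λ {x} x∈ ne → ind-no (supported? 0 target x) (λ P → ne (unique-x₀ x∈ P))) ⟩
          ind (supported? 0 target x₀) (wt x₀)
            ≈⟨ ind-yes (supported? 0 target x₀) (λ i _ j ne → trans (flow-x₀ i j) (X-≢ i ne)) ⟩
          wt x₀
            ≈⟨ ≈-trans wt-x₀ (≈-sym (*-identityʳ prefactor)) ⟩
          prefactor * 1#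
            ≈⟨ *-congˡ (≈-sym (≈-trans (K-empty es {μ 0 supply} {acc} (λ {e} → none e)) (base-tree {A = acc} toRoot length-acc))) ⟩
          prefactor * K es (μ 0 supply) acc ∎
        where
        none : ∀ e → e ∈ es → μ 0 supply e ≡ 0
        none (i , j) e∈ = if-false (<ᵇ-false (ℕₚ.≤-trans (s≤s z≤n) (proj₁ (∈-edges⁻ G e∈))))
        toRoot : ∀ w → Conn acc zero w
        toRoot w = csym (subst (Conn acc w) (Finₚ.toℕ-injective (ℕₚ.n≤0⇒n≡0 (ρ-≤ w))) (ρ-conn w))

    claim : ∀ m (st : State m) → Claim st
    claim zero    st = Final.claim₀ st
    claim (suc m) st = begin
        SumR.⨁ L (λ x → ind (supported? (suc m) target x) (wt x))
          ≈⟨ SumR.⨁-cong L (λ {x} _ → ind-⇔ (supported? (suc m) target x) (supp? (suc m) x)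
               (λ S → S , λ j le → flow-∉ x (λ e∈ → ℕₚ.<⇒≱ (subst (toℕ j <_) v≡ (proj₁ (∈-edges⁻ G e∈))) le)) proj₁) ⟩
        SumR.⨁ L (λ x → ind (supp? (suc m) x) (wt x))
          ≈⟨ inner (claim m) (suc m) ℕₚ.≤-refl ⟩
        prefactor * K es (ν (suc m)) acc
          ≈⟨ *-congˡ (K-cong es acc (λ {e} → agree e)) ⟩
        prefactor * K es (μ (suc m) supply) acc ∎
      where
      open State st
      m<n : suc m < suc n
      m<n = s≤s (ℕₚ.m+n≤o⇒m≤o (suc m) (ℕₚ.≤-reflexive length-acc))
      v : V
      v = Fin.fromℕ< m<n
      v≡ : toℕ v ≡ suc m
      v≡ = Finₚ.toℕ-fromℕ< m<n
      open Inner st v v≡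
      agree : ∀ e → e ∈ es → ν (suc m) e ≡ μ (suc m) supply e
      agree (i , j) e∈ with position i
      ... | low lt   = trans (ν-low (suc m) j lt) (sym (if-true (<ᵇ-true (ℕₚ.m<n⇒m<1+n lt))))
      ... | high gt  = trans (ν-high (suc m) j gt) (sym (if-false (<ᵇ-false gt)))
      ... | mid refl = trans (ν-mid (suc m) j) (trans (if-true (<ᵇ-true (subst (toℕ j <_) v≡ (proj₁ (∈-edges⁻ G e∈)))))
                                          (sym (if-true (<ᵇ-true (s≤s (ℕₚ.≤-reflexive v≡))))))

    Ehr-K : EhrOver R q 1# G L ≈ K es (aAt a ∘ proj₁) []
    Ehr-K = begin
        SumR.⨁ L wt
          ≈⟨ SumR.⨁-cong L (λ {x} _ → ≈-sym (ind-yes (supported? n (State.target start) x) (λ i lt → ⊥-elim (¬beyond i lt)))) ⟩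
        SumR.⨁ L (λ x → ind (supported? n (State.target start) x) (wt x))
          ≈⟨ claim n start ⟩
        State.prefactor start * K es (μ n (aAt a)) []
          ≈⟨ *-cong (ProdR.⨁-ε vs (λ {i} _ → reflexive (if-false (<ᵇ-false (ℕₚ.≮⇒≥ (¬beyond i))))))
                    (K-cong es [] (λ {e} _ → if-true (<ᵇ-true (Finₚ.toℕ<n (proj₁ e))))) ⟩
        1# * K es (aAt a ∘ proj₁) []
          ≈⟨ *-identityˡ (K es (aAt a ∘ proj₁) []) ⟩
        K es (aAt a ∘ proj₁) [] ∎
      where
      ¬beyond : ∀ (i : V) → ¬ (n < toℕ i)
      ¬beyond i lt = ℕₚ.<⇒≱ (Finₚ.toℕ<n i) lt
      start : State n
      start = record
        { target = λ _ → zero ; supply = aAt a ; acc = [] ; ρ = id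
        ; target-edge = λ i lt → ⊥-elim (¬beyond i lt)
        ; supply-eq = λ k → sym (trans (cong (aAt a k ℕ.+_) (Sumℕ.⨁-ε vs (λ {i} _ →
            if-false (cong (_∧ (zero == k)) (<ᵇ-false (ℕₚ.≮⇒≥ (¬beyond i))))))) (ℕₚ.+-identityʳ _))
        ; forced = λ _ _ i lt → ⊥-elim (¬beyond i lt)
        ; length-acc = ℕₚ.+-identityʳ n
        ; ρ-acc = λ ()
        ; ρ-fix = λ _ → refl
        ; ρ-≤ = λ w → ℕₚ.≤-pred (Finₚ.toℕ<n w)
        ; ρ-conn = λ _ → crefl
        }

-- Unordered pairs as edges with the larger end first, and iteration of maps

edgeOf : ∀ {n} → Fin (suc n) → Fin (suc n) → Edge n
edgeOf u w = if toℕ u <ᵇ toℕ w then (w , u) else (u , w)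

module _ {n : ℕ} where
  edgeOf-< : ∀ {u w : Fin (suc n)} → toℕ u < toℕ w → edgeOf u w ≡ (w , u)
  edgeOf-< lt = if-true (<ᵇ-true lt)

  edgeOf-> : ∀ {u w : Fin (suc n)} → toℕ w < toℕ u → edgeOf u w ≡ (u , w)
  edgeOf-> gt = if-false (<ᵇ-false (ℕₚ.<⇒≤ gt))

  data Ordered (u w : Fin (suc n)) : Set where
    isLt : toℕ u < toℕ w → Ordered u w
    isGt : toℕ w < toℕ u → Ordered u w

  ordered : ∀ {u w} → u ≢ w → Ordered u w
  ordered {u} {w} ne with ℕₚ.<-cmp (toℕ u) (toℕ w)
  ... | tri< l _ _ = isLt l
  ... | tri≈ _ e _ = ⊥-elim (ne (Finₚ.toℕ-injective e))
  ... | tri> _ _ g = isGt g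

  edgeOf-max : ∀ u w → proj₁ (edgeOf {n} u w) ≡ maxV u w
  edgeOf-max u w with toℕ u <ᵇ toℕ w
  ... | true  = refl
  ... | false = refl

  maxV-comm : ∀ (u w : Fin (suc n)) → maxV u w ≡ maxV w u
  maxV-comm u w with u Finₚ.≟ w
  ... | yes refl = refl
  ... | no ne with ordered ne
  ...   | isLt l = trans (maxV-< l) (sym (maxV-≥ (ℕₚ.<⇒≤ l)))
  ...   | isGt g = trans (maxV-≥ (ℕₚ.<⇒≤ g)) (sym (maxV-< g))

  edgeOf-injective : ∀ {u w c : Fin (suc n)} → u ≢ c → w ≢ c → edgeOf u c ≡ edgeOf w c → u ≡ w
  edgeOf-injective u≢c w≢c e with ordered u≢c | ordered w≢c
  ... | isLt l | isLt l' = cong proj₂ (trans (sym (edgeOf-< l)) (trans e (edgeOf-< l')))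
  ... | isGt g | isGt g' = cong proj₁ (trans (sym (edgeOf-> g)) (trans e (edgeOf-> g')))
  ... | isLt l | isGt g' = ⊥-elim (w≢c (sym (cong proj₁ (trans (sym (edgeOf-< l)) (trans e (edgeOf-> g'))))))
  ... | isGt g | isLt l' = ⊥-elim (u≢c (cong proj₁ (trans (sym (edgeOf-> g)) (trans e (edgeOf-< l')))))

  edgeOf-Conn : ∀ {A : List (Edge n)} {u w} → Conn A u w → Conn A (proj₁ (edgeOf u w)) (proj₂ (edgeOf u w))
  edgeOf-Conn {u = u} {w} c with toℕ u <ᵇ toℕ w
  ... | true  = csym c
  ... | false = c

  Conn-edgeOf : ∀ {A : List (Edge n)} u w → Conn (edgeOf u w ∷ A) u w
  Conn-edgeOf u w with toℕ u <ᵇ toℕ w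
  ... | true  = csym (cedge (here refl))
  ... | false = cedge (here refl)

iterate-shift : ∀ {A : Set} (f : A → A) k x → iterate f k (f x) ≡ iterate f (suc k) x
iterate-shift f zero    x = refl
iterate-shift f (suc k) x = cong f (iterate-shift f k x)

iterate-invariant : ∀ {A : Set} (P : A → Set) {f : A → A} → (∀ {x} → P x → P (f x)) → ∀ k {x} → P x → P (iterate f k x)
iterate-invariant P h zero    p = p
iterate-invariant P h (suc k) p = h (iterate-invariant P h k p)

iterate-cong : ∀ {A : Set} {f g : A → A} → (∀ x → f x ≡ g x) → ∀ k x → iterate f k x ≡ iterate g k x
iterate-cong h zero    x = refl
iterate-cong {g = g} h (suc k) x = trans (h _) (cong g (iterate-cong h k x))

iterate-+ : ∀ {A : Set} (f : A → A) j k x → iterate f (j ℕ.+ k) x ≡ iterate f j (iterate f k x)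
iterate-+ f zero    k x = refl
iterate-+ f (suc j) k x = cong f (iterate-+ f j k x)

decIf : {P : Set} → Dec P → ℕ → ℕ
decIf d k = if does d then k else 0

module _ {P : Set} {k : ℕ} where
  decIf-yes : (d : Dec P) → P → decIf d k ≡ k
  decIf-yes (yes _) p = refl
  decIf-yes (no ¬p) p = ⊥-elim (¬p p)

  decIf-no : (d : Dec P) → ¬ P → decIf d k ≡ 0
  decIf-no (yes p) ¬p = ⊥-elim (¬p p)
  decIf-no (no _)  ¬p = refl

  decIf-⇔ : ∀ {Q : Set} (d : Dec P) (e : Dec Q) → (P → Q) → (Q → P) → decIf d k ≡ decIf e k
  decIf-⇔ (yes p) (yes _) f g = refl
  decIf-⇔ (yes p) (no ¬q) f g = ⊥-elim (¬q (f p))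
  decIf-⇔ (no ¬p) (yes q) f g = ⊥-elim (¬p (g q))
  decIf-⇔ (no _)  (no _)  f g = refl

-- Spanning trees: the inversion sum obeys the recursion of K

module Trees {ℓ₁ ℓ₂ : Level} (R : CommutativeRing ℓ₁ ℓ₂) (q : CommutativeRing.Carrier R)
             {n : ℕ} (G : Graph n) (sh : IsShifted G) (a : Fin n → ℕ) where
  open WeightedSubgraphs R q
  open Indicator R
  open IsShifted sh
  open import Relation.Binary.Reasoning.Setoid setoid using (begin_; step-≈-⟩; _∎)
  open import Data.List.Membership.DecPropositional (Finₚ._≟_ {suc n}) using (_∈?_)

  private
    V  = Fin (suc n)
    vs = allFin (suc n)
    es = edges G

  par : Vec V n → V → V
  par = parentOf R

  trees : List (Vec V n)
  trees = spanningTrees R G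

  tw : Vec V n → Carrier
  tw = treeWeight R q a

  α : V → V → ℕ
  α u w = aAt a (maxV u w)

  α-comm : ∀ u w → α u w ≡ α w u
  α-comm u w = cong (aAt a) (maxV-comm u w)

  module _ {p : Vec V n} where
    isTree : p ∈ trees → isSpanningTreeᵇ R G p ≡ true
    isTree p∈ = Equivalence.to T-≡ (proj₂ (∈-filter⁻ (Boolₚ.T? ∘ isSpanningTreeᵇ R G) {xs = allVecs (allFin (suc n)) n} p∈))

    tree-adjacent : isSpanningTreeᵇ R G p ≡ true → ∀ k → G (suc k) (par p (suc k)) ≡ true
    tree-adjacent t k = allᵇ-elim {p = λ k → G (suc k) (par p (suc k))} {xs = allFin n} (proj₁ (∧-true t)) (∈-allFin k)

    tree-root : isSpanningTreeᵇ R G p ≡ true → ∀ v → iterate (par p) n v ≡ zero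
    tree-root t v = ==-sound (allᵇ-elim {p = λ v → iterate (par p) n v == zero} {xs = vs}
      (proj₂ (∧-true {allᵇ (λ k → G (suc k) (par p (suc k))) (allFin n)} t)) (∈-allFin v))

    tree-intro : (∀ k → G (suc k) (par p (suc k)) ≡ true) → (∀ v → iterate (par p) n v ≡ zero) → isSpanningTreeᵇ R G p ≡ true
    tree-intro adj root = cong₂ _∧_ (allᵇ-intro (allFin n) (λ {k} _ → adj k))
      (allᵇ-intro vs (λ {v} _ → trans (cong (_== zero) (root v)) (==-refl {suc n} zero)))

  edgeFactor : Vec V n → V → Carrier
  edgeFactor p zero    = 1#
  edgeFactor p (suc k) = [ α (suc k) (par p (suc k)) ]

  invFactor : Vec V n → V → V → Carrier
  invFactor p j i = if isInversionᵇ R p (i , j) then q ^ α (par p i) j else 1#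

  -- Collects what is determined when `j` is visited: the edge to its parent and the inversions with
  -- `j` as the smaller end. Their larger ends are ancestors of `j`, visited before it, and so are
  -- the parents of these.
  weight : Vec V n → V → Carrier
  weight p j = edgeFactor p j * ProdR.⨁ vs (invFactor p j)

  tw-weight : ∀ p → tw p ≈ ProdR.⨁ vs (weight p)
  tw-weight p = begin
    tw p
      ≈⟨ *-cong (≈-sym (≈-trans (ProdR.⨁-allFin-suc n (edgeFactor p)) (*-identityˡ _))) inversions ⟩
    ProdR.⨁ vs (edgeFactor p) * ProdR.⨁ vs (λ j → ProdR.⨁ vs (invFactor p j))
      ≈⟨ ≈-sym (ProdR.⨁-∙ vs (edgeFactor p) (λ j → ProdR.⨁ vs (invFactor p j))) ⟩
    ProdR.⨁ vs (weight p) ∎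
    where
    f : V × V → Carrier
    f ij = q ^ aAt a (maxV (par p (proj₁ ij)) (proj₂ ij))
    g : V × V → Carrier
    g ij = if isInversionᵇ R p ij then f ij else 1#
    inversions : Πᴿ R (filterᵇ (isInversionᵇ R p) (allPairs R n)) f ≈ ProdR.⨁ vs (λ j → ProdR.⨁ vs (invFactor p j))
    inversions = begin
      ProdR.⨁ (filterᵇ (isInversionᵇ R p) (allPairs R n)) f  ≈⟨ ProdR.⨁-filterᵇ (isInversionᵇ R p) (allPairs R n) f ⟩
      ProdR.⨁ (allPairs R n) g                              ≈⟨ ProdR.⨁-concatMap (λ i → List.map (i ,_) vs) vs g ⟩
      ProdR.⨁ vs (λ i → ProdR.⨁ (List.map (i ,_) vs) g)      ≈⟨ ProdR.⨁-cong vs (λ {i} _ → ProdR.⨁-map (i ,_) vs g) ⟩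
      ProdR.⨁ vs (λ i → ProdR.⨁ vs (λ j → g (i , j)))        ≈⟨ ProdR.⨁-comm vs vs (λ i j → g (i , j)) ⟩
      ProdR.⨁ vs (λ j → ProdR.⨁ vs (invFactor p j))          ∎

  -- The stack elements below which u may still be hung: the top t accepts u < θ, and a lower
  -- element accepts only vertices smaller than the child through which the search has left it.
  accepting : List V → ℕ → V → List V
  accepting []       θ u = []
  accepting (t ∷ st) θ u = if toℕ u <ᵇ θ then t ∷ accepting st (toℕ t) u else accepting st (toℕ t) u

  accepting-< : ∀ t st {θ u} → toℕ u < θ → accepting (t ∷ st) θ u ≡ t ∷ accepting st (toℕ t) u
  accepting-< t st l = if-true (<ᵇ-true l)

  accepting-≥ : ∀ t st {θ u} → θ ≤ toℕ u → accepting (t ∷ st) θ u ≡ accepting st (toℕ t) u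
  accepting-≥ t st l = if-false (<ᵇ-false l)

  accepting-⊆ : ∀ st θ u {w} → w ∈ accepting st θ u → w ∈ st
  accepting-⊆ (t ∷ st) θ u w∈ with toℕ u <ᵇ θ
  accepting-⊆ (t ∷ st) θ u (here e)   | true  = here e
  accepting-⊆ (t ∷ st) θ u (there w∈) | true  = there (accepting-⊆ st (toℕ t) u w∈)
  accepting-⊆ (t ∷ st) θ u w∈         | false = there (accepting-⊆ st (toℕ t) u w∈)

  accepting-unique : ∀ st θ u → Unique st → Unique (accepting st θ u)
  accepting-unique []       θ u _ = []
  accepting-unique (t ∷ st) θ u (t∉ ∷ un) with toℕ u <ᵇ θ
  ... | true  = All.tabulate (λ w∈ → All.lookup t∉ (accepting-⊆ st (toℕ t) u w∈)) ∷ accepting-unique st (toℕ t) u un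
  ... | false = accepting-unique st (toℕ t) u un

  -- The stack is the tree path from its top to 0; `nil` is the situation after the root has been
  -- popped.
  data Chain (π : V → V) : List V → Set where
    nil  : Chain π []
    root : Chain π (zero ∷ [])
    link : ∀ {t t' st} → t ≢ zero → π t ≡ t' → Chain π (t' ∷ st) → Chain π (t ∷ t' ∷ st)

  chain-tail : ∀ {π t st} → Chain π (t ∷ st) → Chain π st
  chain-tail root         = nil
  chain-tail (link _ _ c) = c

  chain-closed : ∀ {π st x} → π zero ≡ zero → Chain π st → x ∈ st → π x ∈ st
  chain-closed π0 root         (here refl) = here π0
  chain-closed π0 (link _ e c) (here refl) = there (here e)
  chain-closed π0 (link _ e c) (there x∈)  = there (chain-closed π0 c x∈)

  chain-reaches : ∀ {π t st i} → Chain π (t ∷ st) → i ∈ t ∷ st → ∃ λ k → iterate π k t ≡ i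
  chain-reaches c            (here refl) = 0 , refl
  chain-reaches root         (there ())
  chain-reaches {π} {t} (link _ refl c) (there i∈) = let (k , e) = chain-reaches c i∈ in suc k , trans (sym (iterate-shift π k t)) e

  chain-cong : ∀ {π π' st} → (∀ {x} → x ∈ st → π x ≡ π' x) → Chain π st → Chain π' st
  chain-cong h nil            = nil
  chain-cong h root           = root
  chain-cong h (link ne e c)  = link ne (trans (sym (h (here refl))) e) (chain-cong (h ∘ there) c)

  -- For an ancestor i of j, the factor of the inversion (i , j) is attached to the parent of i.
  chain-inversions : ∀ {π t st} j → Chain π (t ∷ st) →
    ProdR.⨁ (t ∷ st) (λ i → if not (i == zero) ∧ (toℕ j <ᵇ toℕ i) then q ^ α (π i) j else 1#)
    ≈ ProdR.⨁ (accepting st (toℕ t) j) (λ w → q ^ α w j)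
  chain-inversions j root = *-identityˡ _
  chain-inversions {π} {t} {t' ∷ st} j (link ne refl c) rewrite ==-≢ ne with toℕ j <ᵇ toℕ t
  ... | true  = *-congˡ (chain-inversions j c)
  ... | false = ≈-trans (*-identityˡ _) (chain-inversions j c)

  -- A stack element `π t` accepts `c` only if c < t, so the tree edge between `t` and `π t` shifts
  -- down to one between `c` and `π t`; the two are distinct because `c` is not on the stack.
  chain-adjacent : ∀ {π t st c w} → (∀ {x} → x ∈ t ∷ st → x ≢ zero → G x (π x) ≡ true) → c ∉ t ∷ st → Chain π (t ∷ st) →
                   w ∈ accepting st (toℕ t) c → G w c ≡ true
  chain-adjacent adj c∉ root ()
  chain-adjacent {π} {t} {t' ∷ st} {c} adj c∉ (link ne refl ch) w∈ with toℕ c <ᵇ toℕ t in eq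
  chain-adjacent {π} {t} {t' ∷ st} {c} adj c∉ (link ne refl ch) (here refl) | true =
    trans (symmetric (π t) c) (shifted (<ᵇ-sound {toℕ c} eq) (λ e → c∉ (there (here (sym e)))) (adj (here refl) ne))
  ... | false = chain-adjacent (adj ∘ there) (c∉ ∘ there) ch w∈
  chain-adjacent {π} {t} {t' ∷ st} {c} adj c∉ (link ne refl ch) (there w∈) | true =
    chain-adjacent (adj ∘ there) (c∉ ∘ there) ch w∈

  edgeOf-∈ : ∀ {u w} → G u w ≡ true → edgeOf u w ∈ es
  edgeOf-∈ {u} {w} h with ordered (adjacent⇒≢ h)
  ... | isLt l = subst (_∈ es) (sym (edgeOf-< l)) (∈-edges⁺ G l (trans (symmetric w u) h))
  ... | isGt g = subst (_∈ es) (sym (edgeOf-> g)) (∈-edges⁺ G g h)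

  K-remove-loops : ∀ ws {μ ν} (A : List (Edge n)) c → Unique ws → (∀ {w} → w ∈ ws → G w c ≡ true) → (∀ {w} → w ∈ ws → Conn A w c) →
                   (∀ {w} → w ∈ ws → ν (edgeOf w c) ≡ 0) →
                   (∀ {e} → e ∈ es → (∀ {w} → w ∈ ws → e ≢ edgeOf w c) → ν e ≡ μ e) →
                   K es μ A ≈ ProdR.⨁ ws (λ w → q ^ μ (edgeOf w c)) * K es ν A
  K-remove-loops [] {μ} {ν} A c _ _ _ _ same = ≈-trans (K-cong es A (λ e∈ → sym (same e∈ (λ ())))) (≈-sym (*-identityˡ (K es ν A)))
  K-remove-loops (w ∷ ws) {μ} {ν} A c (w∉ ∷ un) adj con νz same = begin
      K es μ A
        ≈⟨ K-remove-loop A (edges-unique G) (edgeOf-∈ (adj (here refl))) (edgeOf-Conn (con (here refl))) (zeroAt-≡ e μ) (λ _ → zeroAt-≢ μ) ⟩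
      q ^ μ e * K es μ₁ A
        ≈⟨ *-congˡ (K-remove-loops ws A c un (adj ∘ there) (con ∘ there) (νz ∘ there) same') ⟩
      q ^ μ e * (ProdR.⨁ ws (λ w → q ^ μ₁ (edgeOf w c)) * K es ν A)
        ≈⟨ *-congˡ (*-congʳ (ProdR.⨁-cong ws (λ {w'} w'∈ → reflexive (cong (q ^_) (zeroAt-≢ μ (λ eq → All.lookup w∉ w'∈
             (sym (edgeOf-injective (adjacent⇒≢ (adj (there w'∈))) (adjacent⇒≢ (adj (here refl))) eq)))))))) ⟩
      q ^ μ e * (ProdR.⨁ ws (λ w → q ^ μ (edgeOf w c)) * K es ν A)
        ≈⟨ ≈-sym (*-assoc (q ^ μ e) (ProdR.⨁ ws (λ w → q ^ μ (edgeOf w c))) (K es ν A)) ⟩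
      ProdR.⨁ (w ∷ ws) (λ w → q ^ μ (edgeOf w c)) * K es ν A ∎
    where
    e : Edge n
    e = edgeOf w c
    μ₁ : Edge n → ℕ
    μ₁ = zeroAt e μ
    same' : ∀ {f} → f ∈ es → (∀ {w} → w ∈ ws → f ≢ edgeOf w c) → ν f ≡ μ₁ f
    same' {f} f∈ off = case (f ≟ₑ e) of λ where
      (yes refl) → trans (νz (here refl)) (sym (zeroAt-≡ e μ))
      (no ne)    → trans (same f∈ (λ { (here refl) → ne ; (there w∈) → off w∈ })) (sym (zeroAt-≢ μ ne))

  -- A configuration of the depth-first search that always tries the largest candidate first:
  -- the visited vertices vis with their parents π, and the stack st of active vertices.
  record State (r : ℕ) (st : List V) : Set (ℓ₁ ⊔ ℓ₂) where
    field
      vis : V → Bool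
      π   : V → V
      acc : List (Edge n)
      d   : ℕ
      C   : Carrier

    Agrees : Vec V n → Set
    Agrees p = ∀ v → vis v ≡ true → par p v ≡ π v

    field
      d+r        : d ℕ.+ r ≡ n
      unvisited  : Σℕ vs (λ v → 𝟙 (not (vis v))) ≡ r
      vis-zero   : vis zero ≡ true
      π-zero     : π zero ≡ zero
      π-vis      : ∀ {v} → vis v ≡ true → vis (π v) ≡ true
      π-depth    : ∀ {v} → vis v ≡ true → iterate π d v ≡ zero
      π-adjacent : ∀ {v} → vis v ≡ true → v ≢ zero → G v (π v) ≡ true
      st-vis     : ∀ {s} → s ∈ st → vis s ≡ true
      st-unique  : Unique st
      st-chain   : Chain π st
      acc-vis    : ∀ {u v} → (u , v) ∈ acc → (vis u ≡ true) × (vis v ≡ true)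
      acc-conn   : ∀ {v} → vis v ≡ true → Conn acc zero v
      acc-length : length acc ≡ d
      -- The same `C` serves every tree that extends the configuration, since the ancestors of a
      -- visited vertex are visited.
      C-weight   : ∀ {p} → p ∈ trees → Agrees p → C ≈ ProdR.⨁ vs (λ v → if vis v then weight p v else 1#)

    -- `s` may still become the parent of `u`: it has not been visited itself, or it is active and
    -- has not yet come down to the candidate `u`.
    Ok : ℕ → V → V → Set
    Ok θ s u = (vis s ≡ false) ⊎ (s ∈ accepting st θ u)

    ok? : ∀ θ s u → Dec (Ok θ s u)
    ok? θ s u = (vis s Boolₚ.≟ false) ⊎-dec (s ∈? accepting st θ u)

    Attach : ℕ → V → V → Set
    Attach θ s u = (vis u ≡ false) × Ok θ s u

    Alive : ℕ → V → V → Set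
    Alive θ i j = Attach θ i j ⊎ Attach θ j i

    alive? : ∀ θ i j → Dec (Alive θ i j)
    alive? θ i j = ((vis j Boolₚ.≟ false) ×-dec ok? θ i j) ⊎-dec ((vis i Boolₚ.≟ false) ×-dec ok? θ j i)

    μ : ℕ → Edge n → ℕ
    μ θ e = decIf (alive? θ (proj₁ e) (proj₂ e)) (aAt a (proj₁ e))

    Consistent : ℕ → Vec V n → Set
    Consistent θ p = Agrees p × (∀ u → vis u ≡ false → Ok θ (par p u) u)

    consistent? : ∀ θ p → Dec (Consistent θ p)
    consistent? θ p = Finₚ.all? (λ v → (vis v Boolₚ.≟ true) →-dec (par p v Finₚ.≟ π v))
                      ×-dec Finₚ.all? (λ u → (vis u Boolₚ.≟ false) →-dec ok? θ (par p u) u)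

    Claim : ℕ → Set ℓ₂
    Claim θ = SumR.⨁ trees (λ p → ind (consistent? θ p) (tw p)) ≈ C * K es (μ θ) acc

  module Complete (σ : State 0 []) where
    open State σ

    all-visited : ∀ v → vis v ≡ true
    all-visited v with vis v in eq
    ... | true  = refl
    ... | false = ⊥-elim (ℕₚ.1+n≢0 (trans (cong (𝟙 ∘ not) (sym eq)) (Σℕ-zero (λ v → 𝟙 (not (vis v))) unvisited (∈-allFin v))))

    p₀ : Vec V n
    p₀ = Vec.tabulate (π ∘ suc)

    par-p₀ : ∀ v → par p₀ v ≡ π v
    par-p₀ zero    = sym π-zero
    par-p₀ (suc k) = Vecₚ.lookup∘tabulate (π ∘ suc) k

    tree-p₀ : isSpanningTreeᵇ R G p₀ ≡ true
    tree-p₀ = tree-intro {p = p₀} (λ k → trans (cong (G (suc k)) (par-p₀ (suc k))) (π-adjacent (all-visited (suc k)) (λ ())))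
      (λ v → trans (iterate-cong par-p₀ n v) (trans (cong (λ k → iterate π k v) (trans (sym d+r) (ℕₚ.+-identityʳ d))) (π-depth (all-visited v))))

    unique-p₀ : ∀ {p} → Agrees p → p ≡ p₀
    unique-p₀ {p} agr = trans (sym (Vecₚ.tabulate∘lookup p)) (Vecₚ.tabulate-cong (λ k → agr (suc k) (all-visited (suc k))))

    -- With every vertex visited, `p₀` is the only consistent tree and `C` is its weight; no edge is
    -- alive, and `acc` is a spanning tree of `base` 1.
    claim : ∀ θ → Claim θ
    claim θ = begin
      SumR.⨁ trees (λ p → ind (consistent? θ p) (tw p))
        ≈⟨ SumR.⨁-filterᵇ (isSpanningTreeᵇ R G) (allVecs vs n) (λ p → ind (consistent? θ p) (tw p)) ⟩
      SumR.⨁ (allVecs vs n) term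
        ≈⟨ SumR.⨁-allVecs-single n p₀ {term} other ⟩
      term p₀
        ≈⟨ reflexive (if-true tree-p₀) ⟩
      ind (consistent? θ p₀) (tw p₀)
        ≈⟨ ind-yes (consistent? θ p₀) ((λ v _ → par-p₀ v) , (λ u f → ⊥-elim (true≢false (all-visited u) f))) ⟩
      tw p₀
        ≈⟨ tw-weight p₀ ⟩
      ProdR.⨁ vs (weight p₀)
        ≈⟨ ProdR.⨁-cong vs (λ {v} _ → reflexive (sym (if-true (all-visited v)))) ⟩
      ProdR.⨁ vs (λ v → if vis v then weight p₀ v else 1#)
        ≈⟨ ≈-sym (C-weight (∈-filter⁺ (Boolₚ.T? ∘ isSpanningTreeᵇ R G) (∈-allVecs n p₀) (Equivalence.from T-≡ tree-p₀)) (λ v _ → par-p₀ v)) ⟩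
      C
        ≈⟨ ≈-sym (*-identityʳ C) ⟩
      C * 1#
        ≈⟨ *-congˡ (≈-sym (≈-trans (K-empty es {μ θ} {acc} (λ {e} _ → decIf-no (alive? θ (proj₁ e) (proj₂ e)) dead))
              (base-tree {A = acc} (λ v → acc-conn (all-visited v)) (trans acc-length (trans (sym (ℕₚ.+-identityʳ d)) d+r))))) ⟩
      C * K es (μ θ) acc ∎
      where
      term : Vec V n → Carrier
      term p = if isSpanningTreeᵇ R G p then ind (consistent? θ p) (tw p) else 0#
      other : ∀ p → p ≢ p₀ → term p ≈ 0#
      other p ne with isSpanningTreeᵇ R G p
      ... | true  = ind-no (consistent? θ p) (λ c → ne (unique-p₀ (proj₁ c)))
      ... | false = ≈-refl
      dead : ∀ {i j} → ¬ Alive θ i j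
      dead {i} {j} (inj₁ (f , _)) = true≢false (all-visited j) f
      dead {i} {j} (inj₂ (f , _)) = true≢false (all-visited i) f
      ∈-allVecs : ∀ m (w : Vec V m) → w ∈ allVecs vs m
      ∈-allVecs zero    Vec.[]      = here refl
      ∈-allVecs (suc m) (x Vec.∷ w) = ∈-concatMap⁺ (λ x → List.map (x Vec.∷_) (allVecs vs m)) (lose (∈-allFin x) (∈-map⁺ (x Vec.∷_) (∈-allVecs m w)))

  module Stuck {r : ℕ} (σ : State (suc r) []) where
    open State σ

    -- With no active vertex an unvisited one can only hang from another unvisited one, so its path
    -- of parents never reaches 0. For the same reason live edges join unvisited vertices only, and
    -- the colouring `vis` makes `K` vanish.
    claim : ∀ θ → Claim θ
    claim θ = ≈-trans (SumR.⨁-ε trees (λ {p} p∈ → ind-no (consistent? θ p) (absurd p∈)))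
                      (≈-sym (≈-trans (*-congˡ (K-colouring es acc vis same colour {proj₁ someUnvisited} differ)) (zeroʳ C)))
      where
      someUnvisited : ∃ λ u → vis u ≡ false
      someUnvisited with Σℕ-pos vs (λ v → 𝟙 (not (vis v))) (subst (0 <_) (sym unvisited) (s≤s z≤n))
      ... | u , _ , l with vis u in eq
      ...   | false = u , eq
      absurd : ∀ {p} → p ∈ trees → ¬ Consistent θ p
      absurd {p} p∈ (_ , ok) = true≢false (trans (cong vis (tree-root {p} (isTree p∈) u)) vis-zero)
                                          (iterate-invariant (λ v → vis v ≡ false) escape n u-unvisited)
        where
        u = proj₁ someUnvisited
        u-unvisited = proj₂ someUnvisited
        escape : ∀ {v} → vis v ≡ false → vis (par p v) ≡ false
        escape {v} f with ok v f
        ... | inj₁ g = g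
        ... | inj₂ ()
      same : ∀ {u v} → (u , v) ∈ acc → vis u ≡ vis v
      same e∈ = let (f , g) = acc-vis e∈ in trans f (sym g)
      differ : vis zero ≢ vis (proj₁ someUnvisited)
      differ e = true≢false (trans (sym e) vis-zero) (proj₂ someUnvisited)
      colour : ∀ {i j} → (i , j) ∈ es → μ θ (i , j) ≡ 0 ⊎ vis i ≡ vis j
      colour {i} {j} _ with alive? θ i j
      ... | no dead = inj₁ (decIf-no (alive? θ i j) dead)
      ... | yes (inj₁ (f , inj₁ g)) = inj₂ (trans g (sym f))
      ... | yes (inj₂ (f , inj₁ g)) = inj₂ (trans f (sym g))

  pop : ∀ {r t st} → State r (t ∷ st) → State r st
  pop {r} {t} {st} σ = record
    { vis = vis ; π = π ; acc = acc ; d = d ; C = C ; d+r = d+r ; unvisited = unvisited ; vis-zero = vis-zero ; π-zero = π-zero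
    ; π-vis = π-vis ; π-depth = π-depth ; π-adjacent = π-adjacent ; st-vis = st-vis ∘ there ; st-unique = unique-tail st-unique
    ; st-chain = chain-tail st-chain ; acc-vis = acc-vis ; acc-conn = acc-conn ; acc-length = acc-length ; C-weight = C-weight }
    where
    open State σ
    unique-tail : Unique (t ∷ st) → Unique st
    unique-tail (_ ∷ u) = u

  module Candidate {r : ℕ} {t : V} {st : List V} (σ : State r (t ∷ st)) (c : V) where
    open State σ

    θ : ℕ
    θ = toℕ c

    Ok-weaken : ∀ {s u} → Ok θ s u → Ok (suc θ) s u
    Ok-weaken (inj₁ f) = inj₁ f
    Ok-weaken {s} {u} (inj₂ m) with ℕₚ.<-cmp (toℕ u) θ
    ... | tri< l _ _ = inj₂ (subst (s ∈_) (trans (accepting-< t st l) (sym (accepting-< t st (ℕₚ.m<n⇒m<1+n l)))) m)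
    ... | tri≈ _ e _ = inj₂ (subst (s ∈_) (sym (accepting-< t st (s≤s (ℕₚ.≤-reflexive e)))) (there (subst (s ∈_) (accepting-≥ t st (ℕₚ.≤-reflexive (sym e))) m)))
    ... | tri> _ _ g = inj₂ (subst (s ∈_) (trans (accepting-≥ t st (ℕₚ.<⇒≤ g)) (sym (accepting-≥ t st g))) m)

    Ok-strengthen : ∀ {s u} → Ok (suc θ) s u → ((s ≡ t) × (u ≡ c)) ⊎ Ok θ s u
    Ok-strengthen (inj₁ f) = inj₂ (inj₁ f)
    Ok-strengthen {s} {u} (inj₂ m) with ℕₚ.<-cmp (toℕ u) θ
    ... | tri< l _ _ = inj₂ (inj₂ (subst (s ∈_) (trans (accepting-< t st (ℕₚ.m<n⇒m<1+n l)) (sym (accepting-< t st l))) m))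
    ... | tri> _ _ g = inj₂ (inj₂ (subst (s ∈_) (trans (accepting-≥ t st g) (sym (accepting-≥ t st (ℕₚ.<⇒≤ g)))) m))
    ... | tri≈ _ e _ with subst (s ∈_) (accepting-< t st (s≤s (ℕₚ.≤-reflexive e))) m
    ...   | here refl = inj₁ (refl , Finₚ.toℕ-injective e)
    ...   | there m'  = inj₂ (inj₂ (subst (s ∈_) (sym (accepting-≥ t st (ℕₚ.≤-reflexive (sym e)))) m'))

    vis-t : vis t ≡ true
    vis-t = st-vis (here refl)

    accepts-t : Ok (suc θ) t c
    accepts-t = inj₂ (subst (t ∈_) (sym (accepting-< t st (ℕₚ.n<1+n θ))) (here refl))

    rejects-t : ¬ Ok θ t c
    rejects-t (inj₁ f) = true≢false vis-t f
    rejects-t (inj₂ m) with st-unique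
    ... | t∉ ∷ _ = All.lookup t∉ (accepting-⊆ st (toℕ t) c (subst (t ∈_) (accepting-≥ t st ℕₚ.≤-refl) m)) refl

    Consistent-weaken : ∀ {p} → Consistent θ p → Consistent (suc θ) p
    Consistent-weaken (agr , ok) = agr , λ u f → Ok-weaken (ok u f)

    Consistent-strengthen : ∀ {p} → Consistent (suc θ) p → (vis c ≡ false → par p c ≢ t) → Consistent θ p
    Consistent-strengthen {p} (agr , ok) ne = agr , λ u f → case Ok-strengthen (ok u f) of λ where
      (inj₁ (e , refl)) → ⊥-elim (ne f e)
      (inj₂ o)          → o

    Alive-weaken : ∀ {i j} → Alive θ i j → Alive (suc θ) i j
    Alive-weaken (inj₁ (f , o)) = inj₁ (f , Ok-weaken o)
    Alive-weaken (inj₂ (f , o)) = inj₂ (f , Ok-weaken o)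

    Alive-strengthen : ∀ {i j} → Alive (suc θ) i j → ¬ ((i ≡ t) × (j ≡ c) × (vis c ≡ false)) → ¬ ((j ≡ t) × (i ≡ c) × (vis c ≡ false)) → Alive θ i j
    Alive-strengthen (inj₁ (f , o)) n₁ n₂ = case Ok-strengthen o of λ where
      (inj₁ (e , refl)) → ⊥-elim (n₁ (e , refl , f))
      (inj₂ o')         → inj₁ (f , o')
    Alive-strengthen (inj₂ (f , o)) n₁ n₂ = case Ok-strengthen o of λ where
      (inj₁ (e , refl)) → ⊥-elim (n₂ (e , refl , f))
      (inj₂ o')         → inj₂ (f , o')

    -- Raising the threshold admits `c` below `t` only if `c` is unvisited, and then it has an
    -- effect only if the pair is an edge; so neither side changes.
    skip : (vis c ≡ false → G t c ≡ false) → Claim θ → Claim (suc θ)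
    skip na ih = begin
      SumR.⨁ trees (λ p → ind (consistent? (suc θ) p) (tw p))
        ≈⟨ SumR.⨁-cong trees (λ {p} p∈ → ind-⇔ (consistent? (suc θ) p) (consistent? θ p)
             (λ C → Consistent-strengthen {p} C (λ f e → true≢false (edge p∈ c refl f e) (na f))) Consistent-weaken) ⟩
      SumR.⨁ trees (λ p → ind (consistent? θ p) (tw p))
        ≈⟨ ih ⟩
      C * K es (μ θ) acc
        ≈⟨ *-congˡ (K-cong es acc (λ {e} → agree e)) ⟩
      C * K es (μ (suc θ)) acc ∎
      where
      edge : ∀ {p} → p ∈ trees → ∀ w → w ≡ c → vis w ≡ false → par p w ≡ t → G t w ≡ true
      edge p∈ zero    refl f e = ⊥-elim (true≢false vis-zero f)
      edge {p} p∈ (suc k) _ f e = trans (symmetric t (suc k)) (trans (cong (G (suc k)) (sym e)) (tree-adjacent {p} (isTree p∈) k))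
      agree : ∀ e → e ∈ es → μ θ e ≡ μ (suc θ) e
      agree (i , j) e∈ = decIf-⇔ (alive? θ i j) (alive? (suc θ) i j) Alive-weaken (λ al → Alive-strengthen al
        (λ { (refl , refl , f) → true≢false (proj₂ (∈-edges⁻ G e∈)) (na f) })
        (λ { (refl , refl , f) → true≢false (trans (symmetric t c) (proj₂ (∈-edges⁻ G e∈))) (na f) }))

    module Push (uc : vis c ≡ false) (tc : G t c ≡ true) where
      c≢visited : ∀ {v} → vis v ≡ true → v ≢ c
      c≢visited h refl = true≢false h uc

      c≢0 : c ≢ zero
      c≢0 e = c≢visited vis-zero (sym e)

      vis' : V → Bool
      vis' v = (v == c) ∨ vis v

      π' : V → V
      π' v = if v == c then t else π v

      vis'-c : vis' c ≡ true
      vis'-c = cong (_∨ vis c) (==-refl c)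

      vis'-≢ : ∀ {v} → v ≢ c → vis' v ≡ vis v
      vis'-≢ ne = cong (_∨ vis _) (==-≢ ne)

      vis'-old : ∀ {v} → vis v ≡ true → vis' v ≡ true
      vis'-old {v} h = ∨-trueʳ (v == c) h

      vis'-false : ∀ {v} → vis' v ≡ false → (v ≢ c) × (vis v ≡ false)
      vis'-false {v} f = ne , trans (sym (vis'-≢ ne)) f
        where
        ne : v ≢ c
        ne refl = true≢false vis'-c f

      vis'-split : ∀ {v} → vis' v ≡ true → (v ≡ c) ⊎ ((v ≢ c) × (vis v ≡ true))
      vis'-split {v} h = case (v Finₚ.≟ c) of λ where
        (yes e) → inj₁ e
        (no ne) → inj₂ (ne , trans (sym (vis'-≢ ne)) h)

      π'-c : π' c ≡ t
      π'-c = if-true (==-refl c)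

      π'-old : ∀ {v} → vis v ≡ true → π' v ≡ π v
      π'-old h = if-false (==-≢ (c≢visited h))

      iterate-π' : ∀ k {v} → vis v ≡ true → (iterate π' k v ≡ iterate π k v) × (vis (iterate π k v) ≡ true)
      iterate-π' zero    h = refl , h
      iterate-π' (suc k) h = let (e , h') = iterate-π' k h in trans (cong π' e) (π'-old h') , π-vis h'

      ws : List V
      ws = accepting (t ∷ st) θ c

      ws≡ : ws ≡ accepting st (toℕ t) c
      ws≡ = accepting-≥ t st ℕₚ.≤-refl

      C' : Carrier
      C' = C * ([ α c t ] * ProdR.⨁ ws (λ w → q ^ α w c))

      chain' : Chain π' (c ∷ t ∷ st)
      chain' = link c≢0 π'-c (chain-cong (λ x∈ → sym (π'-old (st-vis x∈))) st-chain)

      unique' : Unique (c ∷ t ∷ st)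
      unique' = All.tabulate (λ x∈ e → c≢visited (st-vis x∈) (sym e)) ∷ st-unique

      c∉ : c ∉ t ∷ st
      c∉ m = c≢visited (st-vis m) refl

      module _ {p : Vec V n} (p∈ : p ∈ trees) (agr : ∀ v → vis' v ≡ true → par p v ≡ π' v) where
        par-stack : ∀ {x} → x ∈ c ∷ t ∷ st → par p x ≡ π' x
        par-stack (here refl) = agr c vis'-c
        par-stack (there m)   = agr _ (vis'-old (st-vis m))

        chain-p : Chain (par p) (c ∷ t ∷ st)
        chain-p = chain-cong (λ m → sym (par-stack m)) chain'

        ancestor⇒∈ : ∀ k → iterate (par p) k c ∈ c ∷ t ∷ st
        ancestor⇒∈ k = iterate-invariant (_∈ c ∷ t ∷ st) (chain-closed refl chain-p) k (here refl)

        descendant-∈ : ∀ {i} → descendantᵇ R p c i ≡ true → i ∈ c ∷ t ∷ st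
        descendant-∈ {i} h = let (k , _ , e) = anyᵇ-elim {p = λ k → iterate (par p) k c == i} (List.upTo (suc n)) h in
          subst (_∈ c ∷ t ∷ st) (==-sound e) (ancestor⇒∈ k)

        ∈-descendant : ∀ {i} → i ∈ t ∷ st → i ≢ zero → descendantᵇ R p c i ≡ true
        ∈-descendant {i} i∈ ne with chain-reaches chain-p (there i∈)
        ... | k , e with k ℕₚ.<? suc n
        ...   | yes k<n = anyᵇ-intro {p = λ k → iterate (par p) k c == i} (∈-upTo⁺ k<n) (trans (cong (_== i) e) (==-refl i))
        -- From n steps on the iterated parent is 0, so a nonzero ancestor is met within the range
        -- searched by `descendantᵇ`.
        ...   | no k≮n  = ⊥-elim (ne (trans (sym e) (trans (cong (λ k → iterate (par p) k c) (sym (ℕₚ.m∸n+n≡m (ℕₚ.<⇒≤ (ℕₚ.≮⇒≥ k≮n)))))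
                (trans (iterate-+ (par p) (k ∸ n) n c) (trans (cong (iterate (par p) (k ∸ n)) (tree-root {p} (isTree p∈) c))
                  (iterate-invariant (_≡ zero) (λ { refl → refl }) (k ∸ n) refl))))))

        -- The proper ancestors of `c` form the stack, so `(i , c)` is an inversion exactly for the
        -- nonzero `i` on it with c < i, which is when the parent of `i` still accepts `c`.
        inversions-c : ProdR.⨁ vs (invFactor p c) ≈ ProdR.⨁ ws (λ w → q ^ α w c)
        inversions-c = begin
          ProdR.⨁ vs (invFactor p c)
            ≈⟨ ProdR.⨁-support st-unique outside ⟩
          ProdR.⨁ (t ∷ st) (invFactor p c)
            ≈⟨ ProdR.⨁-cong (t ∷ st) (λ {i} i∈ → reflexive (cong (if_then q ^ α (par p i) c else 1#) (inv-stack i i∈ (i Finₚ.≟ zero)))) ⟩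
          ProdR.⨁ (t ∷ st) (λ i → if not (i == zero) ∧ (toℕ c <ᵇ toℕ i) then q ^ α (par p i) c else 1#)
            ≈⟨ chain-inversions c (chain-tail chain-p) ⟩
          ProdR.⨁ (accepting st (toℕ t) c) (λ w → q ^ α w c)
            ≈⟨ reflexive (cong (λ l → ProdR.⨁ l (λ w → q ^ α w c)) (sym ws≡)) ⟩
          ProdR.⨁ ws (λ w → q ^ α w c) ∎
          where
          outside : ∀ i → i ∉ t ∷ st → invFactor p c i ≈ 1#
          outside i i∉ = reflexive (if-false (¬true⇒false (λ h →
            let (_ , h₂) = ∧-true {not (i == zero)} h ; (l , ds) = ∧-true {toℕ c <ᵇ toℕ i} h₂ in
            case descendant-∈ ds of λ where
              (here refl) → ℕₚ.<-irrefl refl (<ᵇ-sound {toℕ c} l)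
              (there m)   → i∉ m)))
          inv-stack : ∀ i → i ∈ t ∷ st → Dec (i ≡ zero) → isInversionᵇ R p (i , c) ≡ (not (i == zero) ∧ (toℕ c <ᵇ toℕ i))
          inv-stack i i∈ (yes refl) = refl
          inv-stack i i∈ (no ne)    = cong (not (i == zero) ∧_) (trans (cong ((toℕ c <ᵇ toℕ i) ∧_) (∈-descendant i∈ ne)) (Boolₚ.∧-identityʳ _))

        weight-c : weight p c ≈ [ α c t ] * ProdR.⨁ ws (λ w → q ^ α w c)
        weight-c = *-cong (edge c refl) inversions-c
          where
          edge : ∀ w → w ≡ c → edgeFactor p w ≈ [ α c t ]
          edge zero    e    = ⊥-elim (c≢0 (sym e))
          edge (suc k) refl = reflexive (cong (λ z → [ α c z ]) (trans (agr c vis'-c) π'-c))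

        C'-weight : C' ≈ ProdR.⨁ vs (λ v → if vis' v then weight p v else 1#)
        C'-weight = begin
            C'
              ≈⟨ *-cong (C-weight p∈ (λ v h → trans (agr v (vis'-old h)) (π'-old h))) (≈-sym weight-c) ⟩
            ProdR.⨁ vs old * weight p c
              ≈⟨ *-congˡ (≈-sym (≈-trans (ProdR.⨁-allFin-single c {extra} (λ v ne → reflexive (if-false (==-≢ ne)))) (reflexive (if-true (==-refl c))))) ⟩
            ProdR.⨁ vs old * ProdR.⨁ vs extra
              ≈⟨ ≈-sym (ProdR.⨁-∙ vs old extra) ⟩
            ProdR.⨁ vs (λ v → old v * extra v)
              ≈⟨ ProdR.⨁-cong vs (λ {v} _ → pt v (v Finₚ.≟ c)) ⟩
            ProdR.⨁ vs (λ v → if vis' v then weight p v else 1#) ∎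
          where
          old extra : V → Carrier
          old v   = if vis v then weight p v else 1#
          extra v = if v == c then weight p c else 1#
          pt : ∀ v → Dec (v ≡ c) → old v * extra v ≈ (if vis' v then weight p v else 1#)
          pt v (yes refl) = ≈-trans (*-cong (reflexive (if-false uc)) (reflexive (if-true (==-refl c))))
            (≈-trans (*-identityˡ (weight p c)) (reflexive (sym (if-true vis'-c))))
          pt v (no ne) = ≈-trans (*-congˡ (reflexive (if-false (==-≢ ne)))) (≈-trans (*-identityʳ (old v)) (reflexive (cong (if_then weight p v else 1#) (sym (vis'-≢ ne)))))

      unvisited' : suc (Σℕ vs (λ v → 𝟙 (not (vis' v)))) ≡ r
      unvisited' = trans (sym split) unvisited
        where
        split : Σℕ vs (λ v → 𝟙 (not (vis v))) ≡ suc (Σℕ vs (λ v → 𝟙 (not (vis' v))))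
        split = trans (Sumℕ.⨁-cong vs (λ {v} _ → pt v (v Finₚ.≟ c))) (trans (Sumℕ.⨁-∙ vs (λ v → 𝟙 (v == c)) (λ v → 𝟙 (not (vis' v))))
          (cong (ℕ._+ Σℕ vs (λ v → 𝟙 (not (vis' v)))) (trans (Sumℕ.⨁-allFin-single c (λ v ne → cong 𝟙 (==-≢ ne))) (cong 𝟙 (==-refl c)))))
          where
          pt : ∀ v → Dec (v ≡ c) → 𝟙 (not (vis v)) ≡ 𝟙 (v == c) ℕ.+ 𝟙 (not (vis' v))
          pt v (yes refl) = trans (cong (𝟙 ∘ not) uc) (sym (cong₂ ℕ._+_ (cong 𝟙 (==-refl c)) (cong (𝟙 ∘ not) vis'-c)))
          pt v (no ne)    = sym (cong₂ ℕ._+_ (cong 𝟙 (==-≢ ne)) (cong (𝟙 ∘ not) (vis'-≢ ne)))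

      push : ∀ {r'} → r ≡ suc r' → State r' (c ∷ t ∷ st)
      push {r'} r≡ = record
        { vis = vis' ; π = π' ; acc = edgeOf t c ∷ acc ; d = suc d ; C = C'
        ; d+r = trans (sym (ℕₚ.+-suc d r')) (trans (cong (d ℕ.+_) (sym r≡)) d+r)
        ; unvisited = ℕₚ.suc-injective (trans unvisited' r≡)
        ; vis-zero = vis'-old vis-zero
        ; π-zero = trans (π'-old vis-zero) π-zero
        ; π-vis = λ h → case vis'-split h of λ where
            (inj₁ refl)    → trans (cong vis' π'-c) (vis'-old vis-t)
            (inj₂ (_ , o)) → trans (cong vis' (π'-old o)) (vis'-old (π-vis o))
        ; π-depth = λ {v} h → trans (sym (iterate-shift π' d v)) (case vis'-split h of λ where
            (inj₁ refl)    → trans (cong (iterate π' d) π'-c) (depth vis-t)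
            (inj₂ (_ , o)) → trans (cong (iterate π' d) (π'-old o)) (depth (π-vis o)))
        ; π-adjacent = λ h ne → case vis'-split h of λ where
            (inj₁ refl)    → trans (cong (G c) π'-c) (trans (symmetric c t) tc)
            (inj₂ (_ , o)) → trans (cong (G _) (π'-old o)) (π-adjacent o ne)
        ; st-vis = λ { (here refl) → vis'-c ; (there m) → vis'-old (st-vis m) }
        ; st-unique = unique'
        ; st-chain = chain'
        ; acc-vis = λ { (here e) → edge-vis e ; (there m) → let (x , y) = acc-vis m in vis'-old x , vis'-old y }
        ; acc-conn = λ h → case vis'-split h of λ where
            (inj₁ refl)    → ctrans (Conn-there (acc-conn vis-t)) (Conn-edgeOf t c)
            (inj₂ (_ , o)) → Conn-there (acc-conn o)
        ; acc-length = cong suc acc-length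
        ; C-weight = C'-weight
        }
        where
        depth : ∀ {v} → vis v ≡ true → iterate π' d v ≡ zero
        depth h = trans (proj₁ (iterate-π' d h)) (π-depth h)
        edge-vis : ∀ {u v} → (u , v) ≡ edgeOf t c → (vis' u ≡ true) × (vis' v ≡ true)
        edge-vis e with toℕ t <ᵇ toℕ c
        edge-vis refl | true  = vis'-c , vis'-old vis-t
        edge-vis refl | false = vis'-old vis-t , vis'-c

      module _ {r' : ℕ} (r≡ : r ≡ suc r') where
        private module σ' = State (push r≡)

        accepting-all : ∀ u → accepting (c ∷ t ∷ st) (suc n) u ≡ c ∷ accepting (t ∷ st) θ u
        accepting-all u = accepting-< c (t ∷ st) (Finₚ.toℕ<n u)

        -- Before the push `c` qualifies as a parent because it is unvisited, after it as a fresh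
        -- top whose threshold `suc n` exceeds all labels. For the other vertices nothing changes.
        Ok-push : ∀ {s u} → Ok θ s u → σ'.Ok (suc n) s u
        Ok-push {s} {u} (inj₂ m) = inj₂ (subst (s ∈_) (sym (accepting-all u)) (there m))
        Ok-push {s} {u} (inj₁ f) = case (s Finₚ.≟ c) of λ where
          (yes refl) → inj₂ (subst (s ∈_) (sym (accepting-all u)) (here refl))
          (no ne)    → inj₁ (trans (vis'-≢ ne) f)

        Ok-pull : ∀ {s u} → σ'.Ok (suc n) s u → Ok θ s u
        Ok-pull (inj₁ f) = inj₁ (proj₂ (vis'-false f))
        Ok-pull {s} {u} (inj₂ m) with subst (s ∈_) (accepting-all u) m
        ... | here refl = inj₁ uc
        ... | there m'  = inj₂ m'

        Consistent-pull : ∀ {p} → σ'.Consistent (suc n) p → Consistent (suc θ) p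
        Consistent-pull {p} (agr , ok) = (λ v h → trans (agr v (vis'-old h)) (π'-old h)) , λ u f → case (u Finₚ.≟ c) of λ where
          (yes refl) → subst (λ s → Ok (suc θ) s u) (sym (trans (agr u vis'-c) π'-c)) accepts-t
          (no ne)    → Ok-weaken (Ok-pull (ok u (trans (vis'-≢ ne) f)))

        Consistent-push : ∀ {p} → Consistent (suc θ) p → par p c ≡ t → σ'.Consistent (suc n) p
        Consistent-push {p} (agr , ok) e = agr' , λ u f → let (ne , f') = vis'-false f in
            case Ok-strengthen (ok u f') of λ where
              (inj₁ (_ , u≡c)) → ⊥-elim (ne u≡c)
              (inj₂ o)         → Ok-push o
          where
          agr' : σ'.Agrees p
          agr' v h = case vis'-split h of λ where
            (inj₁ refl)    → trans e (sym π'-c)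
            (inj₂ (_ , o)) → trans (agr v o) (sym (π'-old o))

        -- An edge between `c` and an unvisited `s` survives the visit of `c` with the roles
        -- exchanged: now `s` may hang from `c`. The edges to `ws` are the only ones lost.
        Alive-push : ∀ {i j} → toℕ j < toℕ i → (∀ {w} → w ∈ ws → (i , j) ≢ edgeOf w c) → Alive θ i j → σ'.Alive (suc n) i j
        Alive-push {i} {j} j<i off = λ where
            (inj₁ (f , o)) → go f o (λ e → ℕₚ.<⇒≢ j<i (cong toℕ (sym e))) (λ { refl m → off m (sym (edgeOf-> j<i)) }) inj₁ inj₂
            (inj₂ (f , o)) → go f o (λ e → ℕₚ.<⇒≢ j<i (cong toℕ e)) (λ { refl m → off m (sym (edgeOf-< j<i)) }) inj₂ inj₁
          where
          go : ∀ {s u} {Z : Set} → vis u ≡ false → Ok θ s u → s ≢ u → (u ≡ c → s ∉ ws) →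
               (σ'.Attach (suc n) s u → Z) → (σ'.Attach (suc n) u s → Z) → Z
          go {s} {u} f o s≢u no-loop k₁ k₂ = case (u Finₚ.≟ c) of λ where
            (no ne)    → k₁ (trans (vis'-≢ ne) f , Ok-push o)
            (yes refl) → case o of λ where
              (inj₂ m) → ⊥-elim (no-loop refl m)
              (inj₁ g) → k₂ (trans (vis'-≢ s≢u) g , inj₂ (subst (c ∈_) (sym (accepting-all s)) (here refl)))

        Alive-pull : ∀ {i j} → σ'.Alive (suc n) i j → Alive θ i j
        Alive-pull (inj₁ (f , o)) = inj₁ (proj₂ (vis'-false f) , Ok-pull o)
        Alive-pull (inj₂ (f , o)) = inj₂ (proj₂ (vis'-false f) , Ok-pull o)

        ws-vis : ∀ {w} → w ∈ ws → vis w ≡ true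
        ws-vis w∈ = st-vis (accepting-⊆ (t ∷ st) θ c w∈)

        edge-value : ∀ θ' {w} → Ok θ' w c → μ θ' (edgeOf w c) ≡ α w c
        edge-value θ' {w} o = trans (decIf-yes (alive? θ' (proj₁ e) (proj₂ e)) al) (cong (aAt a) (edgeOf-max w c))
          where
          e = edgeOf w c
          al : Alive θ' (proj₁ e) (proj₂ e)
          al with toℕ w <ᵇ toℕ c
          ... | true  = inj₂ (uc , o)
          ... | false = inj₁ (uc , o)

        -- Once `c` is joined to `t`, its edges to `ws` have both ends in the visited tree. The
        -- factor they release is the inversion factor of `c` contained in `C'`.
        loops : K es (μ θ) (edgeOf t c ∷ acc) ≈ ProdR.⨁ ws (λ w → q ^ α w c) * K es (σ'.μ (suc n)) (edgeOf t c ∷ acc)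
        loops = ≈-trans (K-remove-loops ws {μ θ} {σ'.μ (suc n)} (edgeOf t c ∷ acc) c (accepting-unique (t ∷ st) θ c st-unique)
            (λ {w} w∈ → chain-adjacent (λ x∈ → π-adjacent (st-vis x∈)) c∉ st-chain (subst (w ∈_) ws≡ w∈))
            (λ w∈ → ctrans (Conn-there (ctrans (csym (acc-conn (ws-vis w∈))) (acc-conn vis-t))) (Conn-edgeOf t c))
            (λ {w} w∈ → decIf-no (σ'.alive? (suc n) _ _) (dead w∈))
            (λ {e} → agree e))
            (*-congʳ (ProdR.⨁-cong ws (λ {w} w∈ → reflexive (cong (q ^_) (edge-value θ (inj₂ w∈))))))
          where
          dead : ∀ {w} → w ∈ ws → ¬ σ'.Alive (suc n) (proj₁ (edgeOf w c)) (proj₂ (edgeOf w c))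
          dead {w} w∈ with toℕ w <ᵇ toℕ c
          ... | true  = λ { (inj₁ (f , _)) → true≢false (vis'-old (ws-vis w∈)) f ; (inj₂ (f , _)) → true≢false vis'-c f }
          ... | false = λ { (inj₁ (f , _)) → true≢false vis'-c f ; (inj₂ (f , _)) → true≢false (vis'-old (ws-vis w∈)) f }
          agree : ∀ e → e ∈ es → (∀ {w} → w ∈ ws → e ≢ edgeOf w c) → σ'.μ (suc n) e ≡ μ θ e
          agree (i , j) e∈ off = decIf-⇔ (σ'.alive? (suc n) i j) (alive? θ i j) Alive-pull (Alive-push (proj₁ (∈-edges⁻ G e∈)) off)

        -- Trees are divided by whether `t` is the parent of `c`. If not, the bundle between them is
        -- deleted; if so, it is contracted and the search goes on from `c`.
        branch : Claim θ → σ'.Claim (suc n) → Claim (suc θ)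
        branch ih₁ ih₂ = begin
            SumR.⨁ trees (λ p → ind (consistent? (suc θ) p) (tw p))
              ≈⟨ SumR.⨁-cong trees (λ {p} _ → ind-split (consistent? (suc θ) p) (consistent? θ p) (σ'.consistent? (suc n) p)
                   Consistent-weaken (Consistent-pull {p}) (disjoint {p})
                   (λ C ¬Q ¬S → ⊥-elim (¬Q (Consistent-strengthen {p} C (λ _ e → ¬S (Consistent-push {p} C e)))))) ⟩
            SumR.⨁ trees (λ p → ind (consistent? θ p) (tw p) + ind (σ'.consistent? (suc n) p) (tw p))
              ≈⟨ SumR.⨁-∙ trees (λ p → ind (consistent? θ p) (tw p)) (λ p → ind (σ'.consistent? (suc n) p) (tw p)) ⟩
            SumR.⨁ trees (λ p → ind (consistent? θ p) (tw p)) + SumR.⨁ trees (λ p → ind (σ'.consistent? (suc n) p) (tw p))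
              ≈⟨ +-cong ih₁ ih₂ ⟩
            C * K es (μ θ) acc + C' * k'
              ≈⟨ +-congˡ (≈-trans (*-assoc C ([ α c t ] * P) k') (*-congˡ (≈-trans (*-assoc [ α c t ] P k') (*-congˡ (≈-sym loops))))) ⟩
            C * K es (μ θ) acc + C * ([ α c t ] * K es (μ θ) (e ∷ acc))
              ≈⟨ ≈-sym (distribˡ C (K es (μ θ) acc) ([ α c t ] * K es (μ θ) (e ∷ acc))) ⟩
            C * (K es (μ θ) acc + [ α c t ] * K es (μ θ) (e ∷ acc))
              ≈⟨ *-congˡ (+-congˡ (*-congʳ (reflexive (cong [_] (trans (α-comm c t) (sym (edge-value (suc θ) accepts-t))))))) ⟩
            C * (K es (μ θ) acc + [ μ (suc θ) e ] * K es (μ θ) (e ∷ acc))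
              ≈⟨ *-congˡ (≈-sym (K-delete-contract {es = es} {μ (suc θ)} {μ θ} {e} acc (edges-unique G) (edgeOf-∈ tc) dead (λ {f} → agree f))) ⟩
            C * K es (μ (suc θ)) acc ∎
          where
          e : Edge n
          e = edgeOf t c
          P k' : Carrier
          P  = ProdR.⨁ ws (λ w → q ^ α w c)
          k' = K es (σ'.μ (suc n)) (e ∷ acc)
          disjoint : ∀ {p} → Consistent θ p → σ'.Consistent (suc n) p → ⊥
          disjoint (_ , ok) (agr , _) = rejects-t (subst (λ s → Ok θ s c) (trans (agr c vis'-c) π'-c) (ok c uc))
          dead : μ θ e ≡ 0
          dead = decIf-no (alive? θ (proj₁ e) (proj₂ e)) ¬al
            where
            ¬al : ¬ Alive θ (proj₁ e) (proj₂ e)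
            ¬al with toℕ t <ᵇ toℕ c
            ... | true  = λ { (inj₁ (f , _)) → true≢false vis-t f ; (inj₂ (_ , o)) → rejects-t o }
            ... | false = λ { (inj₁ (_ , o)) → rejects-t o ; (inj₂ (f , _)) → true≢false vis-t f }
          agree : ∀ f → f ∈ es → f ≢ e → μ θ f ≡ μ (suc θ) f
          agree (i , j) f∈ ne = decIf-⇔ (alive? θ i j) (alive? (suc θ) i j) Alive-weaken (λ al → Alive-strengthen al
            (λ { (refl , refl , _) → ne (sym (edgeOf-> (proj₁ (∈-edges⁻ G f∈)))) })
            (λ { (refl , refl , _) → ne (sym (edgeOf-< (proj₁ (∈-edges⁻ G f∈)))) }))

  private
    advance : ∀ {r} → (∀ {r'} → r ≡ suc r' → ∀ st (σ : State r' st) θ → θ ≤ suc n → State.Claim σ θ) →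
              ∀ {t st} (σ : State r (t ∷ st)) θ → θ < suc n → State.Claim σ θ → State.Claim σ (suc θ)
    advance {r} ih {t} {st} σ θ le smaller = subst (λ k → Claim (suc k)) c≡ (cases (vis c) refl (G t c) refl r refl)
      where
      open State σ
      c : V
      c = Fin.fromℕ< le
      c≡ : toℕ c ≡ θ
      c≡ = Finₚ.toℕ-fromℕ< le
      smaller' : Claim (toℕ c)
      smaller' = subst Claim (sym c≡) smaller
      open Candidate σ c
      cases : ∀ b → vis c ≡ b → ∀ g → G t c ≡ g → ∀ r' → r ≡ r' → Claim (suc (toℕ c))
      cases true  vc _     _  _        _   = skip (λ f → ⊥-elim (true≢false vc f)) smaller'
      cases false uc false tc _        _   = skip (λ _ → tc) smaller'
      cases false uc true  tc zero     r≡  = ⊥-elim (ℕₚ.1+n≢0 (trans (Push.unvisited' uc tc) r≡))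
      cases false uc true  tc (suc r') r≡  = Push.branch uc tc r≡ smaller' (ih r≡ (c ∷ t ∷ st) (Push.push uc tc r≡) (suc n) ℕₚ.≤-refl)

    -- The induction is lexicographic: a push lowers the number `r` of unvisited vertices while
    -- stack and threshold grow, a pop shortens the stack, and passing over a candidate lowers θ.
    process : ∀ r → (∀ {r'} → r ≡ suc r' → ∀ st (σ : State r' st) θ → θ ≤ suc n → State.Claim σ θ) →
              ∀ st (σ : State r st) θ → θ ≤ suc n → State.Claim σ θ
    process zero    ih []       σ θ       _  = Complete.claim σ θ
    process (suc r) ih []       σ θ       _  = Stuck.claim σ θ
    -- At threshold 0 the top accepts nobody, and the claim is by computation that of the popped
    -- stack, whose new top has already tried every candidate from `t` upwards.
    process r       ih (t ∷ st) σ zero    _  = process r ih st (pop σ) (toℕ t) (ℕₚ.<⇒≤ (Finₚ.toℕ<n t))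
    process r       ih (t ∷ st) σ (suc θ) le = advance ih σ θ le (process r ih (t ∷ st) σ θ (ℕₚ.<⇒≤ le))

    dfs : ∀ r st (σ : State r st) θ → θ ≤ suc n → State.Claim σ θ
    dfs zero    = process zero (λ ())
    dfs (suc r) = process (suc r) (λ { refl → dfs r })

  trees-K : SumR.⨁ trees tw ≈ K es (aAt a ∘ proj₁) []
  trees-K = begin
      SumR.⨁ trees tw
        ≈⟨ SumR.⨁-cong trees (λ {p} _ → ≈-sym (ind-yes (State.consistent? start (suc n) p) (consistent p))) ⟩
      SumR.⨁ trees (λ p → ind (State.consistent? start (suc n) p) (tw p))
        ≈⟨ dfs n (zero ∷ []) start (suc n) ℕₚ.≤-refl ⟩
      1# * K es (State.μ start (suc n)) []
        ≈⟨ *-identityˡ (K es (State.μ start (suc n)) []) ⟩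
      K es (State.μ start (suc n)) []
        ≈⟨ K-cong es [] (λ {e} → all-alive e) ⟩
      K es (aAt a ∘ proj₁) [] ∎
    where
    isZero : V → Bool
    isZero v = v == zero
    weight-zero : ∀ p → 1# ≈ ProdR.⨁ vs (λ v → if isZero v then weight p v else 1#)
    weight-zero p = ≈-sym (≈-trans (ProdR.⨁-allFin-single zero {λ v → if isZero v then weight p v else 1#} (λ v ne → reflexive (if-false (==-≢ ne))))
        (≈-trans (*-identityˡ (ProdR.⨁ vs (invFactor p zero))) (ProdR.⨁-ε vs (λ {i} _ → reflexive (if-false (¬true⇒false (no-inversion i)))))))
      where
      no-inversion : ∀ i → ¬ (isInversionᵇ R p (i , zero) ≡ true)
      no-inversion i h = let (nz , h₂) = ∧-true {not (i == zero)} h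
                             (k , _ , e) = anyᵇ-elim {p = λ k → iterate (par p) k zero == i} (List.upTo (suc n)) (proj₂ (∧-true {0 <ᵇ toℕ i} h₂))
                             i≡0 = trans (sym (==-sound e)) (iterate-invariant (_≡ zero) (λ { refl → refl }) k refl)
                         in true≢false nz (cong not (trans (cong (_== zero) i≡0) (==-refl {suc n} zero)))
    start : State n (zero ∷ [])
    start = record
      { vis = isZero ; π = λ _ → zero ; acc = [] ; d = 0 ; C = 1#
      ; d+r = refl
      ; unvisited = trans (Sumℕ.⨁-allFin-suc n (λ v → 𝟙 (not (isZero v))))
          (trans (Σℕ-const (allFin n) 1) (trans (ℕₚ.*-identityʳ _) (length-allFin n)))
      ; vis-zero = refl ; π-zero = refl ; π-vis = λ _ → refl
      ; π-depth = ==-sound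
      ; π-adjacent = λ h ne → ⊥-elim (ne (==-sound h))
      ; st-vis = λ { (here refl) → refl }
      ; st-unique = [] ∷ []
      ; st-chain = root
      ; acc-vis = λ ()
      ; acc-conn = λ h → subst (Conn [] zero) (sym (==-sound h)) crefl
      ; acc-length = refl
      ; C-weight = λ {p} _ _ → weight-zero p
      }
    ok : ∀ s u → State.Ok start (suc n) s u
    ok zero    u = inj₂ (subst (zero ∈_) (sym (accepting-< zero [] (Finₚ.toℕ<n u))) (here refl))
    ok (suc k) u = inj₁ refl
    consistent : ∀ p → State.Consistent start (suc n) p
    consistent p = (λ { zero _ → refl }) , λ u _ → ok (par p u) u
    all-alive : ∀ e → e ∈ es → State.μ start (suc n) e ≡ aAt a (proj₁ e)
    all-alive (suc k , j) e∈ = decIf-yes (State.alive? start (suc n) (suc k) j) (inj₂ (refl , ok j (suc k)))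
    all-alive (zero , j)  e∈ = case proj₁ (∈-edges⁻ G e∈) of λ ()

-- The Tutte polynomial of the multigraph, and conclusion

module _ {n : ℕ} {G : Graph n} (sh : IsShifted G) (a : Fin n → ℕ) (a≥1 : ∀ k → 1 ≤ a k) where
  open IsShifted sh

  private
    mult : Edge n → ℕ
    mult e = aAt a (maxV (proj₁ e) (proj₂ e))

    mult≥1 : ∀ {i j} → toℕ j < toℕ i → 1 ≤ mult (i , j)
    mult≥1 {suc k} {j} lt = subst (1 ≤_) (cong (aAt a) (sym (maxV-≥ (ℕₚ.<⇒≤ lt)))) (a≥1 k)

    ∈-replicate : ∀ {m} (e : Edge n) → 1 ≤ m → e ∈ List.replicate m e
    ∈-replicate e (s≤s _) = here refl

    ∈-multiEdges : ∀ {i j} → toℕ j < toℕ i → G i j ≡ true → (i , j) ∈ multiEdges G a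
    ∈-multiEdges lt g = ∈-concatMap⁺ (λ e → List.replicate (mult e) e) (lose (∈-edges⁺ G lt g) (∈-replicate _ (mult≥1 lt)))

  -- Since the multiplicities are positive, at least one copy of each edge of G is present.
  walk⇒Conn : ∀ {u v} → Walk G u v → Conn (multiEdges G a) u v
  walk⇒Conn here = crefl
  walk⇒Conn (step {u} {v} g w) with ordered (adjacent⇒≢ g)
  ... | isLt l = ctrans (csym (cedge (∈-multiEdges l (trans (symmetric v u) g)))) (walk⇒Conn w)
  ... | isGt l = ctrans (cedge (∈-multiEdges l g)) (walk⇒Conn w)

  module _ {c ℓ} (R : CommutativeRing c ℓ) (q : CommutativeRing.Carrier R) where
    open WeightedSubgraphs R q
    open import Relation.Binary.Reasoning.Setoid setoid using (begin_; step-≈-⟩; _∎)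

    tutte-K : Connected G → tutte R (multiEdges G a) 1# q ≈ K (edges G) (aAt a ∘ proj₁) []
    tutte-K conn = begin
      tutte R (multiEdges G a) 1# q       ≈⟨ tutte-1q (multiEdges G a) (components-connected (multiEdges G a) (connected-intro (λ v → walk⇒Conn (conn zero v)))) ⟩
      subsets (multiEdges G a) []         ≈⟨ subsets-multi (edges G) mult [] ⟩
      K (edges G) mult []                 ≈⟨ K-cong (edges G) [] (λ e∈ → cong (aAt a) (maxV-≥ (ℕₚ.<⇒≤ (proj₁ (∈-edges⁻ G e∈))))) ⟩
      K (edges G) (aAt a ∘ proj₁) []      ∎

theorem3p11 : ∀ {c ℓ : Level} (R : CommutativeRing c ℓ) (q : CommutativeRing.Carrier R)
    (n : ℕ) (G : Graph n) → IsThreshold G → ReverseDegreeLabeled G →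
    (a : Fin n → ℕ) → (∀ k → 1 ≤ a k) →
    (L : List (Vec ℕ (nE G))) → Unique L → (∀ x → (x ∈ L) ⇔ IsIntFlow G a x) →
    (Connected G →
       CommutativeRing._≈_ R (EhrOver R q (CommutativeRing.1# R) G L)
                             (tutte R (multiEdges G a) (CommutativeRing.1# R) q))
    × CommutativeRing._≈_ R (EhrOver R q (CommutativeRing.1# R) G L)
                            (Σᴿ R (spanningTrees R G) (treeWeight R q a))
theorem3p11 R q n G th rev a a≥1 L uL mem =
    (λ conn → ≈-trans Ehr-K (≈-sym (tutte-K sh a a≥1 R q conn))) , ≈-trans Ehr-K (≈-sym (Trees.trees-K R q G sh a))
  where
  open WeightedSubgraphs R q
  sh : IsShifted G
  sh = threshold⇒shifted th rev
  Ehr-K : EhrOver R q 1# G L ≈ K (edges G) (aAt a ∘ proj₁) []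
  Ehr-K = Flows.Ehr-K R q G sh a a≥1 L uL mem
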